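{- Let $\ell$ be a line of $\mathrm{PG}(8,q)$ fixed by $\sigma$. Then $\ell$ is one of the following three types: (a) $\ell$ is fixed pointwise; then $\ell$ meets $q+1$ $\mathbb S_{\mathrm I}$-planes and is contained in a ptwise-fixed plane (a ptwise-fixed line); (b) $\ell$ contains $\mathrm n+1$ fixed points and $q-\mathrm n$ I$_{\vdots}$-points, and $\ell$ is contained in an $\mathbb S_{\mathrm I}$-plane (a fixed-I-line); (c) $\ell$ contains $\mathrm n+1$ fixed points and $q-\mathrm n$ II$_{\vdots}$-points, $\ell$ meets $\mathrm n+1$ $\mathbb S_{\mathrm I}$-planes and $q-\mathrm n$ $\mathbb S_{\mathrm{II}}$-planes, and $\ell$ is contained in a unique $\mathbb H$-5-space, which is an $\mathbb H_{\mathrm I}$-5-space (a fixed-II-line).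
   Context: Let $q>2$ be a prime power, $\mathrm n\in\{ -1,0,1\}$ with $q\equiv\mathrm n\pmod 3$. Let $\phi$ be a collineation of $\mathrm{PG}(2,q^3)$ of order 3 fixing pointwise an $\mathbb F_q$-subplane $\mathcal P_{2,q}$. A point $\bar P$ of $\mathrm{PG}(2,q^3)$ has Type I if in $\mathcal P_{2,q}$, Type II if $\bar P,\bar P^\phi,\bar P^{\phi^2}$ are distinct and collinear, Type III if non-collinear; a line has Type I, II, III if it meets $\mathcal P_{2,q}$ in $q+1$, one, zero points. Bose representation: identifying $\mathbb F_{q^3}^3$ with $\mathbb F_q^9$, each point $\bar P$ corresponds to a plane $[\![P]\!]$ of $\mathrm{PG}(8,q)$ (an $\mathbb S$-plane), each line $\bar\ell$ to the 5-space $[\![\ell]\!]$ spanned by the $\mathbb S$-planes of its points (an $\mathbb H$-5-space); these inherit the types ($\mathbb S_X$-planes, $\mathbb H_X$-5-spaces). $\phi$ induces a projectivity $\sigma$ of $\mathrm{PG}(8,q)$ of order 3 with $[\![P]\!]^\sigma=[\![P^\phi]\!]$. A point is an X-point if its $\mathbb S$-plane is an $\mathbb S_X$-plane. A fixed point is a point fixed by $\sigma$; a I-point $A$ is a I$_{\vdots}$-point if $A,A^\sigma,A^{\sigma^2}$ are distinct and collinear; a II-point $B$ is a II$_{\vdots}$-point if $B,B^\sigma,B^{\sigma^2}$ are collinear. A ptwise-fixed plane is a plane fixed pointwise by $\sigma$. -}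

module Defs where

open import Data.Nat using (ℕ) renaming (_^_ to _^ℕ_; _≤_ to _≤ℕ_)
open import Data.Nat.Primality using (Prime)
open import Data.Fin using (Fin; zero; suc)
open import Data.Maybe using (Maybe; just; nothing)
open import Data.List using (List; length)
open import Data.List.Membership.Propositional using (_∈_)
open import Data.List.Relation.Unary.Unique.Propositional using (Unique)
open import Data.List.Relation.Unary.All using (All)
open import Data.List.Relation.Unary.Any using (Any)
open import Data.List.Relation.Unary.AllPairs using (AllPairs)
open import Data.Product using (Σ; ∃; ∃-syntax; _×_; _,_)
open import Data.Integer using (ℤ; +_)
open import Relation.Nullary using (¬_)
open import Relation.Binary.PropositionalEquality using (_≡_)
open import Function.Bundles using (_⇔_)
open import Algebra.Structures using (IsCommutativeRing)

record Field : Set₁ where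
  infixl 7 _*_
  infixl 6 _+_
  field
    Carrier : Set
    _+_ _*_ : Carrier → Carrier → Carrier
    -_      : Carrier → Carrier
    0# 1#   : Carrier
    isCommutativeRing : IsCommutativeRing _≡_ _+_ _*_ -_ 0# 1#
    0≢1     : ¬ (0# ≡ 1#)
    inverse : ∀ x → ¬ (x ≡ 0#) → ∃[ y ] (x * y ≡ 1#)

HasSize : Field → ℕ → Set
HasSize F q = Σ (List Carrier) λ xs → length xs ≡ q × Unique xs × (∀ x → x ∈ xs)
  where open Field F

IsPrimePower : ℕ → Set
IsPrimePower q = Σ ℕ λ p → Σ ℕ λ k → Prime p × 1 ≤ℕ k × q ≡ p ^ℕ k

Σ3 : {A : Set} → (A → A → A) → (Fin 3 → A) → A
Σ3 _⊕_ f = (f zero ⊕ f (suc zero)) ⊕ f (suc (suc zero))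

record CubicExt (F : Field) : Set₁ where
  module F = Field F
  field
    E     : Field
  module E = Field E
  field
    emb   : F.Carrier → E.Carrier
    emb-+ : ∀ a b → emb (a F.+ b) ≡ emb a E.+ emb b
    emb-* : ∀ a b → emb (a F.* b) ≡ emb a E.* emb b
    emb-1 : emb F.1# ≡ E.1#
    basis : Fin 3 → E.Carrier
    basis-span  : ∀ e → ∃ λ (c : Fin 3 → F.Carrier) → (e ≡ Σ3 E._+_ (λ i → emb (c i) E.* basis i))
    basis-indep : ∀ (c : Fin 3 → F.Carrier) →
                  Σ3 E._+_ (λ i → emb (c i) E.* basis i) ≡ E.0# → ∀ i → c i ≡ F.0#

HasExactly : (A : Set) → (A → A → Set) → (A → Set) → ℕ → Set
HasExactly A R P k = Σ (List A) λ xs →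
  length xs ≡ k × All P xs × AllPairs (λ x y → ¬ R x y) xs ×
  (∀ y → P y → Any (R y) xs)

CountZ : (A : Set) → (A → A → Set) → (A → Set) → ℤ → Set
CountZ A R P z = ∃[ k ] (+ k ≡ z × HasExactly A R P k)

-- The geometry: PG(8,q) = P(V), V = F^(3×3) ≅ E³ ; PG(2,q³) = P(W), W = E³

module Geometry (F : Field) (K : CubicExt F) where
  open CubicExt K using (emb; basis)
  module F = Field F
  module E = Field (CubicExt.E K)

  -- F_q^9, written as 3 blocks of 3 coordinates (block j = E-coordinate j)
  V : Set
  V = Fin 3 → Fin 3 → F.Carrier

  _≐_ : V → V → Set
  x ≐ y = ∀ i j → x i j ≡ y i j

  _+V_ : V → V → V
  (x +V y) i j = x i j F.+ y i j

  _·V_ : F.Carrier → V → V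
  (a ·V x) i j = a F.* x i j

  0V : V
  0V _ _ = F.0#

  NonzeroV : V → Set
  NonzeroV x = ¬ (x ≐ 0V)

  -- x and y represent the same point of PG(8,q) (for nonzero x, y)
  SamePtV : V → V → Set
  SamePtV x y = ∃[ c ] (y ≐ (c ·V x))

  Indep2V : V → V → Set
  Indep2V u v = ∀ a b → ((a ·V u) +V (b ·V v)) ≐ 0V → a ≡ F.0# × b ≡ F.0#

  Indep3V : V → V → V → Set
  Indep3V u v w = ∀ a b c → (((a ·V u) +V (b ·V v)) +V (c ·V w)) ≐ 0V →
                  a ≡ F.0# × b ≡ F.0# × c ≡ F.0#

  CollV : V → V → V → Set
  CollV x y z = ∃[ a ] ∃[ b ] ∃[ c ]
    (¬ (a ≡ F.0# × b ≡ F.0# × c ≡ F.0#) × (((a ·V x) +V (b ·V y)) +V (c ·V z)) ≐ 0V)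

  W : Set
  W = Fin 3 → E.Carrier

  _≐W_ : W → W → Set
  P ≐W Q = ∀ i → P i ≡ Q i

  _+W_ : W → W → W
  (P +W Q) i = P i E.+ Q i

  _·W_ : E.Carrier → W → W
  (a ·W P) i = a E.* P i

  0W : W
  0W _ = E.0#

  NonzeroW : W → Set
  NonzeroW P = ¬ (P ≐W 0W)

  SamePtW : W → W → Set
  SamePtW P Q = ∃[ c ] (Q ≐W (c ·W P))

  Indep2W : W → W → Set
  Indep2W u v = ∀ a b → ((a ·W u) +W (b ·W v)) ≐W 0W → a ≡ E.0# × b ≡ E.0#

  Indep3W : W → W → W → Set
  Indep3W u v w = ∀ a b c → (((a ·W u) +W (b ·W v)) +W (c ·W w)) ≐W 0W →
                  a ≡ E.0# × b ≡ E.0# × c ≡ E.0#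

  CollW : W → W → W → Set
  CollW P Q R = ∃[ a ] ∃[ b ] ∃[ c ]
    (¬ (a ≡ E.0# × b ≡ E.0# × c ≡ E.0#) × (((a ·W P) +W (b ·W Q)) +W (c ·W R)) ≐W 0W)

  -- the identification F_q^9 ≅ F_{q³}^3 via the basis
  ι : V → W
  ι x j = Σ3 E._+_ (λ i → emb (x j i) E.* basis i)

  -- x (a point of PG(8,q)) lies in the S-plane [[P]]
  InS : W → V → Set
  InS P x = ∃[ c ] (ι x ≐W (c ·W P))

  -- a line of PG(2,q³), spanned by E-independent m₁ m₂
  OnLineW : W → W → W → Set
  OnLineW m₁ m₂ P = ∃[ a ] ∃[ b ] (P ≐W ((a ·W m₁) +W (b ·W m₂)))

  -- x lies in the H-5-space [[m]] (the F_q-span of the S-planes of the points of m)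
  InH : W → W → V → Set
  InH m₁ m₂ x = OnLineW m₁ m₂ (ι x)

  SameLineW : W → W → W → W → Set
  SameLineW m₁ m₂ n₁ n₂ = OnLineW m₁ m₂ n₁ × OnLineW m₁ m₂ n₂

  -- an F_q-subplane of PG(2,q³): image of the canonical PG(2,q) under the
  -- projectivity with E-independent columns s₀ s₁ s₂
  record Subplane : Set where
    field
      col   : Fin 3 → W
      indep : Indep3W (col zero) (col (suc zero)) (col (suc (suc zero)))

  InSub : Subplane → W → Set
  InSub S P = ∃ λ (x : Fin 3 → F.Carrier) → (¬ (∀ i → x i ≡ F.0#) ×
    SamePtW (Σ3 _+W_ (λ i → emb (x i) ·W Subplane.col S i)) P)

  -- collineations of PG(2,q³) (acting on representative vectors)
  record IsCollineation (φ : W → W) : Set where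
    field
      nonzero  : ∀ P → NonzeroW P → NonzeroW (φ P)
      wd       : ∀ P Q → NonzeroW P → NonzeroW Q → SamePtW P Q → SamePtW (φ P) (φ Q)
      inj      : ∀ P Q → NonzeroW P → NonzeroW Q → SamePtW (φ P) (φ Q) → SamePtW P Q
      surj     : ∀ Q → NonzeroW Q → ∃[ P ] (NonzeroW P × SamePtW (φ P) Q)
      coll     : ∀ P Q R → NonzeroW P → NonzeroW Q → NonzeroW R →
                 CollW P Q R ⇔ CollW (φ P) (φ Q) (φ R)

  HasOrder3W : (W → W) → Set
  HasOrder3W φ = (∀ P → NonzeroW P → SamePtW P (φ (φ (φ P)))) ×
                 (∃[ P ] (NonzeroW P × ¬ SamePtW P (φ P)))

  FixesPtwise : (W → W) → Subplane → Set
  FixesPtwise φ S = ∀ P → NonzeroW P → InSub S P → SamePtW P (φ P)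

  record IsProjectivity (σ : V → V) : Set where
    field
      additive    : ∀ x y → σ (x +V y) ≐ (σ x +V σ y)
      homogeneous : ∀ a x → σ (a ·V x) ≐ (a ·V σ x)
      nonsingular : ∀ x → NonzeroV x → NonzeroV (σ x)

  HasOrder3V : (V → V) → Set
  HasOrder3V σ = (∃[ c ] ∀ x → σ (σ (σ x)) ≐ (c ·V x)) ×
                 ¬ (∃[ c ] ∀ x → σ x ≐ (c ·V x))

  Induces : (V → V) → (W → W) → Set
  Induces σ φ = ∀ P → NonzeroW P → ∀ x → InS P x ⇔ InS (φ P) (σ x)

  -- the line ℓ = ⟨u,v⟩ of PG(8,q); its points are parametrised by PG(1,q) = Maybe F
  pt : V → V → Maybe F.Carrier → V
  pt u v nothing  = v
  pt u v (just t) = u +V (t ·V v)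

  module Config (φ : W → W) (S : Subplane) (σ : V → V) where

    TypeI : W → Set
    TypeI P = InSub S P

    Distinct3W : W → W → W → Set
    Distinct3W P Q R = ¬ SamePtW P Q × ¬ SamePtW P R × ¬ SamePtW Q R

    TypeII : W → Set
    TypeII P = Distinct3W P (φ P) (φ (φ P)) × CollW P (φ P) (φ (φ P))

    LineTypeI : ℕ → W → W → Set
    LineTypeI q m₁ m₂ = HasExactly W SamePtW
      (λ P → NonzeroW P × TypeI P × OnLineW m₁ m₂ P) (Data.Nat._+_ q 1)

    IPoint : V → Set
    IPoint x = NonzeroV x × ∃[ P ] (NonzeroW P × TypeI P × InS P x)

    IIPoint : V → Set
    IIPoint x = NonzeroV x × ∃[ P ] (NonzeroW P × TypeII P × InS P x)

    Fixed : V → Set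
    Fixed x = SamePtV x (σ x)

    Distinct3V : V → V → V → Set
    Distinct3V x y z = ¬ SamePtV x y × ¬ SamePtV x z × ¬ SamePtV y z

    IColPoint : V → Set
    IColPoint x = IPoint x × Distinct3V x (σ x) (σ (σ x)) × CollV x (σ x) (σ (σ x))

    IIColPoint : V → Set
    IIColPoint x = IIPoint x × CollV x (σ x) (σ (σ x))

    LineFixed : V → V → Set
    LineFixed u v = ∀ t → ∃[ s ] SamePtV (pt u v s) (σ (pt u v t))

    MeetsSI : V → V → ℤ → Set
    MeetsSI u v = CountZ W SamePtW
      (λ P → NonzeroW P × TypeI P × ∃[ t ] InS P (pt u v t))

    MeetsSII : V → V → ℤ → Set
    MeetsSII u v = CountZ W SamePtW
      (λ P → NonzeroW P × TypeII P × ∃[ t ] InS P (pt u v t))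

    PointsWith : V → V → (V → Set) → ℤ → Set
    PointsWith u v Q = CountZ (Maybe F.Carrier) _≡_ (λ t → Q (pt u v t))

    InPtwiseFixedPlane : V → V → Set
    InPtwiseFixedPlane u v = ∃ λ (w : V) → (Indep3V u v w ×
      ∀ (a b c : F.Carrier) → Fixed (((a ·V u) +V (b ·V v)) +V (c ·V w)))

    InSIPlane : V → V → Set
    InSIPlane u v = ∃[ P ] (NonzeroW P × TypeI P × ∀ t → InS P (pt u v t))

    InHSpace : V → V → W → W → Set
    InHSpace u v m₁ m₂ = ∀ t → InH m₁ m₂ (pt u v t)

    InUniqueHISpace : ℕ → V → V → Set
    InUniqueHISpace q u v = ∃[ m₁ ] ∃[ m₂ ] (Indep2W m₁ m₂ ×
      InHSpace u v m₁ m₂ × LineTypeI q m₁ m₂ ×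
      (∀ n₁ n₂ → Indep2W n₁ n₂ → InHSpace u v n₁ n₂ → SameLineW m₁ m₂ n₁ n₂))

{-# OPTIONS --safe #-}
module Submission where

-- In coordinates with respect to a frame of the subplane, σ acts on each coordinate by one F-linear
-- map g : E → E: σ fixes the S-planes of the subplane and is additive.  As σ maps E-lines to
-- E-lines, g (c d) g 1 = g c g d, and since φ is not the identity, g r = r g 1 forces r ∈ F
-- (the degree 3 is prime).  Hence two solutions of g z = k z differ by a factor in F, and every
-- fixed point lies in an S_I-plane.
--
-- On the fixed line ℓ = ⟨u, v⟩, σ permutes the q + 1 points with orbits of size 1 or 3.  If it fixes
-- three points it is scalar on ℓ, which is (a).  Otherwise the number of fixed points is at most 2
-- and congruent to q + 1 mod 3, so it is n + 1.  If ι u and ι v are dependent over E, ℓ lies in one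
-- S-plane, fixed by σ, which is (b).  If they are independent, distinct points of ℓ lie in distinct
-- S-planes, an orbit of three points gives three distinct collinear points of PG(2,q³), and the
-- E-line of ℓ is invariant under σ, so its points with rational coordinates in two suitable
-- places are rational, which is (c).

open import Defs
open import Algebra.Bundles using (CommutativeRing)
import Algebra.Properties.Ring as RingProperties
import Algebra.Properties.Semiring.Exp.TCOptimised as Exp
import Algebra.Properties.Semiring.Mult.TCOptimised as Mult
open import Data.Bool using (if_then_else_)
open import Data.Empty using (⊥-elim)
open import Data.Fin using (Fin)
import Data.Fin as Fin
open import Data.Fin.Patterns using (0F; 1F; 2F)
import Data.Fin.Properties as Finₚ
import Data.Integer as ℤ
import Data.Integer.Divisibility as ℤ
import Data.Integer.Properties as ℤₚ
open import Data.List as List using (List; []; _∷_; _++_; length; filter)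
import Data.List.Properties as Listₚ
open import Data.List.Membership.Propositional using (_∈_)
open import Data.List.Membership.Propositional.Properties
  using (∈-∃++; ∈-map⁺; ∈-filter⁺; ∈-filter⁻)
open import Data.List.Relation.Binary.Permutation.Propositional
  using (_↭_; ↭-trans; ↭-sym; prep; ↭⇒↭ₛ)
open import Data.List.Relation.Binary.Permutation.Propositional.Properties
  using (∈-resp-↭; ↭-length; shift)
import Data.List.Relation.Binary.Permutation.Setoid.Properties as PermutationSetoid
open import Data.List.Relation.Unary.All as All using (All; []; _∷_)
import Data.List.Relation.Unary.All.Properties as Allₚ
open import Data.List.Relation.Unary.AllPairs as AllPairs using ([]; _∷_)
import Data.List.Relation.Unary.AllPairs.Properties as AllPairsₚ
open import Data.List.Relation.Unary.Any as Any using (here; there)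
import Data.List.Relation.Unary.Any.Properties as Anyₚ
open import Data.List.Relation.Unary.Unique.Propositional using (Unique)
import Data.List.Relation.Unary.Unique.Propositional.Properties as Uniqueₚ
open import Data.Maybe using (Maybe; just; nothing)
import Data.Maybe.Properties as Maybeₚ
import Data.Nat as ℕ
import Data.Nat.Divisibility as ℕ
import Data.Nat.Properties as ℕₚ
open import Data.Product using (∃; ∃-syntax; _×_; _,_; proj₁; proj₂)
open import Data.Sum using (_⊎_; inj₁; inj₂; [_,_]′)
open import Function.Bundles using (Equivalence)
open import Relation.Binary.Definitions using (DecidableEquality)
open import Relation.Binary.PropositionalEquality
  using (_≡_; refl; sym; trans; cong; cong₂; subst; setoid; module ≡-Reasoning)
import Relation.Binary.Reflection as Reflection
open import Relation.Nullary using (¬_; Dec; yes; no; ¬?)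
open import Relation.Nullary.Decidable using (does; from-no; map′; _×-dec_)
open import Relation.Unary using (Decidable)
open import Tactic.RingSolver.Core.AlmostCommutativeRing using (fromCommutativeRing)
open import Tactic.RingSolver.Core.Expression
  using (Expr; Κ; Ι; _⊕_; _⊗_; _⊛_; ⊝_; module Eval)
import Tactic.RingSolver.Core.Polynomial.Base as Polynomial
import Tactic.RingSolver.Core.Polynomial.Homomorphism as PolynomialHomomorphism
open import Tactic.RingSolver.Core.Polynomial.Parameters using (Homomorphism)
import Tactic.RingSolver.Core.Polynomial.Semantics as Semantics

-- The obstacle is that `φ` acts on representative vectors and is known only up to scalars that may
-- vary from vector to vector; no semilinear formula for it is given. The formula is recovered from
-- `σ`, which is linear over F. The S-planes of the three columns of the subplane make `σ` diagonal,
-- and the S-plane of the unit point (1, 1, 1) makes the three diagonal maps equal to one `g`. Since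
-- only points are prescribed, `g 1` may be any nonzero element: the field automorphism is g divided
-- by `g 1`, and the formulas carry powers of `g 1` in place of its inverse. Rationality of a point
-- then means that its frame coordinates have ratios fixed by this automorphism. The residue n
-- enters through orbit counting, which treats its three values alike, whereas eigenvalues of `σ` on
-- ℓ would depend on which cube roots of unity lie in F.

infixl 7 _:*_
infixl 6 _:+_ _:-_
infix 8 :-_
infix 4 _:=_

_:*_ _:+_ _:-_ : ∀ {n} → Expr ℤ.ℤ n → Expr ℤ.ℤ n → Expr ℤ.ℤ n
_:*_ = _⊗_
_:+_ = _⊕_
x :- y = x ⊕ ⊝ y

:-_ : ∀ {n} → Expr ℤ.ℤ n → Expr ℤ.ℤ n
:-_ = ⊝_

_:=_ : ∀ {n} → Expr ℤ.ℤ n → Expr ℤ.ℤ n → Expr ℤ.ℤ n × Expr ℤ.ℤ n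
_:=_ = _,_

:0 :1 : ∀ {n} → Expr ℤ.ℤ n
:0 = Κ ℤ.0ℤ
:1 = Κ ℤ.1ℤ

-- Linear algebra over a field

module FieldProperties (K : Field) where
  open Field K

  commutativeRing : CommutativeRing _ _
  commutativeRing = record { isCommutativeRing = isCommutativeRing }

  open CommutativeRing commutativeRing public
    using (+-identityˡ; +-identityʳ; *-identityˡ; *-identityʳ; *-comm; *-assoc;
           +-comm; +-assoc; zeroˡ; zeroʳ; -‿inverseʳ; _-_)
  open RingProperties (CommutativeRing.ring commutativeRing) public
    using (-‿involutive; -0#≈0#; -‿distribˡ-*; -‿distribʳ-*; -‿+-comm; x∙y⁻¹≈ε⇒x≈y)

  private
    open CommutativeRing commutativeRing using (semiring)
    open Mult semiring using (1+×; ×-homo-+; ×1-homo-*) renaming (_×_ to _·_)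
    open Exp semiring using (^-congˡ)

    -- With this form of multiples, `1 · 1#` reduces to `1#`, so the constants `:0` and `:1`
    -- evaluate to the constants of the field by computation.
    ⟦_⟧ : ℤ.ℤ → Carrier
    ⟦ ℤ.+ n ⟧      = n · 1#
    ⟦ ℤ.-[1+ n ] ⟧ = - (ℕ.suc n · 1#)

    cancel-1 : ∀ a b → (1# + a) - (1# + b) ≡ a - b
    cancel-1 a b = begin
      (1# + a) + - (1# + b)      ≡⟨ cong ((1# + a) +_) (sym (-‿+-comm 1# b)) ⟩
      (1# + a) + (- 1# + - b)    ≡⟨ cong (_+ (- 1# + - b)) (+-comm 1# a) ⟩
      (a + 1#) + (- 1# + - b)    ≡⟨ +-assoc a 1# _ ⟩
      a + (1# + (- 1# + - b))    ≡⟨ cong (a +_) (sym (+-assoc 1# (- 1#) (- b))) ⟩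
      a + ((1# + - 1#) + - b)    ≡⟨ cong (λ e → a + (e + - b)) (-‿inverseʳ 1#) ⟩
      a + (0# + - b)             ≡⟨ cong (a +_) (+-identityˡ (- b)) ⟩
      a - b                      ∎
      where open ≡-Reasoning

    ⟦⊖⟧ : ∀ m n → ⟦ m ℤ.⊖ n ⟧ ≡ m · 1# - n · 1#
    ⟦⊖⟧ ℕ.zero    ℕ.zero    = sym (-‿inverseʳ 0#)
    ⟦⊖⟧ ℕ.zero    (ℕ.suc n) = sym (+-identityˡ _)
    ⟦⊖⟧ (ℕ.suc m) ℕ.zero    =
      sym (trans (cong (ℕ.suc m · 1# +_) -0#≈0#) (+-identityʳ _))
    ⟦⊖⟧ (ℕ.suc m) (ℕ.suc n) = begin
      ⟦ ℕ.suc m ℤ.⊖ ℕ.suc n ⟧          ≡⟨ cong ⟦_⟧ (ℤₚ.[1+m]⊖[1+n]≡m⊖n m n) ⟩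
      ⟦ m ℤ.⊖ n ⟧                      ≡⟨ ⟦⊖⟧ m n ⟩
      m · 1# - n · 1#                  ≡⟨ sym (cancel-1 _ _) ⟩
      (1# + m · 1#) - (1# + n · 1#)
        ≡⟨ sym (cong₂ _-_ (1+× m 1#) (1+× n 1#)) ⟩
      ℕ.suc m · 1# - ℕ.suc n · 1#      ∎
      where open ≡-Reasoning

    ⟦⟧-neg : ∀ i → ⟦ ℤ.- i ⟧ ≡ - ⟦ i ⟧
    ⟦⟧-neg (ℤ.+ ℕ.zero)    = sym -0#≈0#
    ⟦⟧-neg (ℤ.+ ℕ.suc n)   = refl
    ⟦⟧-neg ℤ.-[1+ n ]      = sym (-‿involutive _)

    ⟦⟧-+ : ∀ i j → ⟦ i ℤ.+ j ⟧ ≡ ⟦ i ⟧ + ⟦ j ⟧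
    ⟦⟧-+ (ℤ.+ m)     (ℤ.+ n)     = ×-homo-+ 1# m n
    ⟦⟧-+ (ℤ.+ m)     ℤ.-[1+ n ]  = ⟦⊖⟧ m (ℕ.suc n)
    ⟦⟧-+ ℤ.-[1+ m ]  (ℤ.+ n)     = trans (⟦⊖⟧ n (ℕ.suc m)) (+-comm _ _)
    ⟦⟧-+ ℤ.-[1+ m ]  ℤ.-[1+ n ]  = begin
      - (ℕ.suc (ℕ.suc (m ℕ.+ n)) · 1#)
        ≡⟨ cong (λ k → - (k · 1#)) (cong ℕ.suc (sym (ℕₚ.+-suc m n))) ⟩
      - ((ℕ.suc m ℕ.+ ℕ.suc n) · 1#)     ≡⟨ cong -_ (×-homo-+ 1# (ℕ.suc m) (ℕ.suc n)) ⟩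
      - (ℕ.suc m · 1# + ℕ.suc n · 1#)    ≡⟨ sym (-‿+-comm _ _) ⟩
      - (ℕ.suc m · 1#) + - (ℕ.suc n · 1#) ∎
      where
      open ≡-Reasoning
      import Data.Nat.Properties as ℕₚ

    ⟦⟧-*⁺ : ∀ m j → ⟦ ℤ.+ m ℤ.* j ⟧ ≡ m · 1# * ⟦ j ⟧
    ⟦⟧-*⁺ m (ℤ.+ n) = trans (cong ⟦_⟧ (sym (ℤₚ.pos-* m n))) (×1-homo-* m n)
    ⟦⟧-*⁺ m ℤ.-[1+ n ] = begin
      ⟦ ℤ.+ m ℤ.* ℤ.-[1+ n ] ⟧
        ≡⟨ cong ⟦_⟧ (sym (ℤₚ.neg-distribʳ-* (ℤ.+ m) (ℤ.+ ℕ.suc n))) ⟩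
      ⟦ ℤ.- (ℤ.+ m ℤ.* ℤ.+ ℕ.suc n) ⟧  ≡⟨ ⟦⟧-neg (ℤ.+ m ℤ.* ℤ.+ ℕ.suc n) ⟩
      - ⟦ ℤ.+ m ℤ.* ℤ.+ ℕ.suc n ⟧      ≡⟨ cong -_ (⟦⟧-*⁺ m (ℤ.+ ℕ.suc n)) ⟩
      - (m · 1# * ℕ.suc n · 1#)        ≡⟨ -‿distribʳ-* _ _ ⟩
      m · 1# * - (ℕ.suc n · 1#)        ∎
      where open ≡-Reasoning

    ⟦⟧-* : ∀ i j → ⟦ i ℤ.* j ⟧ ≡ ⟦ i ⟧ * ⟦ j ⟧
    ⟦⟧-* (ℤ.+ m) j = ⟦⟧-*⁺ m j
    ⟦⟧-* ℤ.-[1+ m ] j = begin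
      ⟦ ℤ.-[1+ m ] ℤ.* j ⟧           ≡⟨ cong ⟦_⟧ (sym (ℤₚ.neg-distribˡ-* (ℤ.+ ℕ.suc m) j)) ⟩
      ⟦ ℤ.- (ℤ.+ ℕ.suc m ℤ.* j) ⟧    ≡⟨ ⟦⟧-neg (ℤ.+ ℕ.suc m ℤ.* j) ⟩
      - ⟦ ℤ.+ ℕ.suc m ℤ.* j ⟧        ≡⟨ cong -_ (⟦⟧-*⁺ (ℕ.suc m) j) ⟩
      - (ℕ.suc m · 1# * ⟦ j ⟧)       ≡⟨ -‿distribˡ-* _ _ ⟩
      - (ℕ.suc m · 1#) * ⟦ j ⟧       ∎
      where open ≡-Reasoning

    -- Over integer coefficients the solver sees x - x cancel; over those of an abstract field it cannot.
    homomorphism : Homomorphism _ _ _ _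
    homomorphism = record
      { from = record { rawRing = ℤ.+-*-rawRing ; isZero = λ i → does (i ℤ.≟ ℤ.0ℤ) }
      ; to = fromCommutativeRing commutativeRing λ _ → nothing
      ; morphism = record
        { ⟦_⟧ = ⟦_⟧ ; +-homo = ⟦⟧-+ ; *-homo = ⟦⟧-* ; -‿homo = ⟦⟧-neg
        ; 0-homo = refl ; 1-homo = refl }
      ; Zero-C⟶Zero-R = λ { (ℤ.+ ℕ.zero) _ → refl } }

    open Eval (CommutativeRing.rawRing commutativeRing) ⟦_⟧ renaming (⟦_⟧ to ⟦_⟧ₑ)
    open Polynomial (Homomorphism.from homomorphism)
    open Semantics homomorphism renaming (⟦_⟧ to ⟦_⟧ₚ)
    open PolynomialHomomorphism homomorphism

    norm : ∀ {n} → Expr ℤ.ℤ n → Poly n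
    norm (Κ x)   = κ x
    norm (Ι x)   = ι x
    norm (x ⊕ y) = norm x ⊞ norm y
    norm (x ⊗ y) = norm x ⊠ norm y
    norm (x ⊛ i) = norm x ⊡ i
    norm (⊝ x)   = ⊟ norm x

    correct : ∀ {n} (e : Expr ℤ.ℤ n) ρ → ⟦ norm e ⟧ₚ ρ ≡ ⟦ e ⟧ₑ ρ
    correct (Κ x)   ρ = κ-hom x ρ
    correct (Ι x)   ρ = ι-hom x ρ
    correct (x ⊕ y) ρ = trans (⊞-hom (norm x) (norm y) ρ) (cong₂ _+_ (correct x ρ) (correct y ρ))
    correct (x ⊗ y) ρ = trans (⊠-hom (norm x) (norm y) ρ) (cong₂ _*_ (correct x ρ) (correct y ρ))
    correct (x ⊛ i) ρ = trans (⊡-hom (norm x) i ρ) (^-congˡ i (correct x ρ))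
    correct (⊝ x)   ρ = trans (⊟-hom (norm x) ρ) (cong -_ (correct x ρ))

  open Reflection (CommutativeRing.setoid commutativeRing) Ι ⟦_⟧ₑ (λ e → ⟦ norm e ⟧ₚ) correct
    public using (solve)

  1≢0 : ¬ 1# ≡ 0#
  1≢0 e = 0≢1 (sym e)

  ≢⇒-≢0 : ∀ {x y} → ¬ x ≡ y → ¬ (x - y) ≡ 0#
  ≢⇒-≢0 x≢y e = x≢y (x∙y⁻¹≈ε⇒x≈y _ _ e)

  *-cancelˡ : ∀ {x y z} → ¬ x ≡ 0# → x * y ≡ x * z → y ≡ z
  *-cancelˡ {x} {y} {z} x≢0 e with inverse x x≢0
  ... | w , xw≡1 = begin
    y            ≡⟨ sym (*-identityˡ y) ⟩
    1# * y       ≡⟨ cong (_* y) (sym xw≡1) ⟩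
    x * w * y    ≡⟨ solve 3 (λ x w y → x :* w :* y := w :* (x :* y)) refl x w y ⟩
    w * (x * y)  ≡⟨ cong (w *_) e ⟩
    w * (x * z)  ≡⟨ solve 3 (λ x w y → w :* (x :* y) := x :* w :* y) refl x w z ⟩
    x * w * z    ≡⟨ cong (_* z) xw≡1 ⟩
    1# * z       ≡⟨ *-identityˡ z ⟩
    z            ∎
    where open ≡-Reasoning

  x*y≡0⇒y≡0 : ∀ {x y} → ¬ x ≡ 0# → x * y ≡ 0# → y ≡ 0#
  x*y≡0⇒y≡0 {x} x≢0 e = *-cancelˡ x≢0 (trans e (sym (zeroʳ x)))

  *-≢0 : ∀ {x y} → ¬ x ≡ 0# → ¬ y ≡ 0# → ¬ (x * y) ≡ 0#
  *-≢0 x≢0 y≢0 e = y≢0 (x*y≡0⇒y≡0 x≢0 e)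

  solve-* : ∀ {x} → ¬ x ≡ 0# → ∀ y → ∃[ z ] y ≡ x * z
  solve-* {x} x≢0 y with inverse x x≢0
  ... | w , xw≡1 = w * y , (begin
    y            ≡⟨ sym (*-identityˡ y) ⟩
    1# * y       ≡⟨ cong (_* y) (sym xw≡1) ⟩
    x * w * y    ≡⟨ *-assoc x w y ⟩
    x * (w * y)  ∎)
    where open ≡-Reasoning

  δ : Fin 3 → Fin 3 → Carrier
  δ k i = if does (k Fin.≟ i) then 1# else 0#

  -- Basis extension in dimension 3. A nonzero 2×2 minor at coordinates i and j allows the unit
  -- vector at the remaining coordinate k as third basis vector.
  record Completes (x y : Fin 3 → Carrier) (k : Fin 3) : Set where
    field
      spans : ∀ (p : Fin 3 → Carrier) →
              ∃[ a ] ∃[ b ] ∃[ c ] ∀ i → p i ≡ (a * x i + b * y i) + c * δ k i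
      independent : ∀ a b c → (∀ i → (a * x i + b * y i) + c * δ k i ≡ 0#) →
                    a ≡ 0# × b ≡ 0# × c ≡ 0#

  module _ {xᵢ xⱼ yᵢ yⱼ : Carrier} (minor : ¬ xᵢ * yⱼ ≡ xⱼ * yᵢ) where
    private
      D = xᵢ * yⱼ - xⱼ * yᵢ
      D≢0 : ¬ D ≡ 0#
      D≢0 = ≢⇒-≢0 minor

    abstract
      -- Cramer's rule, with `d` the inverse of the determinant `D`.
      minor-spans : ∀ s t → ∃[ a ] ∃[ b ] (s ≡ a * xᵢ + b * yᵢ × t ≡ a * xⱼ + b * yⱼ)
      minor-spans s t with inverse D D≢0
      ... | d , Dd≡1 = (s * yⱼ - t * yᵢ) * d , (xᵢ * t - xⱼ * s) * d ,
        scale (solve 7 (λ xi xj yi yj s t d → (xi :* yj :- xj :* yi) :* d :* s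
                 := (s :* yj :- t :* yi) :* d :* xi :+ (xi :* t :- xj :* s) :* d :* yi)
                 refl xᵢ xⱼ yᵢ yⱼ s t d) ,
        scale (solve 7 (λ xi xj yi yj s t d → (xi :* yj :- xj :* yi) :* d :* t
                 := (s :* yj :- t :* yi) :* d :* xj :+ (xi :* t :- xj :* s) :* d :* yj)
                 refl xᵢ xⱼ yᵢ yⱼ s t d)
        where
        scale : ∀ {u v} → D * d * u ≡ v → u ≡ v
        scale {u} e = trans (trans (sym (*-identityˡ u)) (cong (_* u) (sym Dd≡1))) e

    minor-independent : ∀ a b → a * xᵢ + b * yᵢ ≡ 0# → a * xⱼ + b * yⱼ ≡ 0# → a ≡ 0# × b ≡ 0#
    minor-independent a b e f =
      x*y≡0⇒y≡0 D≢0 (trans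
        (solve 6 (λ xi xj yi yj a b → (xi :* yj :- xj :* yi) :* a
           := yj :* (a :* xi :+ b :* yi) :- yi :* (a :* xj :+ b :* yj))
           refl xᵢ xⱼ yᵢ yⱼ a b)
        (vanish e f)) ,
      x*y≡0⇒y≡0 D≢0 (trans
        (solve 6 (λ xi xj yi yj a b → (xi :* yj :- xj :* yi) :* b
           := xi :* (a :* xj :+ b :* yj) :- xj :* (a :* xi :+ b :* yi))
           refl xᵢ xⱼ yᵢ yⱼ a b)
        (vanish f e))
      where
      vanish : ∀ {r s u v} → u ≡ 0# → v ≡ 0# → r * u - s * v ≡ 0#
      vanish {r} {s} refl refl = solve 2 (λ r s → r :* :0 :- s :* :0 := :0) refl r s

  private
    module _ {x y : Fin 3 → Carrier} {i j : Fin 3} (minor : ¬ x i * y j ≡ x j * y i) where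

      minor-completes : ∀ k → δ k i ≡ 0# → δ k j ≡ 0# → δ k k ≡ 1# →
                        (∀ m → m ≡ i ⊎ m ≡ j ⊎ m ≡ k) → Completes x y k
      minor-completes k δi δj δk cover = record { spans = spans ; independent = independent }
        where
        at0 : ∀ {u c e} → e ≡ 0# → u + c * e ≡ u
        at0 {u} {c} refl = solve 2 (λ u c → u :+ c :* :0 := u) refl u c
        at1 : ∀ {u c e} → e ≡ 1# → u + c * e ≡ u + c
        at1 {u} {c} refl = solve 2 (λ u c → u :+ c :* :1 := u :+ c) refl u c

        spans : ∀ p → ∃[ a ] ∃[ b ] ∃[ c ] ∀ m → p m ≡ (a * x m + b * y m) + c * δ k m
        spans p = extend (minor-spans minor (p i) (p j))
          where
          extend : ∃[ a ] ∃[ b ] (p i ≡ a * x i + b * y i × p j ≡ a * x j + b * y j) →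
                   ∃[ a ] ∃[ b ] ∃[ c ] ∀ m → p m ≡ (a * x m + b * y m) + c * δ k m
          extend (a , b , ei , ej) = a , b , p k - (a * x k + b * y k) , λ m → at (cover m)
            where
            at : ∀ {m} → m ≡ i ⊎ m ≡ j ⊎ m ≡ k →
                 p m ≡ (a * x m + b * y m) + (p k - (a * x k + b * y k)) * δ k m
            at (inj₁ refl)        = trans ei (sym (at0 δi))
            at (inj₂ (inj₁ refl)) = trans ej (sym (at0 δj))
            at (inj₂ (inj₂ refl)) = trans
              (solve 2 (λ u v → u := v :+ (u :- v)) refl (p k) (a * x k + b * y k))
              (sym (at1 δk))

        independent : ∀ a b c → (∀ m → (a * x m + b * y m) + c * δ k m ≡ 0#) →
                      a ≡ 0# × b ≡ 0# × c ≡ 0#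
        independent a b c e =
          conclude (minor-independent minor a b (trans (sym (at0 δi)) (e i)) (trans (sym (at0 δj)) (e j)))
          where
          conclude : a ≡ 0# × b ≡ 0# → a ≡ 0# × b ≡ 0# × c ≡ 0#
          conclude (a≡0 , b≡0) = a≡0 , b≡0 , (begin
            c
              ≡⟨ solve 3 (λ c x y → c := (:0 :* x :+ :0 :* y) :+ c) refl c (x k) (y k) ⟩
            (0# * x k + 0# * y k) + c
              ≡⟨ sym (cong₂ (λ a b → (a * x k + b * y k) + c) a≡0 b≡0) ⟩
            (a * x k + b * y k) + c              ≡⟨ sym (at1 δk) ⟩
            (a * x k + b * y k) + c * δ k k      ≡⟨ e k ⟩
            0#                                   ∎)
            where open ≡-Reasoning

  module _ (_≟_ : DecidableEquality Carrier) where

    -- The three 2×2 minors decide. The dichotomy serves over both fields: over F for the basis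
    -- coordinates of 1 and of an element r of E, over E for the frame coordinates of u and v, where
    -- it separates cases (b) and (c).
    completes⊎proportional : ∀ (x y : Fin 3 → Carrier) →
      (∃[ i ] ∃[ j ] (¬ x i * y j ≡ x j * y i × ∃[ k ] Completes x y k)) ⊎
      (∀ i j → x i * y j ≡ x j * y i)
    completes⊎proportional x y
      with (x 0F * y 1F) ≟ (x 1F * y 0F) | (x 0F * y 2F) ≟ (x 2F * y 0F)
         | (x 1F * y 2F) ≟ (x 2F * y 1F)
    ... | no m | _ | _ = inj₁ (0F , 1F , m , 2F , minor-completes m 2F refl refl refl
            λ { 0F → inj₁ refl ; 1F → inj₂ (inj₁ refl) ; 2F → inj₂ (inj₂ refl) })
    ... | yes _ | no m | _ = inj₁ (0F , 2F , m , 1F , minor-completes m 1F refl refl refl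
            λ { 0F → inj₁ refl ; 2F → inj₂ (inj₁ refl) ; 1F → inj₂ (inj₂ refl) })
    ... | yes _ | yes _ | no m = inj₁ (1F , 2F , m , 0F , minor-completes m 0F refl refl refl
            λ { 1F → inj₁ refl ; 2F → inj₂ (inj₁ refl) ; 0F → inj₂ (inj₂ refl) })
    ... | yes a | yes b | yes c = inj₂ λ
      { 0F 0F → refl ; 0F 1F → a ; 0F 2F → b
      ; 1F 0F → sym a ; 1F 1F → refl ; 1F 2F → c
      ; 2F 0F → sym b ; 2F 1F → sym c ; 2F 2F → refl }

    ≢0-coordinate : ∀ (x : Fin 3 → Carrier) → ¬ (∀ i → x i ≡ 0#) → ∃[ i ] ¬ x i ≡ 0#
    ≢0-coordinate x x≢0 with x 0F ≟ 0# | x 1F ≟ 0# | x 2F ≟ 0#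
    ... | no n | _ | _ = 0F , n
    ... | yes _ | no n | _ = 1F , n
    ... | yes _ | yes _ | no n = 2F , n
    ... | yes a | yes b | yes c = ⊥-elim (x≢0 λ { 0F → a ; 1F → b ; 2F → c })

    independent⇒completes : ∀ (x y : Fin 3 → Carrier) →
      (∀ a b → (∀ i → a * x i + b * y i ≡ 0#) → a ≡ 0# × b ≡ 0#) → ∃[ k ] Completes x y k
    independent⇒completes x y indep with completes⊎proportional x y
    ... | inj₁ (_ , _ , _ , c) = c
    ... | inj₂ prop with ≢0-coordinate x (λ x≡0 → 1≢0 (proj₁ (indep 1# 0# λ i →
                       trans (cong (λ e → 1# * e + 0# * y i) (x≡0 i))
                         (solve 1 (λ y → :1 :* :0 :+ :0 :* y := :0) refl (y i)))))
    -- If all minors vanish, then -yᵢ x + xᵢ y = 0, a relation in which the coefficient xᵢ of y is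
    -- nonzero.
    ... | i , xi≢0 = ⊥-elim (xi≢0 (proj₂ (indep (- y i) (x i) λ j → trans
            (solve 4 (λ xi xj yi yj → :- yi :* xj :+ xi :* yj := xi :* yj :- xj :* yi)
               refl (x i) (x j) (y i) (y j))
            (trans (cong (_- (x j * y i)) (prop i j)) (-‿inverseʳ _)))))

    proportional⇒multiple : ∀ (x y : Fin 3 → Carrier) → ¬ (∀ i → x i ≡ 0#) →
      (∀ i j → x i * y j ≡ x j * y i) → ∃[ c ] ∀ i → y i ≡ c * x i
    proportional⇒multiple x y x≢0 prop with ≢0-coordinate x x≢0
    ... | i , xi≢0 with solve-* xi≢0 (y i)
    ... | c , yi≡xic = c , λ j → *-cancelˡ xi≢0 (trans (prop i j)
            (trans (cong (x j *_) yi≡xic)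
              (solve 3 (λ xi xj c → xj :* (xi :* c) := xi :* (c :* xj)) refl (x i) (x j) c)))

-- Counting the fixed points of a permutation of order 3

abstract
  -- An element is recovered from the position at which `mem` finds it, so it suffices to compare
  -- positions.
  listing⇒≟ : ∀ {A : Set} (xs : List A) → (∀ x → x ∈ xs) → DecidableEquality A
  listing⇒≟ xs mem x y = map′
    (λ e → trans (Anyₚ.lookup-index (mem x)) (trans (cong (List.lookup xs) e) (sym (Anyₚ.lookup-index (mem y)))))
    (cong (λ z → Any.index (mem z)))
    (Any.index (mem x) Finₚ.≟ Any.index (mem y))

-- The counts of the theorem all have this shape: the objects are parametrised by points of PG(1,q),
-- injectively and surjectively up to `R`, and the length of the list of parameters is known.
exactly-map : ∀ {A B : Set} {R : B → B → Set} {P : B → Set} (f : A → B) {xs : List A} →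
              Unique xs → (∀ {x} → x ∈ xs → P (f x)) → (∀ {x y} → R (f x) (f y) → x ≡ y) →
              (∀ y → P y → ∃[ x ] (x ∈ xs × R y (f x))) → HasExactly B R P (length xs)
exactly-map f {xs} u p inj surj =
  List.map f xs , Listₚ.length-map f xs , Allₚ.map⁺ (All.tabulate p) ,
  AllPairsₚ.map⁺ (AllPairs.map (λ x≢y r → x≢y (inj r)) u) ,
  λ y py → let (x , x∈xs , r) = surj y py in Anyₚ.map⁺ (Any.map (λ { refl → r }) x∈xs)

length-filter-¬ : ∀ {A : Set} {P : A → Set} (P? : Decidable P) xs →
                  length (filter P? xs) ℕ.+ length (filter (λ x → ¬? (P? x)) xs) ≡ length xs
length-filter-¬ P? [] = refl
length-filter-¬ P? (x ∷ xs) with P? x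
... | yes _ = cong ℕ.suc (length-filter-¬ P? xs)
... | no _  = trans (ℕₚ.+-suc _ _) (cong ℕ.suc (length-filter-¬ P? xs))

extract : ∀ {A : Set} {x : A} {xs} → x ∈ xs → ∃[ ys ] xs ↭ x ∷ ys
extract x∈xs with ∈-∃++ x∈xs
... | ys , zs , refl = ys ++ zs , shift _ ys zs

Unique-resp-↭ : ∀ {A : Set} {xs ys : List A} → xs ↭ ys → Unique xs → Unique ys
Unique-resp-↭ {A} p = PermutationSetoid.Unique-resp-↭ (setoid A) (↭⇒↭ₛ p)

module _ {A : Set} (π : A → A) (π³≡id : ∀ x → π (π (π x)) ≡ x) where

  π-injective : ∀ {x y} → π x ≡ π y → x ≡ y
  π-injective {x} {y} e = trans (sym (π³≡id x)) (trans (cong (λ z → π (π z)) e) (π³≡id y))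

  private
    tail∈ : ∀ {x y : A} {ys} → y ∈ x ∷ ys → ¬ y ≡ x → y ∈ ys
    tail∈ (here e) n = ⊥-elim (n e)
    tail∈ (there p) _ = p

    -- Remove the orbit of the first entry, which has three distinct members, and recurse on the
    -- rest. The rest is a sublist only up to permutation, so the recursion runs on the bound `n` of
    -- the length.
    free⇒3∣ : ∀ n xs → length xs ℕ.≤ n → Unique xs → (∀ {x} → x ∈ xs → π x ∈ xs) →
             (∀ {x} → x ∈ xs → ¬ π x ≡ x) → ∃[ m ] length xs ≡ m ℕ.* 3
    free⇒3∣ n [] _ _ _ _ = 0 , refl
    free⇒3∣ ℕ.zero (x ∷ xs) () _ _ _
    free⇒3∣ (ℕ.suc n) (x ∷ xs) (ℕ.s≤s l) u closed free =
      ℕ.suc (proj₁ rec) , trans (↭-length p) (cong (3 ℕ.+_) (proj₂ rec))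
      where
      πx≢x : ¬ π x ≡ x
      πx≢x = free (here refl)
      ππx≢x : ¬ π (π x) ≡ x
      ππx≢x e = πx≢x (trans (sym (cong π e)) (π³≡id x))
      ππx≢πx : ¬ π (π x) ≡ π x
      ππx≢πx e = πx≢x (π-injective e)
      first = extract (tail∈ (closed (here refl)) πx≢x)
      ys = proj₁ first
      second = extract (tail∈ (∈-resp-↭ (proj₂ first) (tail∈ (closed (closed (here refl))) ππx≢x)) ππx≢πx)
      zs = proj₁ second
      p : x ∷ xs ↭ x ∷ π x ∷ π (π x) ∷ zs
      p = prep x (↭-trans (proj₂ first) (prep (π x) (proj₂ second)))
      u′ : Unique (x ∷ π x ∷ π (π x) ∷ zs)
      u′ = Unique-resp-↭ p u
      ∈zs⇒ : ∀ {y} → y ∈ zs → y ∈ x ∷ xs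
      ∈zs⇒ q = ∈-resp-↭ (↭-sym p) (there (there (there q)))
      apart : ∀ {y} → y ∈ zs → ¬ y ≡ x × ¬ y ≡ π x × ¬ y ≡ π (π x)
      apart q with u′
      ... | (_ ∷ _ ∷ a) ∷ (_ ∷ b) ∷ c ∷ _ =
        (λ e → All.lookup a q (sym e)) , (λ e → All.lookup b q (sym e)) , (λ e → All.lookup c q (sym e))
      unique-zs : Unique zs
      unique-zs with u′
      ... | _ ∷ _ ∷ _ ∷ v = v
      closed′ : ∀ {y} → y ∈ zs → π y ∈ zs
      closed′ {y} q with apart q
      -- Each removed element is the image of a removed one, x being the image of π (π x); so by
      -- injectivity π y can be removed only if y was.
      ... | y≢x , y≢πx , y≢ππx = tail∈ (tail∈ (tail∈ (∈-resp-↭ p (closed (∈zs⇒ q)))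
             (λ e → y≢ππx (π-injective (trans e (sym (π³≡id x))))))
             (λ e → y≢x (π-injective e)))
             (λ e → y≢πx (π-injective e))
      shorter : length zs ℕ.≤ n
      shorter = ℕₚ.≤-trans (ℕₚ.≤-trans (ℕₚ.m≤n+m (length zs) 2)
                  (ℕₚ.≤-reflexive (ℕₚ.suc-injective (sym (↭-length p))))) l
      rec = free⇒3∣ n zs shorter unique-zs closed′ (λ q → free (∈zs⇒ q))

  movedPoints-multiple-of-3 : (_≟_ : DecidableEquality A) → ∀ {xs} → Unique xs → (∀ x → x ∈ xs) →
    ∃[ m ] length (filter (λ x → ¬? (π x ≟ x)) xs) ≡ m ℕ.* 3
  movedPoints-multiple-of-3 _≟_ {xs} u mem = free⇒3∣ _ _ ℕₚ.≤-refl (Uniqueₚ.filter⁺ moves? u)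
    (λ {x} q → ∈-filter⁺ moves? (mem (π x)) (λ e → proj₂ (∈-filter⁻ moves? {xs = xs} q) (π-injective e)))
    (λ q → proj₂ (∈-filter⁻ moves? {xs = xs} q))
    where
    moves? = λ x → ¬? (π x ≟ x)

private
  3∤1 : ¬ 3 ℕ.∣ 1
  3∤1 = from-no (3 ℕ.∣? 1)

  3∤2 : ¬ 3 ℕ.∣ 2
  3∤2 = from-no (3 ℕ.∣? 2)

-- Modulo 3, f ≡ q + 1 ≡ n + 1, and both f and n + 1 lie between 0 and 2. Each of the six wrong
-- pairs yields 3 ∣ 1 or 3 ∣ 2.
fixedPoint-count : ∀ {q f m} n → 2 ℕ.< q → f ℕ.≤ 2 → f ℕ.+ m ℕ.* 3 ≡ q ℕ.+ 1 →
  (n ≡ ℤ.-[1+ 0 ] ⊎ n ≡ ℤ.+ 0 ⊎ n ≡ ℤ.+ 1) → (ℤ.+ 3) ℤ.∣ (ℤ.+ q ℤ.- n) →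
  ℤ.+ f ≡ n ℤ.+ ℤ.+ 1 × ℤ.+ (m ℕ.* 3) ≡ ℤ.+ q ℤ.- n
fixedPoint-count {q} {0} {m} _ _ _ e (inj₁ refl) d = refl , cong ℤ.+_ e
fixedPoint-count {q} {1} {m} _ _ _ e (inj₁ refl) d =
  ⊥-elim (3∤1 (ℕ.∣m+n∣m⇒∣n (subst (3 ℕ.∣_) (trans (sym e) (ℕₚ.+-comm 1 _)) d) (ℕ.n∣m*n m)))
fixedPoint-count {q} {2} {m} _ _ _ e (inj₁ refl) d =
  ⊥-elim (3∤2 (ℕ.∣m+n∣m⇒∣n (subst (3 ℕ.∣_) (trans (sym e) (ℕₚ.+-comm 2 _)) d) (ℕ.n∣m*n m)))
fixedPoint-count {q} {0} {m} _ _ _ e (inj₂ (inj₁ refl)) d =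
  ⊥-elim (3∤1 (ℕ.∣m+n∣m⇒∣n (subst (3 ℕ.∣_) e (ℕ.n∣m*n m)) (subst (3 ℕ.∣_) (ℕₚ.+-identityʳ q) d)))
fixedPoint-count {q} {1} {m} _ _ _ e (inj₂ (inj₁ refl)) d =
  refl , cong ℤ.+_ (trans (ℕₚ.suc-injective (trans e (ℕₚ.+-comm q 1))) (sym (ℕₚ.+-identityʳ q)))
fixedPoint-count {q} {2} {m} _ _ _ e (inj₂ (inj₁ refl)) d =
  ⊥-elim (3∤1 (ℕ.∣m+n∣m⇒∣n (subst (3 ℕ.∣_) (trans (trans (ℕₚ.+-identityʳ q) (sym (ℕₚ.suc-injective (trans e (ℕₚ.+-comm q 1))))) (ℕₚ.+-comm 1 _)) d) (ℕ.n∣m*n m)))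
-- For n = 1 the successor pattern, available because 2 < q, lets the integer difference compute to
-- the natural number here called `q`, one less than the order of the field.
fixedPoint-count {ℕ.suc q} {0} {m} _ _ _ e (inj₂ (inj₂ refl)) d =
  ⊥-elim (3∤2 (ℕ.∣m+n∣m⇒∣n (subst (3 ℕ.∣_) (trans e (sym (ℕₚ.+-suc q 1))) (ℕ.n∣m*n m)) d))
fixedPoint-count {ℕ.suc q} {1} {m} _ _ _ e (inj₂ (inj₂ refl)) d =
  ⊥-elim (3∤1 (ℕ.∣m+n∣m⇒∣n (subst (3 ℕ.∣_) (ℕₚ.suc-injective e) (ℕ.n∣m*n m)) d))
fixedPoint-count {ℕ.suc q} {2} {m} _ _ _ e (inj₂ (inj₂ refl)) d =
  refl , cong ℤ.+_ (ℕₚ.suc-injective (trans (ℕₚ.suc-injective e) (ℕₚ.+-comm q 1)))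
fixedPoint-count {f = ℕ.suc (ℕ.suc (ℕ.suc _))} _ _ (ℕ.s≤s (ℕ.s≤s ()))

-- Coordinates

module Extension (F : Field) (K : CubicExt F) where
  open CubicExt K using (emb; emb-+; emb-*; emb-1; basis; basis-span; basis-indep)
  open Geometry F K
  module Fₚ = FieldProperties F
  module Eₚ = FieldProperties (CubicExt.E K)

  emb-0 : emb F.0# ≡ E.0#
  emb-0 = begin
    emb F.0#
      ≡⟨ Eₚ.solve 2 (λ x y → x := (x :+ y) :- y) refl (emb F.0#) (emb F.0#) ⟩
    (emb F.0# E.+ emb F.0#) Eₚ.- emb F.0#
      ≡⟨ cong (Eₚ._- emb F.0#) (sym (emb-+ F.0# F.0#)) ⟩
    emb (F.0# F.+ F.0#) Eₚ.- emb F.0#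
      ≡⟨ cong (λ z → emb z Eₚ.- emb F.0#) (Fₚ.+-identityˡ F.0#) ⟩
    emb F.0# Eₚ.- emb F.0#                          ≡⟨ Eₚ.-‿inverseʳ (emb F.0#) ⟩
    E.0#                                            ∎
    where open ≡-Reasoning

  emb-neg : ∀ a → emb (F.- a) ≡ E.- emb a
  emb-neg a = begin
    emb (F.- a)
      ≡⟨ Eₚ.solve 2 (λ x y → x := (y :+ x) :- y) refl (emb (F.- a)) (emb a) ⟩
    (emb a E.+ emb (F.- a)) Eₚ.- emb a       ≡⟨ cong (Eₚ._- emb a) (sym (emb-+ a (F.- a))) ⟩
    emb (a Fₚ.- a) Eₚ.- emb a                ≡⟨ cong (λ z → emb z Eₚ.- emb a) (Fₚ.-‿inverseʳ a) ⟩
    emb F.0# Eₚ.- emb a                      ≡⟨ cong (Eₚ._- emb a) emb-0 ⟩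
    E.0# Eₚ.- emb a                          ≡⟨ Eₚ.+-identityˡ _ ⟩
    E.- emb a                                ∎
    where open ≡-Reasoning

  emb-≢0 : ∀ {a} → ¬ a ≡ F.0# → ¬ emb a ≡ E.0#
  emb-≢0 {a} a≢0 e =
    let (b , ab≡1) = F.inverse a a≢0 in
    E.0≢1 (begin
      E.0#               ≡⟨ sym (Eₚ.zeroˡ (emb b)) ⟩
      E.0# E.* emb b     ≡⟨ cong (E._* emb b) (sym e) ⟩
      emb a E.* emb b    ≡⟨ sym (emb-* a b) ⟩
      emb (a F.* b)      ≡⟨ cong emb ab≡1 ⟩
      emb F.1#           ≡⟨ emb-1 ⟩
      E.1#               ∎)
    where open ≡-Reasoning

  emb-- : ∀ a b → emb (a Fₚ.- b) ≡ emb a Eₚ.- emb b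
  emb-- a b = trans (emb-+ a (F.- b)) (cong (emb a E.+_) (emb-neg b))

  fromBasis : (Fin 3 → F.Carrier) → E.Carrier
  fromBasis c = Σ3 E._+_ (λ i → emb (c i) E.* basis i)

  Σ3-cong : ∀ {f g : Fin 3 → E.Carrier} → (∀ i → f i ≡ g i) → Σ3 E._+_ f ≡ Σ3 E._+_ g
  Σ3-cong e = cong₂ E._+_ (cong₂ E._+_ (e 0F) (e 1F)) (e 2F)

  fromBasis-cong : ∀ {c d} → (∀ i → c i ≡ d i) → fromBasis c ≡ fromBasis d
  fromBasis-cong e = Σ3-cong (λ i → cong (λ z → emb z E.* basis i) (e i))

  fromBasis-comb : ∀ a c b d → fromBasis (λ i → a F.* c i F.+ b F.* d i)
                             ≡ emb a E.* fromBasis c E.+ emb b E.* fromBasis d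
  fromBasis-comb a c b d = trans
    (Σ3-cong λ i → cong (E._* basis i) (trans (emb-+ _ _) (cong₂ E._+_ (emb-* a (c i)) (emb-* b (d i)))))
    (Eₚ.solve 11 (λ a b c₀ c₁ c₂ d₀ d₁ d₂ β₀ β₁ β₂ →
       (a :* c₀ :+ b :* d₀) :* β₀ :+ (a :* c₁ :+ b :* d₁) :* β₁ :+ (a :* c₂ :+ b :* d₂) :* β₂
       := a :* (c₀ :* β₀ :+ c₁ :* β₁ :+ c₂ :* β₂) :+ b :* (d₀ :* β₀ :+ d₁ :* β₁ :+ d₂ :* β₂))
       refl (emb a) (emb b) (emb (c 0F)) (emb (c 1F)) (emb (c 2F))
       (emb (d 0F)) (emb (d 1F)) (emb (d 2F)) (basis 0F) (basis 1F) (basis 2F))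

  abstract
    toBasis : E.Carrier → Fin 3 → F.Carrier
    toBasis e = proj₁ (basis-span e)

    from-toBasis : ∀ e → fromBasis (toBasis e) ≡ e
    from-toBasis e = sym (proj₂ (basis-span e))

  ι-cong : ∀ {x y} → x ≐ y → ι x ≐W ι y
  ι-cong e j = fromBasis-cong (e j)

  ι-comb : ∀ a x b y → ι ((a ·V x) +V (b ·V y)) ≐W ((emb a ·W ι x) +W (emb b ·W ι y))
  ι-comb a x b y j = fromBasis-comb a (x j) b (y j)

  ι≐0 : ∀ {x} → ι x ≐W 0W → x ≐ 0V
  ι≐0 {x} e j = basis-indep (x j) (e j)

  abstract
    ι⁻¹ : W → V
    ι⁻¹ P j = toBasis (P j)

    ι-ι⁻¹ : ∀ P → ι (ι⁻¹ P) ≐W P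
    ι-ι⁻¹ P j = from-toBasis (P j)

  ι-· : ∀ a x → ι (a ·V x) ≐W (emb a ·W ι x)
  ι-· a x j = begin
    ι (a ·V x) j
      ≡⟨ ι-cong (λ i l → Fₚ.solve 2 (λ a x → a :* x := a :* x :+ :0 :* x) refl a (x i l)) j ⟩
    ι ((a ·V x) +V (F.0# ·V x)) j                        ≡⟨ ι-comb a x F.0# x j ⟩
    emb a E.* ι x j E.+ emb F.0# E.* ι x j
      ≡⟨ cong (λ z → emb a E.* ι x j E.+ z E.* ι x j) emb-0 ⟩
    emb a E.* ι x j E.+ E.0# E.* ι x j
      ≡⟨ Eₚ.solve 2 (λ a x → a :* x :+ :0 :* x := a :* x) refl (emb a) (ι x j) ⟩
    emb a E.* ι x j                                      ∎
    where open ≡-Reasoning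

  ι-injective : ∀ {x y} → ι x ≐W ι y → x ≐ y
  ι-injective {x} {y} e i l = Fₚ.x∙y⁻¹≈ε⇒x≈y _ _ (trans
    (Fₚ.solve 2 (λ x y → x :- y := :1 :* x :+ (:- :1) :* y) refl (x i l) (y i l))
    (ι≐0 {(F.1# ·V x) +V ((F.- F.1#) ·V y)} (λ j → begin
      ι ((F.1# ·V x) +V ((F.- F.1#) ·V y)) j                    ≡⟨ ι-comb F.1# x (F.- F.1#) y j ⟩
      emb F.1# E.* ι x j E.+ emb (F.- F.1#) E.* ι y j
        ≡⟨ cong (λ z → emb F.1# E.* ι x j E.+ z E.* ι y j) (emb-neg F.1#) ⟩
      emb F.1# E.* ι x j E.+ (E.- emb F.1#) E.* ι y j
        ≡⟨ cong (λ z → emb F.1# E.* z E.+ (E.- emb F.1#) E.* ι y j) (e j) ⟩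
      emb F.1# E.* ι y j E.+ (E.- emb F.1#) E.* ι y j
        ≡⟨ Eₚ.solve 2 (λ a x → a :* x :+ (:- a) :* x := :0) refl (emb F.1#) (ι y j) ⟩
      E.0#                                                      ∎) i l))
    where open ≡-Reasoning

  fromBasis-zero : ∀ {c} → (∀ i → c i ≡ F.0#) → fromBasis c ≡ E.0#
  fromBasis-zero {c} e = begin
    fromBasis c                   ≡⟨ fromBasis-cong {c} {λ _ → F.0#} e ⟩
    fromBasis (λ _ → F.0#)
      ≡⟨ cong (λ z → z E.* basis 0F E.+ z E.* basis 1F E.+ z E.* basis 2F) emb-0 ⟩
    E.0# E.* basis 0F E.+ E.0# E.* basis 1F E.+ E.0# E.* basis 2F
      ≡⟨ Eₚ.solve 3 (λ x y z → :0 :* x :+ :0 :* y :+ :0 :* z := :0) refl (basis 0F) (basis 1F) (basis 2F) ⟩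
    E.0#                          ∎
    where open ≡-Reasoning

  ι-zero : ∀ {x} → x ≐ 0V → ι x ≐W 0W
  ι-zero {x} e j = fromBasis-zero {x j} (e j)

  ι-≢0 : ∀ {x} → NonzeroV x → NonzeroW (ι x)
  ι-≢0 x≢0 e = x≢0 (ι≐0 e)

  embVec : (Fin 3 → F.Carrier) → W
  embVec z i = emb (z i)

  module _ (_≟_ : DecidableEquality F.Carrier) where

    emb-injective : ∀ {a b} → emb a ≡ emb b → a ≡ b
    emb-injective {a} {b} e with (a Fₚ.- b) ≟ F.0#
    ... | yes a-b≡0 = Fₚ.x∙y⁻¹≈ε⇒x≈y a b a-b≡0
    ... | no a-b≢0  = ⊥-elim (emb-≢0 a-b≢0 (trans (emb-- a b)
            (trans (cong (Eₚ._- emb b) e) (Eₚ.-‿inverseʳ (emb b)))))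

    E-≟ : DecidableEquality E.Carrier
    E-≟ x y = map′
      (λ { (e₀ , e₁ , e₂) → trans (sym (from-toBasis x)) (trans
             (fromBasis-cong {toBasis x} {toBasis y} λ { 0F → e₀ ; 1F → e₁ ; 2F → e₂ }) (from-toBasis y)) })
      (λ { refl → refl , refl , refl })
      ((toBasis x 0F ≟ toBasis y 0F) ×-dec (toBasis x 1F ≟ toBasis y 1F) ×-dec
       (toBasis x 2F ≟ toBasis y 2F))

  ≐W-sym : ∀ {P Q : W} → P ≐W Q → Q ≐W P
  ≐W-sym e i = sym (e i)

  abstract
    SamePtW-trans : ∀ {P Q R : W} → SamePtW P Q → SamePtW Q R → SamePtW P R
    SamePtW-trans (c , e) (d , f) = d E.* c , λ i → trans (f i) (trans (cong (d E.*_) (e i)) (sym (Eₚ.*-assoc d c _)))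

    SamePtW-sym : ∀ {P Q : W} → NonzeroW Q → SamePtW P Q → SamePtW Q P
    SamePtW-sym {P} {Q} Q≢0 (c , e) =
      let (d , cd≡1) = E.inverse c (λ c≡0 → Q≢0 λ i → trans (e i) (trans (cong (E._* P i) c≡0) (Eₚ.zeroˡ _))) in
      d , λ i → begin
        P i                    ≡⟨ sym (Eₚ.*-identityˡ (P i)) ⟩
        E.1# E.* P i           ≡⟨ cong (E._* P i) (sym cd≡1) ⟩
        (c E.* d) E.* P i
          ≡⟨ Eₚ.solve 3 (λ c d p → c :* d :* p := d :* (c :* p)) refl c d (P i) ⟩
        d E.* (c E.* P i)      ≡⟨ cong (d E.*_) (sym (e i)) ⟩
        d E.* Q i              ∎
      where open ≡-Reasoning

  -- Coordinates with respect to a basis of E³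

  module Frame (_≟_ : DecidableEquality E.Carrier) (s : Fin 3 → W)
               (indep : Indep3W (s 0F) (s 1F) (s 2F)) where

    frame : W → W
    frame p = Σ3 _+W_ (λ i → p i ·W s i)

    frame-cong : ∀ {p r} → p ≐W r → frame p ≐W frame r
    frame-cong e j = cong₂ E._+_ (cong₂ E._+_ (cong (E._* s 0F j) (e 0F)) (cong (E._* s 1F j) (e 1F)))
                       (cong (E._* s 2F j) (e 2F))

    frame-comb : ∀ a p b r → frame ((a ·W p) +W (b ·W r)) ≐W ((a ·W frame p) +W (b ·W frame r))
    frame-comb a p b r j = Eₚ.solve 11 (λ a b c₀ c₁ c₂ d₀ d₁ d₂ β₀ β₁ β₂ →
       (a :* c₀ :+ b :* d₀) :* β₀ :+ (a :* c₁ :+ b :* d₁) :* β₁ :+ (a :* c₂ :+ b :* d₂) :* β₂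
       := a :* (c₀ :* β₀ :+ c₁ :* β₁ :+ c₂ :* β₂) :+ b :* (d₀ :* β₀ :+ d₁ :* β₁ :+ d₂ :* β₂))
       refl a b (p 0F) (p 1F) (p 2F) (r 0F) (r 1F) (r 2F) (s 0F j) (s 1F j) (s 2F j)

    frame-zero : ∀ {p} → p ≐W 0W → frame p ≐W 0W
    frame-zero {p} e j = trans (frame-cong {p} {0W} e j)
      (Eₚ.solve 3 (λ x y z → :0 :* x :+ :0 :* y :+ :0 :* z := :0) refl (s 0F j) (s 1F j) (s 2F j))

    frame≐0 : ∀ {p} → frame p ≐W 0W → p ≐W 0W
    frame≐0 {p} e = let (a , b , c) = indep (p 0F) (p 1F) (p 2F) e in
      λ { 0F → a ; 1F → b ; 2F → c }

    private
      s₀s₁-indep : ∀ a b → (∀ i → a E.* s 0F i E.+ b E.* s 1F i ≡ E.0#) → a ≡ E.0# × b ≡ E.0#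
      s₀s₁-indep a b e = let (a≡0 , b≡0 , _) = indep a b E.0# (λ i → trans
                              (Eₚ.solve 2 (λ x y → x :+ :0 :* y := x) refl (a E.* s 0F i E.+ b E.* s 1F i) (s 2F i))
                              (e i)) in a≡0 , b≡0

    -- Exchange: complete s₀, s₁ by a unit vector and expand both P and s₂. The coefficient `c′` of
    -- the unit vector in s₂ is nonzero by independence, so s₂ can replace the unit vector.
    frame-spans : ∀ P → ∃[ p ] P ≐W frame p
    frame-spans P =
      let (k , completes) = Eₚ.independent⇒completes _≟_ (s 0F) (s 1F) s₀s₁-indep
          open Eₚ.Completes completes
          (a , b , c , eP) = spans P
          (a′ , b′ , c′ , es) = spans (s 2F)
          c′≢0 : ¬ c′ ≡ E.0#
          c′≢0 c′≡0 = Eₚ.1≢0 (proj₂ (proj₂ (indep (E.- a′) (E.- b′) E.1# λ i → begin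
            ((E.- a′) E.* s 0F i E.+ (E.- b′) E.* s 1F i) E.+ E.1# E.* s 2F i
              ≡⟨ cong (λ z → ((E.- a′) E.* s 0F i E.+ (E.- b′) E.* s 1F i) E.+ E.1# E.* z) (es i) ⟩
            ((E.- a′) E.* s 0F i E.+ (E.- b′) E.* s 1F i) E.+ E.1# E.* (a′ E.* s 0F i E.+ b′ E.* s 1F i E.+ c′ E.* Eₚ.δ k i)
              ≡⟨ Eₚ.solve 6 (λ a b c x y d → (:- a) :* x :+ (:- b) :* y :+ :1 :* (a :* x :+ b :* y :+ c :* d) := c :* d)
                   refl a′ b′ c′ (s 0F i) (s 1F i) (Eₚ.δ k i) ⟩
            c′ E.* Eₚ.δ k i
              ≡⟨ cong (E._* Eₚ.δ k i) c′≡0 ⟩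
            E.0# E.* Eₚ.δ k i
              ≡⟨ Eₚ.zeroˡ _ ⟩
            E.0# ∎)))
          (r , c≡c′r) = Eₚ.solve-* c′≢0 c
      in (λ { 0F → a Eₚ.- r E.* a′ ; 1F → b Eₚ.- r E.* b′ ; 2F → r }) , λ i → begin
        P i ≡⟨ eP i ⟩
        a E.* s 0F i E.+ b E.* s 1F i E.+ c E.* Eₚ.δ k i
          ≡⟨ cong (λ z → a E.* s 0F i E.+ b E.* s 1F i E.+ z E.* Eₚ.δ k i) c≡c′r ⟩
        a E.* s 0F i E.+ b E.* s 1F i E.+ (c′ E.* r) E.* Eₚ.δ k i
          ≡⟨ Eₚ.solve 9 (λ a b a′ b′ c′ r x y d →
               a :* x :+ b :* y :+ (c′ :* r) :* d
               := (a :- r :* a′) :* x :+ (b :- r :* b′) :* y :+ r :* (a′ :* x :+ b′ :* y :+ c′ :* d))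
               refl a b a′ b′ c′ r (s 0F i) (s 1F i) (Eₚ.δ k i) ⟩
        (a Eₚ.- r E.* a′) E.* s 0F i E.+ (b Eₚ.- r E.* b′) E.* s 1F i
          E.+ r E.* (a′ E.* s 0F i E.+ b′ E.* s 1F i E.+ c′ E.* Eₚ.δ k i)
          ≡⟨ cong (λ z → (a Eₚ.- r E.* a′) E.* s 0F i E.+ (b Eₚ.- r E.* b′) E.* s 1F i E.+ r E.* z) (sym (es i)) ⟩
        (a Eₚ.- r E.* a′) E.* s 0F i E.+ (b Eₚ.- r E.* b′) E.* s 1F i E.+ r E.* s 2F i ∎
      where open ≡-Reasoning

    abstract
      coords : W → W
      coords P = proj₁ (frame-spans P)

      frame-coords : ∀ P → frame (coords P) ≐W P
      frame-coords P = ≐W-sym (proj₂ (frame-spans P))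

    frame-injective : ∀ {p r} → frame p ≐W frame r → p ≐W r
    frame-injective {p} {r} e i = Eₚ.x∙y⁻¹≈ε⇒x≈y _ _ (trans
      (Eₚ.solve 2 (λ x y → x :- y := :1 :* x :+ (:- :1) :* y) refl (p i) (r i))
      (frame≐0 {(E.1# ·W p) +W ((E.- E.1#) ·W r)} (λ j → begin
        frame ((E.1# ·W p) +W ((E.- E.1#) ·W r)) j
          ≡⟨ frame-comb E.1# p (E.- E.1#) r j ⟩
        E.1# E.* frame p j E.+ (E.- E.1#) E.* frame r j
          ≡⟨ cong (λ z → E.1# E.* z E.+ (E.- E.1#) E.* frame r j) (e j) ⟩
        E.1# E.* frame r j E.+ (E.- E.1#) E.* frame r j
          ≡⟨ Eₚ.solve 1 (λ x → :1 :* x :+ (:- :1) :* x := :0) refl (frame r j) ⟩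
        E.0#                                                    ∎) i))
      where open ≡-Reasoning

    abstract
      -- In these coordinates the points of the subplane are the E-multiples of vectors over F, so
      -- type I becomes a condition of rationality.
      ψ : V → W
      ψ x = coords (ι x)

      frame-ψ : ∀ x → frame (ψ x) ≐W ι x
      frame-ψ x = frame-coords (ι x)

    ψ-cong : ∀ {x y} → x ≐ y → ψ x ≐W ψ y
    ψ-cong {x} {y} e = frame-injective λ i → trans (frame-ψ x i) (trans (ι-cong e i) (sym (frame-ψ y i)))

    ψ-comb : ∀ a x b y → ψ ((a ·V x) +V (b ·V y)) ≐W ((emb a ·W ψ x) +W (emb b ·W ψ y))
    ψ-comb a x b y = frame-injective λ i → begin
      frame (ψ ((a ·V x) +V (b ·V y))) i
        ≡⟨ frame-ψ ((a ·V x) +V (b ·V y)) i ⟩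
      ι ((a ·V x) +V (b ·V y)) i                                   ≡⟨ ι-comb a x b y i ⟩
      emb a E.* ι x i E.+ emb b E.* ι y i
        ≡⟨ sym (cong₂ (λ P Q → emb a E.* P E.+ emb b E.* Q) (frame-ψ x i) (frame-ψ y i)) ⟩
      emb a E.* frame (ψ x) i E.+ emb b E.* frame (ψ y) i
        ≡⟨ sym (frame-comb (emb a) (ψ x) (emb b) (ψ y) i) ⟩
      frame ((emb a ·W ψ x) +W (emb b ·W ψ y)) i                   ∎
      where open ≡-Reasoning

    abstract
      ψ⁻¹ : W → V
      ψ⁻¹ p = ι⁻¹ (frame p)

      ι-ψ⁻¹ : ∀ p → ι (ψ⁻¹ p) ≐W frame p
      ι-ψ⁻¹ p = ι-ι⁻¹ (frame p)

    ψ-ψ⁻¹ : ∀ p → ψ (ψ⁻¹ p) ≐W p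
    ψ-ψ⁻¹ p = frame-injective λ i → trans (frame-ψ (ψ⁻¹ p) i) (ι-ψ⁻¹ p i)

    ψ-injective : ∀ {x y} → ψ x ≐W ψ y → x ≐ y
    ψ-injective {x} {y} e = ι-injective λ i →
      trans (sym (frame-ψ x i)) (trans (frame-cong e i) (frame-ψ y i))

    frame-· : ∀ c p → frame (c ·W p) ≐W (c ·W frame p)
    frame-· c p j = Eₚ.solve 7 (λ c p₀ p₁ p₂ x y z →
      c :* p₀ :* x :+ c :* p₁ :* y :+ c :* p₂ :* z := c :* (p₀ :* x :+ p₁ :* y :+ p₂ :* z))
      refl c (p 0F) (p 1F) (p 2F) (s 0F j) (s 1F j) (s 2F j)

    frame-≢0 : ∀ {p} → NonzeroW p → NonzeroW (frame p)
    frame-≢0 p≢0 e = p≢0 (frame≐0 e)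

    ψ≐0 : ∀ {x} → ψ x ≐W 0W → x ≐ 0V
    ψ≐0 {x} e = ι≐0 λ i → trans (sym (frame-ψ x i)) (frame-zero {ψ x} e i)

    ψ-≢0 : ∀ {x} → NonzeroV x → NonzeroW (ψ x)
    ψ-≢0 {x} x≢0 e = x≢0 (ψ≐0 {x} e)

    ι-multiple : ∀ {c x y} → ψ y ≐W (c ·W ψ x) → ι y ≐W (c ·W ι x)
    ι-multiple {c} {x} {y} e i = begin
      ι y i                   ≡⟨ sym (frame-ψ y i) ⟩
      frame (ψ y) i           ≡⟨ frame-cong e i ⟩
      frame (c ·W ψ x) i      ≡⟨ frame-· c (ψ x) i ⟩
      c E.* frame (ψ x) i     ≡⟨ cong (c E.*_) (frame-ψ x i) ⟩
      c E.* ι x i             ∎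
      where open ≡-Reasoning

    ψ-multiple : ∀ {c x y} → ι y ≐W (c ·W ι x) → ψ y ≐W (c ·W ψ x)
    ψ-multiple {c} {x} {y} e = frame-injective λ i → begin
      frame (ψ y) i           ≡⟨ frame-ψ y i ⟩
      ι y i                   ≡⟨ e i ⟩
      c E.* ι x i             ≡⟨ cong (c E.*_) (sym (frame-ψ x i)) ⟩
      c E.* frame (ψ x) i     ≡⟨ sym (frame-· c (ψ x) i) ⟩
      frame (c ·W ψ x) i      ∎
      where open ≡-Reasoning

    InS⇒ψ : ∀ {p x} → InS (frame p) x → ∃[ c ] ψ x ≐W (c ·W p)
    InS⇒ψ {p} {x} (c , e) = c , frame-injective {ψ x} {c ·W p} λ i →
      trans (frame-ψ x i) (trans (e i) (sym (frame-· c p i)))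

    InS-ψ⁻¹ : ∀ c p → InS (frame p) (ψ⁻¹ (c ·W p))
    InS-ψ⁻¹ c p = c , λ i → trans (ι-ψ⁻¹ (c ·W p) i) (frame-· c p i)

-- The action of σ in frame coordinates

module FixedLine (F : Field) (K : CubicExt F) {q : ℕ.ℕ} (size : HasSize F q)
  (φ : Geometry.W F K → Geometry.W F K)
  (isCollineation : Geometry.IsCollineation F K φ) (order3W : Geometry.HasOrder3W F K φ)
  (S : Geometry.Subplane F K) (fixesPtwise : Geometry.FixesPtwise F K φ S)
  (σ : Geometry.V F K → Geometry.V F K) (isProjectivity : Geometry.IsProjectivity F K σ)
  (order3V : Geometry.HasOrder3V F K σ) (induces : Geometry.Induces F K σ φ)
  (u v : Geometry.V F K) (uv-indep : Geometry.Indep2V F K u v)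
  (lineFixed : Geometry.Config.LineFixed F K φ S σ u v)
  where
  open Geometry F K
  open Config φ S σ
  open CubicExt K using (emb; emb-+; emb-*; emb-1; basis-indep)
  open IsProjectivity isProjectivity
  open ≡-Reasoning

  _≟_ : DecidableEquality F.Carrier
  _≟_ = listing⇒≟ (proj₁ size) (proj₂ (proj₂ (proj₂ size)))

  open Extension F K
  open Frame (E-≟ _≟_) (Subplane.col S) (Subplane.indep S)

  embVec-≢0 : ∀ z → ¬ (∀ i → z i ≡ F.0#) → NonzeroW (embVec z)
  embVec-≢0 z z≢0 e = let (i , zᵢ≢0) = Fₚ.≢0-coordinate _≟_ z z≢0 in emb-≢0 zᵢ≢0 (e i)

  frame-fixed : ∀ z → ¬ (∀ i → z i ≡ F.0#) → SamePtW (frame (embVec z)) (φ (frame (embVec z)))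
  frame-fixed z z≢0 = fixesPtwise (frame (embVec z)) (frame-≢0 (embVec-≢0 z z≢0))
    (z , z≢0 , E.1# , λ i → sym (Eₚ.*-identityˡ _))

  δ-≢0 : ∀ k → ¬ (∀ i → Fₚ.δ k i ≡ F.0#)
  δ-≢0 0F e = Fₚ.1≢0 (e 0F)
  δ-≢0 1F e = Fₚ.1≢0 (e 1F)
  δ-≢0 2F e = Fₚ.1≢0 (e 2F)

  emb-δ : ∀ k i → emb (Fₚ.δ k i) ≡ Eₚ.δ k i
  emb-δ 0F = λ { 0F → emb-1 ; 1F → emb-0 ; 2F → emb-0 }
  emb-δ 1F = λ { 0F → emb-0 ; 1F → emb-1 ; 2F → emb-0 }
  emb-δ 2F = λ { 0F → emb-0 ; 1F → emb-0 ; 2F → emb-1 }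

  abstract
    -- `induces` puts `σ x` into the S-plane of the image under `φ`, and `φ` fixes this point of the
    -- subplane.
    InS-σ-fixed : ∀ z → ¬ (∀ i → z i ≡ F.0#) → ∀ {x} → InS (frame (embVec z)) x →
                  InS (frame (embVec z)) (σ x)
    InS-σ-fixed z z≢0 {x} x∈ =
      SamePtW-trans (frame-fixed z z≢0)
        (Equivalence.to (induces (frame (embVec z)) (frame-≢0 (embVec-≢0 z z≢0)) x) x∈)

  -- The definition of a projectivity does not say that σ respects pointwise equality; this
  -- comes from the two fixed S-planes of a frame, which meet only in 0.
  σ-zero : ∀ {x} → x ≐ 0V → σ x ≐ 0V
  σ-zero {x} x≐0 = ψ≐0 {σ x} λ { 0F → vanishes 1F 0F refl ; 1F → vanishes 0F 1F refl ; 2F → vanishes 0F 2F refl }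
    where
    multiple : ∀ k → ∃[ c ] ψ (σ x) ≐W (c ·W embVec (Fₚ.δ k))
    multiple k = InS⇒ψ {embVec (Fₚ.δ k)} {σ x}
      (InS-σ-fixed (Fₚ.δ k) (δ-≢0 k) {x} (E.0# , λ i → trans (ι-zero {x} x≐0 i) (sym (Eₚ.zeroˡ _))))
    vanishes : ∀ k i → Eₚ.δ k i ≡ E.0# → ψ (σ x) i ≡ E.0#
    vanishes k i e = let (c , m) = multiple k in
      trans (m i) (trans (cong (c E.*_) (trans (emb-δ k i) e)) (Eₚ.zeroʳ c))

  σ-comb : ∀ a x b y → σ ((a ·V x) +V (b ·V y)) ≐ ((a ·V σ x) +V (b ·V σ y))
  σ-comb a x b y i j = trans (additive (a ·V x) (b ·V y) i j)
    (cong₂ F._+_ (homogeneous a x i j) (homogeneous b y i j))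

  σ-cong : ∀ {x y} → x ≐ y → σ x ≐ σ y
  σ-cong {x} {y} e i j = Fₚ.x∙y⁻¹≈ε⇒x≈y _ _ (begin
    σ x i j Fₚ.- σ y i j
      ≡⟨ Fₚ.solve 2 (λ x y → x :- y := :1 :* x :+ (:- :1) :* y) refl (σ x i j) (σ y i j) ⟩
    F.1# F.* σ x i j F.+ (F.- F.1#) F.* σ y i j
      ≡⟨ sym (σ-comb F.1# x (F.- F.1#) y i j) ⟩
    σ ((F.1# ·V x) +V ((F.- F.1#) ·V y)) i j                  ≡⟨ σ-zero difference≐0 i j ⟩
    F.0#                                                      ∎)
    where
    difference≐0 : ((F.1# ·V x) +V ((F.- F.1#) ·V y)) ≐ 0V
    difference≐0 k l = trans (cong (λ z → F.1# F.* z F.+ (F.- F.1#) F.* y k l) (e k l))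
      (Fₚ.solve 1 (λ y → :1 :* y :+ (:- :1) :* y := :0) refl (y k l))

  τ : W → W
  τ p = ψ (σ (ψ⁻¹ p))

  ψσ : ∀ x → ψ (σ x) ≐W τ (ψ x)
  ψσ x = ψ-cong (σ-cong (ψ-injective λ i → sym (ψ-ψ⁻¹ (ψ x) i)))

  ψ⁻¹-comb : ∀ a p b r → ψ⁻¹ ((emb a ·W p) +W (emb b ·W r)) ≐ ((a ·V ψ⁻¹ p) +V (b ·V ψ⁻¹ r))
  ψ⁻¹-comb a p b r = ψ-injective λ i → begin
    ψ (ψ⁻¹ ((emb a ·W p) +W (emb b ·W r))) i              ≡⟨ ψ-ψ⁻¹ _ i ⟩
    emb a E.* p i E.+ emb b E.* r i
      ≡⟨ sym (cong₂ (λ y z → emb a E.* y E.+ emb b E.* z) (ψ-ψ⁻¹ p i) (ψ-ψ⁻¹ r i)) ⟩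
    emb a E.* ψ (ψ⁻¹ p) i E.+ emb b E.* ψ (ψ⁻¹ r) i       ≡⟨ sym (ψ-comb a (ψ⁻¹ p) b (ψ⁻¹ r) i) ⟩
    ψ ((a ·V ψ⁻¹ p) +V (b ·V ψ⁻¹ r)) i                    ∎

  τ-comb : ∀ a p b r → τ ((emb a ·W p) +W (emb b ·W r)) ≐W ((emb a ·W τ p) +W (emb b ·W τ r))
  τ-comb a p b r i = begin
    τ ((emb a ·W p) +W (emb b ·W r)) i
      ≡⟨ ψ-cong (σ-cong (ψ⁻¹-comb a p b r)) i ⟩
    ψ (σ ((a ·V ψ⁻¹ p) +V (b ·V ψ⁻¹ r))) i
      ≡⟨ ψ-cong (σ-comb a (ψ⁻¹ p) b (ψ⁻¹ r)) i ⟩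
    ψ ((a ·V σ (ψ⁻¹ p)) +V (b ·V σ (ψ⁻¹ r))) i
      ≡⟨ ψ-comb a (σ (ψ⁻¹ p)) b (σ (ψ⁻¹ r)) i ⟩
    emb a E.* τ p i E.+ emb b E.* τ r i                       ∎

  τ-cong : ∀ {p r} → p ≐W r → τ p ≐W τ r
  τ-cong {p} {r} e = ψ-cong (σ-cong (ψ-injective λ i → trans (ψ-ψ⁻¹ p i) (trans (e i) (sym (ψ-ψ⁻¹ r i)))))

  τ-+ : ∀ p r → τ (p +W r) ≐W (τ p +W τ r)
  τ-+ p r i = begin
    τ (p +W r) i
      ≡⟨ τ-cong (λ j → sym (unit (p j) (r j))) i ⟩
    τ ((emb F.1# ·W p) +W (emb F.1# ·W r)) i             ≡⟨ τ-comb F.1# p F.1# r i ⟩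
    emb F.1# E.* τ p i E.+ emb F.1# E.* τ r i            ≡⟨ unit (τ p i) (τ r i) ⟩
    τ p i E.+ τ r i                                      ∎
    where
    unit : ∀ x y → emb F.1# E.* x E.+ emb F.1# E.* y ≡ x E.+ y
    unit x y = trans (cong (λ z → z E.* x E.+ z E.* y) emb-1) (cong₂ E._+_ (Eₚ.*-identityˡ x) (Eₚ.*-identityˡ y))

  σ-≢0 : ∀ {x} → NonzeroV x → NonzeroV (σ x)
  σ-≢0 {x} = nonsingular x

  abstract
    -- The vector `x` lies in its own S-plane, so `σ x` lies in that of `φ (ι x)`; as `σ x` is
    -- nonzero, the factor can be inverted. This is how later statements about `φ` on points of ℓ
    -- are reduced to `σ`.
    φι : ∀ x → NonzeroV x → ∃[ d ] (¬ d ≡ E.0# × φ (ι x) ≐W (d ·W ι (σ x)))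
    φι x x≢0 =
      let (c , e) = Equivalence.to (induces (ι x) (ι-≢0 x≢0) x) (E.1# , λ i → sym (Eₚ.*-identityˡ _))
          (d , f) = SamePtW-sym {φ (ι x)} {ι (σ x)} (ι-≢0 (σ-≢0 x≢0)) (c , e)
      in d , (λ d≡0 → IsCollineation.nonzero isCollineation (ι x) (ι-≢0 x≢0)
               λ i → trans (f i) (trans (cong (E._* _) d≡0) (Eₚ.zeroˡ _))) , f

  ψ⁻¹-≢0 : ∀ {p} → NonzeroW p → NonzeroV (ψ⁻¹ p)
  ψ⁻¹-≢0 {p} p≢0 e = frame-≢0 p≢0 λ i → trans (sym (ι-ψ⁻¹ p i))
    (ι-zero {ψ⁻¹ p} e i)

  abstract
    -- Both vectors come from one S-plane, so their images lie in one S-plane. A priori the factor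
    -- `e` depends on `p` as well as on `c`.
    τ-line : ∀ c p → NonzeroW p → ∃[ e ] τ (c ·W p) ≐W (e ·W τ p)
    τ-line c p p≢0 =
      let x = ψ⁻¹ p
          (a , e) = Equivalence.to (induces (ι x) (ι-≢0 (ψ⁻¹-≢0 p≢0)) (ψ⁻¹ (c ·W p)))
                      (c , λ i → trans (ι-ψ⁻¹ (c ·W p) i) (trans (frame-· c p i) (cong (c E.*_) (sym (ι-ψ⁻¹ p i)))))
          (d , _ , f) = φι x (ψ⁻¹-≢0 p≢0)
      in a E.* d , ψ-multiple {a E.* d} {σ x} {σ (ψ⁻¹ (c ·W p))}
           λ i → trans (e i) (trans (cong (a E.*_) (f i)) (sym (Eₚ.*-assoc a d _)))

    τ-embVec : ∀ c z → ¬ (∀ i → z i ≡ F.0#) → ∃[ e ] τ (c ·W embVec z) ≐W (e ·W embVec z)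
    τ-embVec c z z≢0 = InS⇒ψ {embVec z} {σ (ψ⁻¹ (c ·W embVec z))}
      (InS-σ-fixed z z≢0 {ψ⁻¹ (c ·W embVec z)} (InS-ψ⁻¹ c (embVec z)))

  -- The semilinear map induced by σ

  abstract
    gₖ : Fin 3 → E.Carrier → E.Carrier
    gₖ k c = proj₁ (τ-embVec c (Fₚ.δ k) (δ-≢0 k))

    τ-emb-δ : ∀ k c → τ (c ·W embVec (Fₚ.δ k)) ≐W (gₖ k c ·W embVec (Fₚ.δ k))
    τ-emb-δ k c = proj₂ (τ-embVec c (Fₚ.δ k) (δ-≢0 k))

  τ-δ : ∀ k c → τ (c ·W Eₚ.δ k) ≐W (gₖ k c ·W Eₚ.δ k)
  τ-δ k c i = trans (τ-cong {c ·W Eₚ.δ k} {c ·W embVec (Fₚ.δ k)} (λ j → cong (c E.*_) (sym (emb-δ k j))) i)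
    (trans (τ-emb-δ k c i) (cong (gₖ k c E.*_) (emb-δ k i)))

  -- `τ` is additive and maps each coordinate axis into itself, so a coordinate of the image depends
  -- on the same coordinate of `p` alone.
  τ-diagonal : ∀ p i → τ p i ≡ gₖ i (p i)
  τ-diagonal p i = begin
    τ p i
      ≡⟨ τ-cong {p} {((p 0F ·W Eₚ.δ 0F) +W (p 1F ·W Eₚ.δ 1F)) +W (p 2F ·W Eₚ.δ 2F)} decompose i ⟩
    τ (((p 0F ·W Eₚ.δ 0F) +W (p 1F ·W Eₚ.δ 1F)) +W (p 2F ·W Eₚ.δ 2F)) i
      ≡⟨ τ-+ ((p 0F ·W Eₚ.δ 0F) +W (p 1F ·W Eₚ.δ 1F)) (p 2F ·W Eₚ.δ 2F) i ⟩
    τ ((p 0F ·W Eₚ.δ 0F) +W (p 1F ·W Eₚ.δ 1F)) i E.+ τ (p 2F ·W Eₚ.δ 2F) i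
      ≡⟨ cong (E._+ τ (p 2F ·W Eₚ.δ 2F) i) (τ-+ (p 0F ·W Eₚ.δ 0F) (p 1F ·W Eₚ.δ 1F) i) ⟩
    τ (p 0F ·W Eₚ.δ 0F) i E.+ τ (p 1F ·W Eₚ.δ 1F) i E.+ τ (p 2F ·W Eₚ.δ 2F) i
      ≡⟨ cong₂ E._+_ (cong₂ E._+_ (τ-δ 0F (p 0F) i) (τ-δ 1F (p 1F) i)) (τ-δ 2F (p 2F) i) ⟩
    gₖ 0F (p 0F) E.* Eₚ.δ 0F i E.+ gₖ 1F (p 1F) E.* Eₚ.δ 1F i E.+ gₖ 2F (p 2F) E.* Eₚ.δ 2F i
      ≡⟨ sym (sift (λ k → gₖ k (p k)) i) ⟩
    gₖ i (p i) ∎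
    where
    sift : ∀ (h : W) → h ≐W (((h 0F ·W Eₚ.δ 0F) +W (h 1F ·W Eₚ.δ 1F)) +W (h 2F ·W Eₚ.δ 2F))
    sift h 0F = Eₚ.solve 3 (λ x y z → x := x :* :1 :+ y :* :0 :+ z :* :0) refl (h 0F) (h 1F) (h 2F)
    sift h 1F = Eₚ.solve 3 (λ x y z → y := x :* :0 :+ y :* :1 :+ z :* :0) refl (h 0F) (h 1F) (h 2F)
    sift h 2F = Eₚ.solve 3 (λ x y z → z := x :* :0 :+ y :* :0 :+ z :* :1) refl (h 0F) (h 1F) (h 2F)
    decompose : p ≐W (((p 0F ·W Eₚ.δ 0F) +W (p 1F ·W Eₚ.δ 1F)) +W (p 2F ·W Eₚ.δ 2F))
    decompose = sift p

  ones : Fin 3 → F.Carrier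
  ones _ = F.1#

  abstract
    g : E.Carrier → E.Carrier
    g c = proj₁ (τ-embVec c ones λ e → Fₚ.1≢0 (e 0F))

    τ-ones : ∀ c → τ (c ·W embVec ones) ≐W (g c ·W embVec ones)
    τ-ones c = proj₂ (τ-embVec c ones λ e → Fₚ.1≢0 (e 0F))

  -- The unit point of the frame also belongs to the subplane. Its S-plane is fixed, which ties the
  -- three axes together: every coordinate of the image of c (1, 1, 1) is the same.
  gₖ≡g : ∀ k c → gₖ k c ≡ g c
  gₖ≡g k c = begin
    gₖ k c                        ≡⟨ cong (gₖ k) (sym (unit c)) ⟩
    gₖ k (c E.* emb F.1#)         ≡⟨ sym (τ-diagonal (c ·W embVec ones) k) ⟩
    τ (c ·W embVec ones) k        ≡⟨ τ-ones c k ⟩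
    g c E.* emb F.1#              ≡⟨ unit (g c) ⟩
    g c                           ∎
    where
    unit : ∀ x → x E.* emb F.1# ≡ x
    unit x = trans (cong (x E.*_) emb-1) (Eₚ.*-identityʳ x)

  τ≡g : ∀ p i → τ p i ≡ g (p i)
  τ≡g p i = trans (τ-diagonal p i) (gₖ≡g i (p i))

  ψσ≡g : ∀ x i → ψ (σ x) i ≡ g (ψ x i)
  ψσ≡g x i = trans (ψσ x i) (τ≡g (ψ x) i)

  g-comb : ∀ a x b y → g (emb a E.* x E.+ emb b E.* y) ≡ emb a E.* g x E.+ emb b E.* g y
  g-comb a x b y = begin
    g (emb a E.* x E.+ emb b E.* y)
      ≡⟨ sym (τ≡g (λ _ → emb a E.* x E.+ emb b E.* y) 0F) ⟩
    τ (λ _ → emb a E.* x E.+ emb b E.* y) 0F      ≡⟨ τ-comb a (λ _ → x) b (λ _ → y) 0F ⟩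
    emb a E.* τ (λ _ → x) 0F E.+ emb b E.* τ (λ _ → y) 0F
      ≡⟨ cong₂ (λ u v → emb a E.* u E.+ emb b E.* v) (τ≡g (λ _ → x) 0F) (τ≡g (λ _ → y) 0F) ⟩
    emb a E.* g x E.+ emb b E.* g y ∎

  -- σ maps the E-line through (1, d, d) into an E-line; compare the images of (1, d, d) and (c, cd, cd).
  g-* : ∀ c d → g (c E.* d) E.* g E.1# ≡ g c E.* g d
  g-* c d =
    let p : W
        p = λ { 0F → E.1# ; 1F → d ; 2F → d }
        (e , m) = τ-line c p (λ p≐0 → Eₚ.1≢0 (p≐0 0F))
        at : ∀ i → g (c E.* p i) ≡ e E.* g (p i)
        at i = trans (sym (τ≡g (c ·W p) i)) (trans (m i) (cong (e E.*_) (τ≡g p i)))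
    in begin
      g (c E.* d) E.* g E.1#            ≡⟨ cong (E._* g E.1#) (at 1F) ⟩
      (e E.* g d) E.* g E.1#
        ≡⟨ Eₚ.solve 3 (λ e d u → e :* d :* u := e :* u :* d) refl e (g d) (g E.1#) ⟩
      (e E.* g E.1#) E.* g d            ≡⟨ cong (E._* g d) (sym (at 0F)) ⟩
      g (c E.* E.1#) E.* g d            ≡⟨ cong (λ z → g z E.* g d) (Eₚ.*-identityʳ c) ⟩
      g c E.* g d                       ∎

  g-≢0 : ∀ {c} → ¬ c ≡ E.0# → ¬ g c ≡ E.0#
  g-≢0 {c} c≢0 gc≡0 = ψ-≢0 (σ-≢0 (ψ⁻¹-≢0 {λ _ → c} (λ e → c≢0 (e 0F)))) λ i →
    trans (τ≡g (λ _ → c) i) gc≡0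

  -- The fixed field of the automorphism g / g 1 of E, written without division.
  Fix : E.Carrier → Set
  Fix r = g r ≡ r E.* g E.1#

  g1≢0 : ¬ g E.1# ≡ E.0#
  g1≢0 = g-≢0 Eₚ.1≢0

  fix-comb : ∀ a {x} b {y} → Fix x → Fix y → Fix (emb a E.* x E.+ emb b E.* y)
  fix-comb a {x} b {y} fx fy = begin
    g (emb a E.* x E.+ emb b E.* y)                               ≡⟨ g-comb a x b y ⟩
    emb a E.* g x E.+ emb b E.* g y
      ≡⟨ cong₂ (λ u v → emb a E.* u E.+ emb b E.* v) fx fy ⟩
    emb a E.* (x E.* g E.1#) E.+ emb b E.* (y E.* g E.1#)
      ≡⟨ Eₚ.solve 5 (λ a b x y u → a :* (x :* u) :+ b :* (y :* u) := (a :* x :+ b :* y) :* u) refl (emb a) (emb b) x y (g E.1#) ⟩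
    (emb a E.* x E.+ emb b E.* y) E.* g E.1#                      ∎

  fix-1 : Fix E.1#
  fix-1 = sym (Eₚ.*-identityˡ _)

  fix-quotient : ∀ {r w} → ¬ w ≡ E.0# → Fix w → Fix (r E.* w) → Fix r
  fix-quotient {r} {w} w≢0 fw frw = Eₚ.*-cancelˡ (Eₚ.*-≢0 w≢0 g1≢0) (begin
    (w E.* g E.1#) E.* g r               ≡⟨ cong (E._* g r) (sym fw) ⟩
    g w E.* g r                          ≡⟨ Eₚ.*-comm (g w) (g r) ⟩
    g r E.* g w                          ≡⟨ sym (g-* r w) ⟩
    g (r E.* w) E.* g E.1#               ≡⟨ cong (E._* g E.1#) frw ⟩
    ((r E.* w) E.* g E.1#) E.* g E.1#
      ≡⟨ Eₚ.solve 3 (λ r w u → r :* w :* u :* u := w :* u :* (r :* u)) refl r w (g E.1#) ⟩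
    (w E.* g E.1#) E.* (r E.* g E.1#)    ∎)

  -- Otherwise `σ` would multiply every vector by `g 1` over E and so preserve every S-plane, while
  -- `φ` moves some point by `order3W`.
  not-all-fixed : ¬ (∀ e → Fix e)
  not-all-fixed all = let (_ , P , P≢0 , P≁φP) = order3W
                          x = ψ⁻¹ (coords P)
                          P≐ιx : P ≐W ι x
                          P≐ιx i = sym (trans (ι-ψ⁻¹ (coords P) i) (frame-coords P i))
                          x≢0 : NonzeroV x
                          x≢0 e = P≢0 λ i → trans (P≐ιx i) (ι-zero {x} e i)
                          (d , _ , φιx) = φι x x≢0
                          σx : ι (σ x) ≐W (g E.1# ·W ι x)
                          σx = ι-multiple {g E.1#} {x} {σ x} λ i → trans (ψσ≡g x i) (trans (all (ψ x i)) (Eₚ.*-comm _ _))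
                          P~ιx : SamePtW P (ι x)
                          P~ιx = E.1# , λ i → trans (sym (P≐ιx i)) (sym (Eₚ.*-identityˡ _))
                          -- `P` and `ι x` agree only coordinatewise, so the passage between their
                          -- images under `φ` goes through `wd`.
                          φιx~φP = IsCollineation.wd isCollineation (ι x) P (ι-≢0 x≢0) P≢0
                                     (E.1# , λ i → trans (P≐ιx i) (sym (Eₚ.*-identityˡ _)))
    in P≁φP (SamePtW-trans {P} {φ (ι x)} {φ P} (SamePtW-trans {P} {ι (σ x)} {φ (ι x)} (SamePtW-trans {P} {ι x} {ι (σ x)} P~ιx (g E.1# , σx)) (d , φιx)) φιx~φP)

  -- If r were fixed but not in F, then 1, r would be independent over F, so each e would satisfy
  -- e (c + d r) = a + b r with (c, d) ≠ 0, hence be fixed, and φ would be the identity.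
  fix⇒∈F : ∀ {r} → Fix r → ∃[ f ] r ≡ emb f
  fix⇒∈F {r} fr = [ (λ { (_ , _ , _ , _ , c) → ⊥-elim (not-all-fixed (all-fixed c)) }) , multiple ]′
                    (Fₚ.completes⊎proportional _≟_ (toBasis E.1#) (toBasis r))
    where
    multiple : (∀ i j → toBasis E.1# i F.* toBasis r j ≡ toBasis E.1# j F.* toBasis r i) → ∃[ f ] r ≡ emb f
    multiple prop =
      let (f , e) = Fₚ.proportional⇒multiple _≟_ (toBasis E.1#) (toBasis r)
                      (λ z → Eₚ.1≢0 (trans (sym (from-toBasis E.1#)) (fromBasis-zero {toBasis E.1#} z))) prop
      in f , (begin
        r                                                  ≡⟨ sym (from-toBasis r) ⟩
        fromBasis (toBasis r)
          ≡⟨ fromBasis-cong {toBasis r} (λ i → trans (e i) (Fₚ.solve 2 (λ f x → f :* x := f :* x :+ :0 :* x) refl f (toBasis E.1# i))) ⟩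
        fromBasis (λ i → f F.* toBasis E.1# i F.+ F.0# F.* toBasis E.1# i)
                                                           ≡⟨ fromBasis-comb f (toBasis E.1#) F.0# (toBasis E.1#) ⟩
        emb f E.* fromBasis (toBasis E.1#) E.+ emb F.0# E.* fromBasis (toBasis E.1#)
          ≡⟨ cong₂ (λ u v → emb f E.* u E.+ v E.* u) (from-toBasis E.1#) emb-0 ⟩
        emb f E.* E.1# E.+ E.0# E.* E.1#
          ≡⟨ Eₚ.solve 1 (λ f → f :* :1 :+ :0 :* :1 := f) refl (emb f) ⟩
        emb f                                              ∎)

    module _ {k : Fin 3} (c : Fₚ.Completes (toBasis E.1#) (toBasis r) k) where
      open Fₚ.Completes c

      β : E.Carrier
      β = fromBasis (Fₚ.δ k)

      fromBasis-comb₃ : ∀ a b c → fromBasis (λ i → (a F.* toBasis E.1# i F.+ b F.* toBasis r i) F.+ c F.* Fₚ.δ k i)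
                        ≡ (emb a E.* E.1# E.+ emb b E.* r) E.+ emb c E.* β
      fromBasis-comb₃ a b c = begin
        fromBasis (λ i → (a F.* toBasis E.1# i F.+ b F.* toBasis r i) F.+ c F.* Fₚ.δ k i)
          ≡⟨ fromBasis-cong {λ i → (a F.* toBasis E.1# i F.+ b F.* toBasis r i) F.+ c F.* Fₚ.δ k i} (λ i → cong (F._+ (c F.* Fₚ.δ k i)) (sym (Fₚ.*-identityˡ _))) ⟩
        fromBasis (λ i → F.1# F.* (a F.* toBasis E.1# i F.+ b F.* toBasis r i) F.+ c F.* Fₚ.δ k i)
          ≡⟨ fromBasis-comb F.1# (λ i → a F.* toBasis E.1# i F.+ b F.* toBasis r i) c (Fₚ.δ k) ⟩
        emb F.1# E.* fromBasis (λ i → a F.* toBasis E.1# i F.+ b F.* toBasis r i) E.+ emb c E.* β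
          ≡⟨ cong₂ (λ u v → u E.* v E.+ emb c E.* β) emb-1 (fromBasis-comb a (toBasis E.1#) b (toBasis r)) ⟩
        E.1# E.* (emb a E.* fromBasis (toBasis E.1#) E.+ emb b E.* fromBasis (toBasis r)) E.+ emb c E.* β
          ≡⟨ cong (E._+ (emb c E.* β)) (Eₚ.*-identityˡ _) ⟩
        (emb a E.* fromBasis (toBasis E.1#) E.+ emb b E.* fromBasis (toBasis r)) E.+ emb c E.* β
          ≡⟨ cong₂ (λ u v → (emb a E.* u E.+ emb b E.* v) E.+ emb c E.* β) (from-toBasis E.1#) (from-toBasis r) ⟩
        (emb a E.* E.1# E.+ emb b E.* r) E.+ emb c E.* β ∎

      expand : ∀ e → ∃[ a ] ∃[ b ] ∃[ c ] e ≡ (emb a E.* E.1# E.+ emb b E.* r) E.+ emb c E.* β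
      expand e = let (a , b , c , m) = spans (toBasis e) in
        a , b , c , trans (sym (from-toBasis e)) (trans (fromBasis-cong {toBasis e} m) (fromBasis-comb₃ a b c))

      1,r-independent : ∀ {a b} → emb a E.* E.1# E.+ emb b E.* r ≡ E.0# → b ≡ F.0#
      1,r-independent {a} {b} e = proj₁ (proj₂ (independent a b F.0# (CubicExt.basis-indep K _ (begin
        fromBasis (λ i → (a F.* toBasis E.1# i F.+ b F.* toBasis r i) F.+ F.0# F.* Fₚ.δ k i)
          ≡⟨ fromBasis-comb₃ a b F.0# ⟩
        (emb a E.* E.1# E.+ emb b E.* r) E.+ emb F.0# E.* β
          ≡⟨ cong₂ (λ u v → u E.+ v E.* β) e emb-0 ⟩
        E.0# E.+ E.0# E.* β ≡⟨ Eₚ.solve 1 (λ x → :0 :+ :0 :* x := :0) refl β ⟩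
        E.0# ∎))))

      all-fixed : ∀ e → Fix e
      all-fixed e =
        let (a , b , c , m) = expand e
            (a′ , b′ , c′ , m′) = expand (e E.* r)
        in by-cases a b c m a′ b′ c′ m′ (c ≟ F.0#)
        where
        by-cases : ∀ a b c → e ≡ (emb a E.* E.1# E.+ emb b E.* r) E.+ emb c E.* β →
                   ∀ a′ b′ c′ → e E.* r ≡ (emb a′ E.* E.1# E.+ emb b′ E.* r) E.+ emb c′ E.* β →
                   Dec (c ≡ F.0#) → Fix e
        by-cases a b c m a′ b′ c′ m′ (yes c≡0) = subst Fix (sym (begin
          e                                                     ≡⟨ m ⟩
          (emb a E.* E.1# E.+ emb b E.* r) E.+ emb c E.* β
            ≡⟨ cong (λ z → _ E.+ z E.* β) (trans (cong emb c≡0) emb-0) ⟩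
          (emb a E.* E.1# E.+ emb b E.* r) E.+ E.0# E.* β
            ≡⟨ Eₚ.solve 2 (λ x y → x :+ :0 :* y := x) refl _ β ⟩
          emb a E.* E.1# E.+ emb b E.* r                        ∎)) (fix-comb a b fix-1 fr)
        -- Eliminating β from the expansions of e and e r gives e (c′ - c r) = (c′ a - c a′) + (c′ b
        -- - c b′) r. The factor c′ - c r is nonzero because c is and 1, r are independent.
        by-cases a b c m a′ b′ c′ m′ (no c≢0) = fix-quotient {e} {emb c′ E.* E.1# E.+ emb (F.- c) E.* r}
          (λ w≡0 → c≢0 (trans (sym (Fₚ.-‿involutive c)) (trans (cong F.-_ (1,r-independent w≡0)) Fₚ.-0#≈0#)))
          (fix-comb c′ (F.- c) fix-1 fr)
          (subst Fix (sym relation) (fix-comb F.1# F.1#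
             (fix-comb (c′ F.* a) (c′ F.* b) fix-1 fr)
             (fix-comb (F.- (c F.* a′)) (F.- (c F.* b′)) fix-1 fr)))
          where
          emb-neg* : ∀ x y → emb (F.- (x F.* y)) ≡ E.- (emb x E.* emb y)
          emb-neg* x y = trans (emb-neg _) (cong E.-_ (emb-* x y))
          relation : e E.* (emb c′ E.* E.1# E.+ emb (F.- c) E.* r) ≡
                     emb F.1# E.* (emb (c′ F.* a) E.* E.1# E.+ emb (c′ F.* b) E.* r) E.+
                     emb F.1# E.* (emb (F.- (c F.* a′)) E.* E.1# E.+ emb (F.- (c F.* b′)) E.* r)
          relation = begin
            e E.* (emb c′ E.* E.1# E.+ emb (F.- c) E.* r)
              ≡⟨ cong (λ z → e E.* (emb c′ E.* E.1# E.+ z E.* r)) (emb-neg c) ⟩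
            e E.* (emb c′ E.* E.1# E.+ (E.- emb c) E.* r)
              ≡⟨ Eₚ.solve 4 (λ e c c′ r → e :* (c′ :* :1 :+ (:- c) :* r) := c′ :* e :- c :* (e :* r)) refl e (emb c) (emb c′) r ⟩
            emb c′ E.* e Eₚ.- emb c E.* (e E.* r)
              ≡⟨ cong₂ (λ x y → emb c′ E.* x Eₚ.- emb c E.* y) m m′ ⟩
            emb c′ E.* ((emb a E.* E.1# E.+ emb b E.* r) E.+ emb c E.* β) Eₚ.-
              emb c E.* ((emb a′ E.* E.1# E.+ emb b′ E.* r) E.+ emb c′ E.* β)
              ≡⟨ Eₚ.solve 8 (λ a b c a′ b′ c′ r β →
                   c′ :* (a :* :1 :+ b :* r :+ c :* β) :- c :* (a′ :* :1 :+ b′ :* r :+ c′ :* β)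
                   := :1 :* ((c′ :* a) :* :1 :+ (c′ :* b) :* r) :+ :1 :* ((:- (c :* a′)) :* :1 :+ (:- (c :* b′)) :* r))
                   refl (emb a) (emb b) (emb c) (emb a′) (emb b′) (emb c′) r β ⟩
            E.1# E.* ((emb c′ E.* emb a) E.* E.1# E.+ (emb c′ E.* emb b) E.* r) E.+
            E.1# E.* ((E.- (emb c E.* emb a′)) E.* E.1# E.+ (E.- (emb c E.* emb b′)) E.* r)
              ≡⟨ sym (cong₂ E._+_
                   (cong₂ E._*_ emb-1 (cong₂ (λ u v → u E.* E.1# E.+ v E.* r) (emb-* c′ a) (emb-* c′ b)))
                   (cong₂ E._*_ emb-1 (cong₂ (λ u v → u E.* E.1# E.+ v E.* r) (emb-neg* c a′) (emb-neg* c b′)))) ⟩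
            emb F.1# E.* (emb (c′ F.* a) E.* E.1# E.+ emb (c′ F.* b) E.* r) E.+
            emb F.1# E.* (emb (F.- (c F.* a′)) E.* E.1# E.+ emb (F.- (c F.* b′)) E.* r) ∎

  fix-emb : ∀ f → g (emb f) ≡ emb f E.* g E.1#
  fix-emb f = subst Fix
    (trans (cong (λ z → emb f E.* E.1# E.+ z E.* E.1#) emb-0)
      (Eₚ.solve 1 (λ x → x :* :1 :+ :0 :* :1 := x) refl (emb f)))
    (fix-comb f F.0# fix-1 fix-1)

  eigen-ratio : ∀ {k z z′} → ¬ z ≡ E.0# → g z ≡ k E.* z → g z′ ≡ k E.* z′ → ∃[ f ] z′ ≡ z E.* emb f
  eigen-ratio {k} {z} {z′} z≢0 e e′ =
    let (r , z′≡zr) = Eₚ.solve-* z≢0 z′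
        (f , r≡f) = fix⇒∈F {r} (Eₚ.*-cancelˡ (g-≢0 z≢0) (begin
          g z E.* g r                     ≡⟨ sym (g-* z r) ⟩
          g (z E.* r) E.* g E.1#          ≡⟨ cong (λ y → g y E.* g E.1#) (sym z′≡zr) ⟩
          g z′ E.* g E.1#                 ≡⟨ cong (E._* g E.1#) e′ ⟩
          (k E.* z′) E.* g E.1#           ≡⟨ cong (λ y → (k E.* y) E.* g E.1#) z′≡zr ⟩
          (k E.* (z E.* r)) E.* g E.1#
            ≡⟨ Eₚ.solve 4 (λ k z r u → k :* (z :* r) :* u := k :* z :* (r :* u)) refl k z r (g E.1#) ⟩
          (k E.* z) E.* (r E.* g E.1#)    ≡⟨ cong (E._* (r E.* g E.1#)) (sym e) ⟩
          g z E.* (r E.* g E.1#)          ∎))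
    in f , trans z′≡zr (cong (z E.*_) r≡f)

  -- Take z₀ to be a nonzero coordinate of `p`; by `eigen-ratio` the other coordinates are
  -- F-multiples of it.
  eigenvector : ∀ {k} p → NonzeroW p → (∀ i → g (p i) ≡ k E.* p i) →
    ∃[ z₀ ] ∃ λ (z : Fin 3 → F.Carrier) →
      ¬ z₀ ≡ E.0# × g z₀ ≡ k E.* z₀ × p ≐W (z₀ ·W embVec z)
  eigenvector p p≢0 e =
    let (i , pᵢ≢0) = Eₚ.≢0-coordinate (E-≟ _≟_) p p≢0
        ratio = λ j → eigen-ratio pᵢ≢0 (e i) (e j)
    in p i , (λ j → proj₁ (ratio j)) , pᵢ≢0 , e i , λ j → proj₂ (ratio j)

  rational⇒TypeI : ∀ {x z₀ z} → NonzeroV x → ψ x ≐W (z₀ ·W embVec z) → TypeI (ι x)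
  rational⇒TypeI {x} {z₀} {z} x≢0 e = z , z≢0 , z₀ , λ i → begin
    ι x i                         ≡⟨ sym (frame-ψ x i) ⟩
    frame (ψ x) i                 ≡⟨ frame-cong {ψ x} {z₀ ·W embVec z} e i ⟩
    frame (z₀ ·W embVec z) i      ≡⟨ frame-· z₀ (embVec z) i ⟩
    z₀ E.* frame (embVec z) i     ∎
    where
    z≢0 : ¬ (∀ i → z i ≡ F.0#)
    z≢0 z≡0 = ψ-≢0 x≢0 λ i → trans (e i) (trans (cong (λ y → z₀ E.* emb y) (z≡0 i))
      (trans (cong (z₀ E.*_) emb-0) (Eₚ.zeroʳ z₀)))

  -- The factor `k` is allowed in E, so the criterion covers not only fixed points but all points
  -- whose S-plane is fixed, as in case (b).
  eigen⇒TypeI : ∀ {k x} → NonzeroV x → ι (σ x) ≐W (k ·W ι x) → TypeI (ι x)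
  eigen⇒TypeI {k} {x} x≢0 e =
    let (z₀ , z , _ , _ , m) = eigenvector {k} (ψ x) (ψ-≢0 x≢0)
          (λ i → trans (sym (ψσ≡g x i)) (ψ-multiple {k} {x} {σ x} e i))
    in rational⇒TypeI {x} {z₀} {z} x≢0 m

  -- The points of the line

  co₁ co₂ : Maybe F.Carrier → F.Carrier
  co₁ nothing  = F.0#
  co₁ (just _) = F.1#
  co₂ nothing  = F.1#
  co₂ (just t) = t

  pt-comb : ∀ t → pt u v t ≐ ((co₁ t ·V u) +V (co₂ t ·V v))
  pt-comb nothing i j  = Fₚ.solve 2 (λ x y → y := :0 :* x :+ :1 :* y) refl (u i j) (v i j)
  pt-comb (just t) i j = Fₚ.solve 3 (λ t x y → x :+ t :* y := :1 :* x :+ t :* y) refl t (u i j) (v i j)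

  co-≢0 : ∀ t → ¬ (co₁ t ≡ F.0# × co₂ t ≡ F.0#)
  co-≢0 nothing (_ , e)  = Fₚ.1≢0 e
  co-≢0 (just _) (e , _) = Fₚ.1≢0 e

  pt-≢0 : ∀ t → NonzeroV (pt u v t)
  pt-≢0 t e = co-≢0 t (uv-indep (co₁ t) (co₂ t) λ i j → trans (sym (pt-comb t i j)) (e i j))

  -- The factor `e` ranges over E because it also arises from equality of S-planes. Between two
  -- finite parameters it must be 1; a finite one against infinity would give 1 = 0.
  co-injective : ∀ {e} t t′ → emb (co₁ t′) ≡ e E.* emb (co₁ t) → emb (co₂ t′) ≡ e E.* emb (co₂ t) → t ≡ t′
  co-injective nothing nothing _ _ = refl
  co-injective {e} nothing (just _) m _ =
    ⊥-elim (emb-≢0 Fₚ.1≢0 (trans m (trans (cong (e E.*_) emb-0) (Eₚ.zeroʳ e))))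
  co-injective {e} (just t) nothing m m′ =
    ⊥-elim (emb-≢0 Fₚ.1≢0 (begin
      emb F.1#                      ≡⟨ m′ ⟩
      e E.* emb t                   ≡⟨ cong (E._* emb t) (sym (Eₚ.*-identityʳ e)) ⟩
      (e E.* E.1#) E.* emb t        ≡⟨ cong (λ y → (e E.* y) E.* emb t) (sym emb-1) ⟩
      (e E.* emb F.1#) E.* emb t    ≡⟨ cong (E._* emb t) (sym m) ⟩
      emb F.0# E.* emb t            ≡⟨ cong (E._* emb t) emb-0 ⟩
      E.0# E.* emb t                ≡⟨ Eₚ.zeroˡ _ ⟩
      E.0#                          ∎))
  co-injective {e} (just t) (just t′) m m′ = cong just (emb-injective _≟_ (begin
    emb t                       ≡⟨ sym (Eₚ.*-identityˡ (emb t)) ⟩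
    E.1# E.* emb t              ≡⟨ cong (E._* emb t) 1≡e ⟩
    e E.* emb t                 ≡⟨ sym m′ ⟩
    emb t′                      ∎))
    where
    1≡e : E.1# ≡ e
    1≡e = trans (sym emb-1) (trans m (trans (cong (e E.*_) emb-1) (Eₚ.*-identityʳ e)))

  uv-coefficients : ∀ {a b c d} → ((a ·V u) +V (b ·V v)) ≐ ((c ·V u) +V (d ·V v)) → a ≡ c × b ≡ d
  uv-coefficients {a} {b} {c} {d} e =
    let (p , q) = uv-indep (a Fₚ.- c) (b Fₚ.- d) λ i j → begin
          (a Fₚ.- c) F.* u i j F.+ (b Fₚ.- d) F.* v i j
            ≡⟨ Fₚ.solve 6 (λ a b c d x y → (a :- c) :* x :+ (b :- d) :* y := (a :* x :+ b :* y) :- (c :* x :+ d :* y))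
                 refl a b c d (u i j) (v i j) ⟩
          (a F.* u i j F.+ b F.* v i j) Fₚ.- (c F.* u i j F.+ d F.* v i j)
            ≡⟨ cong (Fₚ._- (c F.* u i j F.+ d F.* v i j)) (e i j) ⟩
          (c F.* u i j F.+ d F.* v i j) Fₚ.- (c F.* u i j F.+ d F.* v i j)
            ≡⟨ Fₚ.-‿inverseʳ _ ⟩
          F.0# ∎
    in Fₚ.x∙y⁻¹≈ε⇒x≈y a c p , Fₚ.x∙y⁻¹≈ε⇒x≈y b d q

  pt-injective : ∀ t t′ → SamePtV (pt u v t) (pt u v t′) → t ≡ t′
  pt-injective t t′ (c , e) =
    let (p , q) = uv-coefficients {co₁ t′} {co₂ t′} {c F.* co₁ t} {c F.* co₂ t} λ i j → begin
          co₁ t′ F.* u i j F.+ co₂ t′ F.* v i j            ≡⟨ sym (pt-comb t′ i j) ⟩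
          pt u v t′ i j                                    ≡⟨ e i j ⟩
          c F.* pt u v t i j                               ≡⟨ cong (c F.*_) (pt-comb t i j) ⟩
          c F.* (co₁ t F.* u i j F.+ co₂ t F.* v i j)
            ≡⟨ Fₚ.solve 5 (λ c a b x y → c :* (a :* x :+ b :* y) := (c :* a) :* x :+ (c :* b) :* y) refl c (co₁ t) (co₂ t) (u i j) (v i j) ⟩
          (c F.* co₁ t) F.* u i j F.+ (c F.* co₂ t) F.* v i j ∎
    in co-injective {emb c} t t′ (trans (cong emb p) (emb-* c (co₁ t))) (trans (cong emb q) (emb-* c (co₂ t)))

  ≢⇒minor : ∀ {t t′} → ¬ t ≡ t′ → ¬ co₁ t F.* co₂ t′ ≡ co₂ t F.* co₁ t′
  ≢⇒minor {nothing} {nothing} t≢t′ _ = t≢t′ refl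
  ≢⇒minor {nothing} {just t′} _ e = Fₚ.1≢0 (trans (sym (Fₚ.*-identityˡ F.1#)) (trans (sym e) (Fₚ.zeroˡ t′)))
  ≢⇒minor {just t} {nothing} _ e = Fₚ.1≢0 (trans (sym (Fₚ.*-identityˡ F.1#)) (trans e (Fₚ.zeroʳ t)))
  ≢⇒minor {just t} {just t′} t≢t′ e =
    t≢t′ (cong just (trans (sym (Fₚ.*-identityʳ t)) (trans (sym e) (Fₚ.*-identityˡ t′))))

  module _ {t₁ t₂ : Maybe F.Carrier} (t₁≢t₂ : ¬ t₁ ≡ t₂) where

    private
      regroup : ∀ a b → ((a ·V pt u v t₁) +V (b ·V pt u v t₂)) ≐
                (((a F.* co₁ t₁ F.+ b F.* co₁ t₂) ·V u) +V ((a F.* co₂ t₁ F.+ b F.* co₂ t₂) ·V v))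
      regroup a b i j = begin
        a F.* pt u v t₁ i j F.+ b F.* pt u v t₂ i j
          ≡⟨ cong₂ (λ x y → a F.* x F.+ b F.* y) (pt-comb t₁ i j) (pt-comb t₂ i j) ⟩
        a F.* (co₁ t₁ F.* u i j F.+ co₂ t₁ F.* v i j) F.+ b F.* (co₁ t₂ F.* u i j F.+ co₂ t₂ F.* v i j)
          ≡⟨ Fₚ.solve 8 (λ a b p q r s x y → a :* (p :* x :+ q :* y) :+ b :* (r :* x :+ s :* y)
               := (a :* p :+ b :* r) :* x :+ (a :* q :+ b :* s) :* y)
               refl a b (co₁ t₁) (co₂ t₁) (co₁ t₂) (co₂ t₂) (u i j) (v i j) ⟩
        (a F.* co₁ t₁ F.+ b F.* co₁ t₂) F.* u i j F.+ (a F.* co₂ t₁ F.+ b F.* co₂ t₂) F.* v i j ∎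

    pt-spans : ∀ t → ∃[ a ] ∃[ b ] pt u v t ≐ ((a ·V pt u v t₁) +V (b ·V pt u v t₂))
    pt-spans t =
      let (a , b , p , q) = Fₚ.minor-spans (≢⇒minor t₁≢t₂) (co₁ t) (co₂ t)
      in a , b , λ i j → trans (pt-comb t i j)
           (trans (cong₂ (λ x y → x F.* u i j F.+ y F.* v i j) p q) (sym (regroup a b i j)))

    pt-independent : Indep2V (pt u v t₁) (pt u v t₂)
    pt-independent a b e =
      let (p , q) = uv-indep _ _ (λ i j → trans (sym (regroup a b i j)) (e i j))
      in Fₚ.minor-independent (≢⇒minor t₁≢t₂) a b p q

  -- The permutation of the points of ℓ induced by σ

  abstract
    s : Maybe F.Carrier → Maybe F.Carrier
    s t = proj₁ (lineFixed t)

    κ : Maybe F.Carrier → F.Carrier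
    κ t = proj₁ (proj₂ (lineFixed t))

    σ-pt : ∀ t → σ (pt u v t) ≐ (κ t ·V pt u v (s t))
    σ-pt t = proj₂ (proj₂ (lineFixed t))

  κ≢0 : ∀ t → ¬ κ t ≡ F.0#
  κ≢0 t κ≡0 = σ-≢0 (pt-≢0 t) λ i j →
    trans (σ-pt t i j) (trans (cong (F._* pt u v (s t) i j) κ≡0) (Fₚ.zeroˡ _))

  σσ-pt : ∀ t → σ (σ (pt u v t)) ≐ ((κ t F.* κ (s t)) ·V pt u v (s (s t)))
  σσ-pt t i j = begin
    σ (σ (pt u v t)) i j
      ≡⟨ σ-cong {σ (pt u v t)} {κ t ·V pt u v (s t)} (σ-pt t) i j ⟩
    σ (κ t ·V pt u v (s t)) i j                   ≡⟨ homogeneous (κ t) (pt u v (s t)) i j ⟩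
    κ t F.* σ (pt u v (s t)) i j                  ≡⟨ cong (κ t F.*_) (σ-pt (s t) i j) ⟩
    κ t F.* (κ (s t) F.* pt u v (s (s t)) i j)    ≡⟨ sym (Fₚ.*-assoc _ _ _) ⟩
    (κ t F.* κ (s t)) F.* pt u v (s (s t)) i j    ∎

  multiples⇒≡ : ∀ {c d t t′} → ¬ d ≡ F.0# → (c ·V pt u v t) ≐ (d ·V pt u v t′) → t ≡ t′
  multiples⇒≡ {c} {d} {t} {t′} d≢0 e =
    let (d⁻¹ , dd⁻¹≡1) = F.inverse d d≢0
    in pt-injective t t′ (d⁻¹ F.* c , λ i j → begin
      pt u v t′ i j                        ≡⟨ sym (Fₚ.*-identityˡ _) ⟩
      F.1# F.* pt u v t′ i j               ≡⟨ cong (F._* pt u v t′ i j) (sym dd⁻¹≡1) ⟩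
      (d F.* d⁻¹) F.* pt u v t′ i j
        ≡⟨ Fₚ.solve 3 (λ d e x → d :* e :* x := e :* (d :* x)) refl d d⁻¹ (pt u v t′ i j) ⟩
      d⁻¹ F.* (d F.* pt u v t′ i j)        ≡⟨ cong (d⁻¹ F.*_) (sym (e i j)) ⟩
      d⁻¹ F.* (c F.* pt u v t i j)         ≡⟨ sym (Fₚ.*-assoc _ _ _) ⟩
      (d⁻¹ F.* c) F.* pt u v t i j         ∎)

  s³≡id : ∀ t → s (s (s t)) ≡ t
  s³≡id t = let ((c , e) , _) = order3V in
    sym (multiples⇒≡ {c} {(κ t F.* κ (s t)) F.* κ (s (s t))} {t} {s (s (s t))} (Fₚ.*-≢0 (Fₚ.*-≢0 (κ≢0 t) (κ≢0 (s t))) (κ≢0 (s (s t))))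
      λ i j → begin
        c F.* pt u v t i j               ≡⟨ sym (e (pt u v t) i j) ⟩
        σ (σ (σ (pt u v t))) i j
          ≡⟨ σ-cong {σ (σ (pt u v t))} {(κ t F.* κ (s t)) ·V pt u v (s (s t))} (σσ-pt t) i j ⟩
        σ ((κ t F.* κ (s t)) ·V pt u v (s (s t))) i j
          ≡⟨ homogeneous (κ t F.* κ (s t)) (pt u v (s (s t))) i j ⟩
        (κ t F.* κ (s t)) F.* σ (pt u v (s (s t))) i j
          ≡⟨ cong ((κ t F.* κ (s t)) F.*_) (σ-pt (s (s t)) i j) ⟩
        (κ t F.* κ (s t)) F.* (κ (s (s t)) F.* pt u v (s (s (s t))) i j)
          ≡⟨ sym (Fₚ.*-assoc _ _ _) ⟩
        ((κ t F.* κ (s t)) F.* κ (s (s t))) F.* pt u v (s (s (s t))) i j ∎)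

  fixed⇒s≡ : ∀ t → Fixed (pt u v t) → s t ≡ t
  fixed⇒s≡ t (c , e) = sym (multiples⇒≡ {c} {κ t} {t} {s t} (κ≢0 t) λ i j → trans (sym (e i j)) (σ-pt t i j))

  s≡⇒σ-pt : ∀ t → s t ≡ t → σ (pt u v t) ≐ (κ t ·V pt u v t)
  s≡⇒σ-pt t e i j = trans (σ-pt t i j) (cong (λ t′ → κ t F.* pt u v t′ i j) e)

  s≡⇒fixed : ∀ t → s t ≡ t → Fixed (pt u v t)
  s≡⇒fixed t e = κ t , s≡⇒σ-pt t e

  -- Write x₃ = a x₁ + b x₂; both coefficients are nonzero since the points are distinct. Applying
  -- `σ` and comparing coefficients makes the eigenvalues at x₁ and x₂ equal to that at x₃.
  three-fixed⇒scalar : ∀ {t₁ t₂ t₃} → ¬ t₁ ≡ t₂ → ¬ t₁ ≡ t₃ → ¬ t₂ ≡ t₃ →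
    s t₁ ≡ t₁ → s t₂ ≡ t₂ → s t₃ ≡ t₃ → ∃[ k ] ∀ t → σ (pt u v t) ≐ (k ·V pt u v t)
  three-fixed⇒scalar {t₁} {t₂} {t₃} t₁≢t₂ t₁≢t₃ t₂≢t₃ f₁ f₂ f₃ = k , λ t i j →
    let (a , b , e) = pt-spans t₁≢t₂ t in begin
      σ (pt u v t) i j                                  ≡⟨ σ-span a b e i j ⟩
      a F.* (κ t₁ F.* x₁ i j) F.+ b F.* (κ t₂ F.* x₂ i j)
        ≡⟨ cong₂ (λ p q → a F.* (p F.* x₁ i j) F.+ b F.* (q F.* x₂ i j)) κ₁≡k κ₂≡k ⟩
      a F.* (k F.* x₁ i j) F.+ b F.* (k F.* x₂ i j)
        ≡⟨ Fₚ.solve 5 (λ a b k x y → a :* (k :* x) :+ b :* (k :* y) := k :* (a :* x :+ b :* y)) refl a b k (x₁ i j) (x₂ i j) ⟩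
      k F.* (a F.* x₁ i j F.+ b F.* x₂ i j)             ≡⟨ cong (k F.*_) (sym (e i j)) ⟩
      k F.* pt u v t i j                                ∎
    where
    x₁ = pt u v t₁
    x₂ = pt u v t₂
    x₃ = pt u v t₃
    k = κ t₃
    σ-span : ∀ {x} a b → x ≐ ((a ·V x₁) +V (b ·V x₂)) →
             σ x ≐ ((a ·V (κ t₁ ·V x₁)) +V (b ·V (κ t₂ ·V x₂)))
    σ-span {x} a b e i j = trans (σ-cong {x} {(a ·V x₁) +V (b ·V x₂)} e i j) (trans (σ-comb a x₁ b x₂ i j)
      (cong₂ (λ p q → a F.* p F.+ b F.* q) (s≡⇒σ-pt t₁ f₁ i j) (s≡⇒σ-pt t₂ f₂ i j)))
    span₃ = pt-spans t₁≢t₂ t₃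
    a₃ = proj₁ span₃
    b₃ = proj₁ (proj₂ span₃)
    e₃ : x₃ ≐ ((a₃ ·V x₁) +V (b₃ ·V x₂))
    e₃ = proj₂ (proj₂ span₃)
    a₃≢0 : ¬ a₃ ≡ F.0#
    a₃≢0 a≡0 = t₂≢t₃ (pt-injective t₂ t₃ (b₃ , λ i j → trans (e₃ i j) (trans
      (cong (λ a → a F.* x₁ i j F.+ b₃ F.* x₂ i j) a≡0)
      (Fₚ.solve 3 (λ x b y → :0 :* x :+ b :* y := b :* y) refl (x₁ i j) b₃ (x₂ i j)))))
    b₃≢0 : ¬ b₃ ≡ F.0#
    b₃≢0 b≡0 = t₁≢t₃ (pt-injective t₁ t₃ (a₃ , λ i j → trans (e₃ i j) (trans
      (cong (λ b → a₃ F.* x₁ i j F.+ b F.* x₂ i j) b≡0)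
      (Fₚ.solve 3 (λ x a y → a :* x :+ :0 :* y := a :* x) refl (x₁ i j) a₃ (x₂ i j)))))
    relation : (((a₃ F.* (κ t₁ Fₚ.- k)) ·V x₁) +V ((b₃ F.* (κ t₂ Fₚ.- k)) ·V x₂)) ≐ 0V
    relation i j = begin
      a₃ F.* (κ t₁ Fₚ.- k) F.* x₁ i j F.+ b₃ F.* (κ t₂ Fₚ.- k) F.* x₂ i j
        ≡⟨ Fₚ.solve 7 (λ a b k₁ k₂ k x y → a :* (k₁ :- k) :* x :+ b :* (k₂ :- k) :* y
             := (a :* (k₁ :* x) :+ b :* (k₂ :* y)) :- k :* (a :* x :+ b :* y))
             refl a₃ b₃ (κ t₁) (κ t₂) k (x₁ i j) (x₂ i j) ⟩
      (a₃ F.* (κ t₁ F.* x₁ i j) F.+ b₃ F.* (κ t₂ F.* x₂ i j)) Fₚ.- k F.* (a₃ F.* x₁ i j F.+ b₃ F.* x₂ i j)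
        ≡⟨ cong₂ Fₚ._-_ (sym (σ-span {x₃} a₃ b₃ e₃ i j)) (cong (k F.*_) (sym (e₃ i j))) ⟩
      σ x₃ i j Fₚ.- k F.* x₃ i j
        ≡⟨ cong (Fₚ._- (k F.* x₃ i j)) (s≡⇒σ-pt t₃ f₃ i j) ⟩
      k F.* x₃ i j Fₚ.- k F.* x₃ i j
        ≡⟨ Fₚ.-‿inverseʳ _ ⟩
      F.0# ∎
    κ₁≡k : κ t₁ ≡ k
    κ₁≡k = Fₚ.x∙y⁻¹≈ε⇒x≈y _ _ (Fₚ.x*y≡0⇒y≡0 a₃≢0 (proj₁ (pt-independent t₁≢t₂ _ _ relation)))
    κ₂≡k : κ t₂ ≡ k
    κ₂≡k = Fₚ.x∙y⁻¹≈ε⇒x≈y _ _ (Fₚ.x*y≡0⇒y≡0 b₃≢0 (proj₂ (pt-independent t₁≢t₂ _ _ relation)))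

  module _ (t : Maybe F.Carrier) (moved : ¬ s t ≡ t) where

    t≢st : ¬ t ≡ s t
    t≢st e = moved (sym e)

    t≢sst : ¬ t ≡ s (s t)
    t≢sst e = moved (trans (cong s e) (s³≡id t))

    st≢sst : ¬ s t ≡ s (s t)
    st≢sst e = moved (trans (trans e (cong s e)) (s³≡id t))

    orbit-collinear : CollV (pt u v t) (σ (pt u v t)) (σ (σ (pt u v t)))
    orbit-collinear =
      let (a , b , e) = pt-spans t≢st (s (s t))
          k = κ t ; l = κ t F.* κ (s t)
      -- With x, y the points at t and s t, σ x = k y and σ (σ x) = l (a x + b y). Multiplying the
      -- last equation by k turns k y into σ x without an inverse.
      in (a F.* l) F.* k , b F.* l , F.- k ,
         (λ (_ , _ , -k≡0) → κ≢0 t (trans (sym (Fₚ.-‿involutive k)) (trans (cong F.-_ -k≡0) Fₚ.-0#≈0#))) ,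
         λ i j → begin
           ((a F.* l) F.* k) F.* pt u v t i j F.+ (b F.* l) F.* σ (pt u v t) i j F.+ (F.- k) F.* σ (σ (pt u v t)) i j
             ≡⟨ cong₂ (λ x y → ((a F.* l) F.* k) F.* pt u v t i j F.+ (b F.* l) F.* x F.+ (F.- k) F.* y) (σ-pt t i j) (trans (σσ-pt t i j) (cong (l F.*_) (e i j))) ⟩
           ((a F.* l) F.* k) F.* pt u v t i j F.+ (b F.* l) F.* (k F.* pt u v (s t) i j)
             F.+ (F.- k) F.* (l F.* (a F.* pt u v t i j F.+ b F.* pt u v (s t) i j))
             ≡⟨ Fₚ.solve 6 (λ a b k l x y → a :* l :* k :* x :+ b :* l :* (k :* y) :+ (:- k) :* (l :* (a :* x :+ b :* y)) := :0)
                  refl a b k l (pt u v t i j) (pt u v (s t) i j) ⟩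
           F.0# ∎

    orbit-distinct : Distinct3V (pt u v t) (σ (pt u v t)) (σ (σ (pt u v t)))
    orbit-distinct =
      (λ (c , e) → t≢st (multiples⇒≡ {c} {κ t} {t} {s t} (κ≢0 t) λ i j → trans (sym (e i j)) (σ-pt t i j))) ,
      (λ (c , e) → t≢sst (multiples⇒≡ {c} {κ t F.* κ (s t)} {t} {s (s t)} (Fₚ.*-≢0 (κ≢0 t) (κ≢0 (s t))) λ i j → trans (sym (e i j)) (σσ-pt t i j))) ,
      (λ (c , e) → st≢sst (multiples⇒≡ {c F.* κ t} {κ t F.* κ (s t)} {s t} {s (s t)} (Fₚ.*-≢0 (κ≢0 t) (κ≢0 (s t)))
        λ i j → trans (Fₚ.*-assoc c (κ t) _) (trans (cong (c F.*_) (sym (σ-pt t i j))) (trans (sym (e i j)) (σσ-pt t i j)))))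

  u≢0 : NonzeroV u
  u≢0 e = Fₚ.1≢0 (proj₁ (uv-indep F.1# F.0# λ i j →
    trans (cong (λ x → F.1# F.* x F.+ F.0# F.* v i j) (e i j))
      (Fₚ.solve 1 (λ y → :1 :* :0 :+ :0 :* y := :0) refl (v i j))))

  u≐pt0 : u ≐ pt u v (just F.0#)
  u≐pt0 i j = Fₚ.solve 2 (λ x y → x := x :+ :0 :* y) refl (u i j) (v i j)

  ι-pt : ∀ t → ι (pt u v t) ≐W ((emb (co₁ t) ·W ι u) +W (emb (co₂ t) ·W ι v))
  ι-pt t i = trans (ι-cong {pt u v t} {(co₁ t ·V u) +V (co₂ t ·V v)} (pt-comb t) i) (ι-comb (co₁ t) u (co₂ t) v i)

  ψ-pt : ∀ t → ψ (pt u v t) ≐W ((emb (co₁ t) ·W ψ u) +W (emb (co₂ t) ·W ψ v))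
  ψ-pt t i = trans (ψ-cong {pt u v t} {(co₁ t ·V u) +V (co₂ t ·V v)} (pt-comb t) i) (ψ-comb (co₁ t) u (co₂ t) v i)

  ι-pt-≢0 : ∀ t → NonzeroW (ι (pt u v t))
  ι-pt-≢0 t = ι-≢0 (pt-≢0 t)

  InS-refl : ∀ x → InS (ι x) x
  InS-refl x = E.1# , λ i → sym (Eₚ.*-identityˡ _)

  ι-σ-pt : ∀ t → ι (σ (pt u v t)) ≐W (emb (κ t) ·W ι (pt u v (s t)))
  ι-σ-pt t i = trans (ι-cong {σ (pt u v t)} {κ t ·V pt u v (s t)} (σ-pt t) i) (ι-· (κ t) (pt u v (s t)) i)

  s≡⇒TypeI : ∀ t → s t ≡ t → TypeI (ι (pt u v t))
  s≡⇒TypeI t st≡t = eigen⇒TypeI {emb (κ t)} {pt u v t} (pt-≢0 t) λ i →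
    trans (ι-σ-pt t i) (cong (λ t′ → emb (κ t) E.* ι (pt u v t′) i) st≡t)

  -- Lists of the fixed and of the moved points of ℓ

  _≟ₚ_ : DecidableEquality (Maybe F.Carrier)
  _≟ₚ_ = Maybeₚ.≡-dec _≟_

  points : List (Maybe F.Carrier)
  points = nothing ∷ List.map just (proj₁ size)

  length-points : length points ≡ q ℕ.+ 1
  length-points = trans (cong ℕ.suc (trans (Listₚ.length-map just (proj₁ size)) (proj₁ (proj₂ size)))) (ℕₚ.+-comm 1 q)

  points-unique : Unique points
  points-unique = Allₚ.map⁺ (All.tabulate λ _ ()) ∷
    Uniqueₚ.map⁺ Maybeₚ.just-injective (proj₁ (proj₂ (proj₂ size)))

  ∈points : ∀ t → t ∈ points
  ∈points nothing  = here refl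
  ∈points (just t) = there (∈-map⁺ just (proj₂ (proj₂ (proj₂ size)) t))

  fixed? : ∀ t → Dec (s t ≡ t)
  fixed? t = s t ≟ₚ t

  moved? : ∀ t → Dec (¬ s t ≡ t)
  moved? t = ¬? (fixed? t)

  fixedPoints movedPoints : List (Maybe F.Carrier)
  fixedPoints = filter fixed? points
  movedPoints = filter moved? points

  exactly-fixed : {B : Set} {R : B → B → Set} {P : B → Set} (f : Maybe F.Carrier → B) →
    (∀ {t} → s t ≡ t → P (f t)) → (∀ {x y} → R (f x) (f y) → x ≡ y) →
    (∀ y → P y → ∃[ t ] (s t ≡ t × R y (f t))) → HasExactly B R P (length fixedPoints)
  exactly-fixed f p inj surj = exactly-map f (Uniqueₚ.filter⁺ fixed? points-unique)
    (λ t∈ → p (proj₂ (∈-filter⁻ fixed? {xs = points} t∈))) inj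
    λ y py → let (t , e , r) = surj y py in t , ∈-filter⁺ fixed? (∈points t) e , r

  exactly-moved : {B : Set} {R : B → B → Set} {P : B → Set} (f : Maybe F.Carrier → B) →
    (∀ {t} → ¬ s t ≡ t → P (f t)) → (∀ {x y} → R (f x) (f y) → x ≡ y) →
    (∀ y → P y → ∃[ t ] (¬ s t ≡ t × R y (f t))) → HasExactly B R P (length movedPoints)
  exactly-moved f p inj surj = exactly-map f (Uniqueₚ.filter⁺ moved? points-unique)
    (λ t∈ → p (proj₂ (∈-filter⁻ moved? {xs = points} t∈))) inj
    λ y py → let (t , e , r) = surj y py in t , ∈-filter⁺ moved? (∈points t) e , r

  fixed-exactly : HasExactly (Maybe F.Carrier) _≡_ (λ t → Fixed (pt u v t)) (length fixedPoints)
  fixed-exactly = exactly-fixed (λ t → t) (λ {t} → s≡⇒fixed t) (λ e → e)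
    (λ t f → t , fixed⇒s≡ t f , refl)

  g-emb* : ∀ x f → g (x E.* emb f) ≡ g x E.* emb f
  g-emb* x f = begin
    g (x E.* emb f)                            ≡⟨ cong g (pad x) ⟩
    g (emb f E.* x E.+ emb F.0# E.* x)         ≡⟨ g-comb f x F.0# x ⟩
    emb f E.* g x E.+ emb F.0# E.* g x         ≡⟨ sym (pad (g x)) ⟩
    g x E.* emb f                              ∎
    where
    pad : ∀ x → x E.* emb f ≡ emb f E.* x E.+ emb F.0# E.* x
    pad x = trans (Eₚ.solve 2 (λ x f → x :* f := f :* x :+ :0 :* x) refl x (emb f))
      (cong (λ z → emb f E.* x E.+ z E.* x) (sym emb-0))

  -- Case (a): lines fixed pointwise

  module PtwiseFixed (k : F.Carrier) (scalar : ∀ t → σ (pt u v t) ≐ (k ·V pt u v t)) where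

    ψ-scalar : ∀ t i → g (ψ (pt u v t) i) ≡ emb k E.* ψ (pt u v t) i
    ψ-scalar t i = trans (sym (ψσ≡g (pt u v t) i))
      (ψ-multiple {emb k} {pt u v t} {σ (pt u v t)} (λ j → trans (ι-cong {σ (pt u v t)} {k ·V pt u v t} (scalar t) j) (ι-· k (pt u v t) j)) i)

    -- In a nonzero coordinate the two points are solutions of g z = k z, so their ratio, a priori
    -- in E, lies in F and they are the same point of PG(8,q).
    E-injective : ∀ t t′ → SamePtW (ι (pt u v t)) (ι (pt u v t′)) → t ≡ t′
    E-injective t t′ (e , m) =
      let (i , ψ≢0) = Eₚ.≢0-coordinate (E-≟ _≟_) (ψ (pt u v t)) (ψ-≢0 (pt-≢0 t))
          (f , r) = eigen-ratio {emb k} ψ≢0 (ψ-scalar t i) (ψ-scalar t′ i)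
          e≡f : e ≡ emb f
          e≡f = Eₚ.*-cancelˡ ψ≢0 (begin
            ψ (pt u v t) i E.* e          ≡⟨ Eₚ.*-comm _ _ ⟩
            e E.* ψ (pt u v t) i          ≡⟨ sym (ψ-multiple {e} {pt u v t} {pt u v t′} m i) ⟩
            ψ (pt u v t′) i               ≡⟨ r ⟩
            ψ (pt u v t) i E.* emb f      ∎)
      in pt-injective t t′ (f , ι-injective {pt u v t′} {f ·V pt u v t} λ j → begin
           ι (pt u v t′) j                ≡⟨ m j ⟩
           e E.* ι (pt u v t) j           ≡⟨ cong (E._* ι (pt u v t) j) e≡f ⟩
           emb f E.* ι (pt u v t) j       ≡⟨ sym (ι-· f (pt u v t) j) ⟩
           ι (f ·V pt u v t) j            ∎)

    all-Fixed : ∀ t → Fixed (pt u v t)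
    all-Fixed t = k , scalar t

    meetsSI : MeetsSI u v (ℤ.+ q ℤ.+ ℤ.+ 1)
    meetsSI = length points , cong ℤ.+_ length-points , exactly-map (λ t → ι (pt u v t)) points-unique
      (λ {t} _ → ι-pt-≢0 t , s≡⇒TypeI t (fixed⇒s≡ t (all-Fixed t)) , t , InS-refl (pt u v t))
      (λ {t} {t′} → E-injective t t′)
      (λ P (_ , _ , t , P∋) → t , ∈points t , P∋)

    σu : σ u ≐ (k ·V u)
    σu i j = trans (σ-cong {u} {pt u v (just F.0#)} u≐pt0 i j) (trans (scalar (just F.0#) i j) (cong (k F.*_) (sym (u≐pt0 i j))))

    eigen-u : ∀ i → g (ψ u i) ≡ emb k E.* ψ u i
    eigen-u i = trans (sym (ψσ≡g u i)) (ψ-multiple {emb k} {u} {σ u} (λ j → trans (ι-cong {σ u} {k ·V u} σu j) (ι-· k u j)) i)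

    -- In frame coordinates u = z₀ x and v = z₀ y with x, y over F. As g (z₀ f) = k z₀ f for f in F,
    -- `σ` is the scalar k on all of z₀ F³, a plane of PG(8,q) containing ℓ; `w` is z₀ times a unit
    -- vector that completes x, y.
    inPtwiseFixedPlane : InPtwiseFixedPlane u v
    inPtwiseFixedPlane = plane (eigenvector {emb k} (ψ u) (ψ-≢0 u≢0) eigen-u)
      where
      plane : (∃[ z₀ ] ∃ λ (x : Fin 3 → F.Carrier) →
                ¬ z₀ ≡ E.0# × g z₀ ≡ emb k E.* z₀ × ψ u ≐W (z₀ ·W embVec x)) → InPtwiseFixedPlane u v
      plane (z₀ , x , z₀≢0 , gz₀ , ψu) = w , independent₃ , fixed
        where
        ratio : ∀ i → ∃[ f ] ψ v i ≡ z₀ E.* emb f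
        ratio i = eigen-ratio z₀≢0 gz₀ (ψ-scalar nothing i)
        y : Fin 3 → F.Carrier
        y i = proj₁ (ratio i)

        rational : ∀ a b i → emb a E.* ψ u i E.+ emb b E.* ψ v i ≡ z₀ E.* emb (a F.* x i F.+ b F.* y i)
        rational a b i = begin
          emb a E.* ψ u i E.+ emb b E.* ψ v i
            ≡⟨ cong₂ (λ p r → emb a E.* p E.+ emb b E.* r) (ψu i) (proj₂ (ratio i)) ⟩
          emb a E.* (z₀ E.* emb (x i)) E.+ emb b E.* (z₀ E.* emb (y i))
            ≡⟨ Eₚ.solve 5 (λ a b z x y → a :* (z :* x) :+ b :* (z :* y) := z :* (a :* x :+ b :* y)) refl (emb a) (emb b) z₀ (emb (x i)) (emb (y i)) ⟩
          z₀ E.* (emb a E.* emb (x i) E.+ emb b E.* emb (y i))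
            ≡⟨ cong (z₀ E.*_) (sym (trans (emb-+ _ _) (cong₂ E._+_ (emb-* a (x i)) (emb-* b (y i))))) ⟩
          z₀ E.* emb (a F.* x i F.+ b F.* y i) ∎

        xy-indep : ∀ a b → (∀ i → a F.* x i F.+ b F.* y i ≡ F.0#) → a ≡ F.0# × b ≡ F.0#
        xy-indep a b e = uv-indep a b (ψ≐0 {(a ·V u) +V (b ·V v)} λ i → begin
          ψ ((a ·V u) +V (b ·V v)) i                   ≡⟨ ψ-comb a u b v i ⟩
          emb a E.* ψ u i E.+ emb b E.* ψ v i          ≡⟨ rational a b i ⟩
          z₀ E.* emb (a F.* x i F.+ b F.* y i)         ≡⟨ cong (λ z → z₀ E.* emb z) (e i) ⟩
          z₀ E.* emb F.0#                              ≡⟨ cong (z₀ E.*_) emb-0 ⟩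
          z₀ E.* E.0#                                  ≡⟨ Eₚ.zeroʳ z₀ ⟩
          E.0#                                         ∎)

        completion = Fₚ.independent⇒completes _≟_ x y xy-indep
        d = Fₚ.δ (proj₁ completion)
        open Fₚ.Completes (proj₂ completion) using (independent)

        w : V
        w = ψ⁻¹ (z₀ ·W embVec d)

        ψw : ψ w ≐W (z₀ ·W embVec d)
        ψw = ψ-ψ⁻¹ (z₀ ·W embVec d)

        σw : σ w ≐ (k ·V w)
        σw = ψ-injective {σ w} {k ·V w} λ i → begin
          ψ (σ w) i                             ≡⟨ ψσ≡g w i ⟩
          g (ψ w i)                             ≡⟨ cong g (ψw i) ⟩
          g (z₀ E.* emb (d i))                  ≡⟨ g-emb* z₀ (d i) ⟩
          g z₀ E.* emb (d i)                    ≡⟨ cong (E._* emb (d i)) gz₀ ⟩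
          (emb k E.* z₀) E.* emb (d i)          ≡⟨ Eₚ.*-assoc _ _ _ ⟩
          emb k E.* (z₀ E.* emb (d i))          ≡⟨ cong (emb k E.*_) (sym (ψw i)) ⟩
          emb k E.* ψ w i
            ≡⟨ sym (ψ-multiple {emb k} {w} {k ·V w} (ι-· k w) i) ⟩
          ψ (k ·V w) i                          ∎

        unit : ∀ a b c → (((a ·V u) +V (b ·V v)) +V (c ·V w)) ≐ ((F.1# ·V ((a ·V u) +V (b ·V v))) +V (c ·V w))
        unit a b c i j = cong (F._+ (c F.* w i j)) (sym (Fₚ.*-identityˡ _))

        independent₃ : Indep3V u v w
        independent₃ a b c e = independent a b c λ i → emb-injective _≟_ (trans
          (Eₚ.x*y≡0⇒y≡0 z₀≢0 (begin
            z₀ E.* emb ((a F.* x i F.+ b F.* y i) F.+ c F.* d i)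
              ≡⟨ cong (z₀ E.*_) (trans (emb-+ _ _) (cong (emb (a F.* x i F.+ b F.* y i) E.+_) (emb-* c (d i)))) ⟩
            z₀ E.* (emb (a F.* x i F.+ b F.* y i) E.+ emb c E.* emb (d i))
              ≡⟨ Eₚ.solve 4 (λ z p c d → z :* (p :+ c :* d) := :1 :* (z :* p) :+ c :* (z :* d)) refl z₀ (emb (a F.* x i F.+ b F.* y i)) (emb c) (emb (d i)) ⟩
            E.1# E.* (z₀ E.* emb (a F.* x i F.+ b F.* y i)) E.+ emb c E.* (z₀ E.* emb (d i))
              ≡⟨ sym (cong₂ (λ p r → E.1# E.* p E.+ emb c E.* r) (trans (ψ-comb a u b v i) (rational a b i)) (ψw i)) ⟩
            E.1# E.* ψ ((a ·V u) +V (b ·V v)) i E.+ emb c E.* ψ w i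
              ≡⟨ cong (λ z → z E.* ψ ((a ·V u) +V (b ·V v)) i E.+ emb c E.* ψ w i) (sym emb-1) ⟩
            emb F.1# E.* ψ ((a ·V u) +V (b ·V v)) i E.+ emb c E.* ψ w i
              ≡⟨ sym (ψ-comb F.1# ((a ·V u) +V (b ·V v)) c w i) ⟩
            ψ ((F.1# ·V ((a ·V u) +V (b ·V v))) +V (c ·V w)) i
              ≡⟨ ψ-cong {(F.1# ·V ((a ·V u) +V (b ·V v))) +V (c ·V w)} {0V} (λ l m → trans (sym (unit a b c l m)) (e l m)) i ⟩
            ψ 0V i
              ≡⟨ ψ-zero i ⟩
            E.0# ∎))
          (sym emb-0))
          where
          ψ-zero : ψ 0V ≐W 0W
          ψ-zero = frame-injective {ψ 0V} {0W} λ i → trans (frame-ψ 0V i)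
            (trans (ι-zero {0V} (λ _ _ → refl) i) (sym (frame-zero {0W} (λ _ → refl) i)))

        fixed : ∀ a b c → Fixed (((a ·V u) +V (b ·V v)) +V (c ·V w))
        fixed a b c = k , λ i j → begin
          σ (((a ·V u) +V (b ·V v)) +V (c ·V w)) i j
            ≡⟨ σ-cong {((a ·V u) +V (b ·V v)) +V (c ·V w)} {(F.1# ·V ((a ·V u) +V (b ·V v))) +V (c ·V w)} (unit a b c) i j ⟩
          σ ((F.1# ·V ((a ·V u) +V (b ·V v))) +V (c ·V w)) i j
            ≡⟨ σ-comb F.1# ((a ·V u) +V (b ·V v)) c w i j ⟩
          F.1# F.* σ ((a ·V u) +V (b ·V v)) i j F.+ c F.* σ w i j
            ≡⟨ cong₂ (λ p r → F.1# F.* p F.+ c F.* r) (trans (σ-comb a u b v i j)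
                 (cong₂ (λ p r → a F.* p F.+ b F.* r) (σu i j) (scalar nothing i j))) (σw i j) ⟩
          F.1# F.* (a F.* (k F.* u i j) F.+ b F.* (k F.* v i j)) F.+ c F.* (k F.* w i j)
            ≡⟨ Fₚ.solve 7 (λ a b c k x y z → :1 :* (a :* (k :* x) :+ b :* (k :* y)) :+ c :* (k :* z)
                 := k :* (a :* x :+ b :* y :+ c :* z)) refl a b c k (u i j) (v i j) (w i j) ⟩
          k F.* ((a F.* u i j F.+ b F.* v i j) F.+ c F.* w i j) ∎

  -- Case (b): lines inside one S-plane

  module InOneSPlane (c : E.Carrier) (ψv≡cψu : ∀ i → ψ v i ≡ c E.* ψ u i) where

    inS : ∀ t → InS (ι u) (pt u v t)
    inS t = emb (co₁ t) E.+ emb (co₂ t) E.* c , λ i → begin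
      ι (pt u v t) i                                            ≡⟨ ι-pt t i ⟩
      emb (co₁ t) E.* ι u i E.+ emb (co₂ t) E.* ι v i
        ≡⟨ cong (λ z → emb (co₁ t) E.* ι u i E.+ emb (co₂ t) E.* z) (ι-multiple {c} {u} {v} ψv≡cψu i) ⟩
      emb (co₁ t) E.* ι u i E.+ emb (co₂ t) E.* (c E.* ι u i)
        ≡⟨ Eₚ.solve 4 (λ a b c x → a :* x :+ b :* (c :* x) := (a :+ b :* c) :* x) refl (emb (co₁ t)) (emb (co₂ t)) c (ι u i) ⟩
      (emb (co₁ t) E.+ emb (co₂ t) E.* c) E.* ι u i             ∎

    -- `σ u` is again on ℓ, hence in the S-plane of u, which makes u an eigenvector with factor in
    -- E.
    typeI : TypeI (ι u)
    typeI = let (e , m) = inS (s (just F.0#)) in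
      eigen⇒TypeI {emb (κ (just F.0#)) E.* e} {u} u≢0 λ i → begin
        ι (σ u) i
          ≡⟨ ι-cong {σ u} {σ (pt u v (just F.0#))} (σ-cong {u} {pt u v (just F.0#)} u≐pt0) i ⟩
        ι (σ (pt u v (just F.0#))) i       ≡⟨ ι-σ-pt (just F.0#) i ⟩
        emb (κ (just F.0#)) E.* ι (pt u v (s (just F.0#))) i
          ≡⟨ cong (emb (κ (just F.0#)) E.*_) (m i) ⟩
        emb (κ (just F.0#)) E.* (e E.* ι u i)                 ≡⟨ sym (Eₚ.*-assoc _ _ _) ⟩
        (emb (κ (just F.0#)) E.* e) E.* ι u i                 ∎

    inSIPlane : InSIPlane u v
    inSIPlane = ι u , ι-≢0 u≢0 , typeI , inS

    IPoints-exactly : HasExactly (Maybe F.Carrier) _≡_ (λ t → IColPoint (pt u v t)) (length movedPoints)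
    IPoints-exactly = exactly-moved (λ t → t)
      (λ {t} m → (pt-≢0 t , ι u , ι-≢0 u≢0 , typeI , inS t) , orbit-distinct t m , orbit-collinear t m)
      (λ e → e)
      (λ t (_ , (x≁σx , _) , _) → t , (λ e → x≁σx (s≡⇒fixed t e)) , refl)

  -- Case (c): lines meeting each S-plane in at most one point

  module EIndependent {i j : Fin 3} (minor : ¬ ψ u i E.* ψ v j ≡ ψ u j E.* ψ v i) where

    E-injective : ∀ t t′ → SamePtW (ι (pt u v t)) (ι (pt u v t′)) → t ≡ t′
    E-injective t t′ (e , m) =
      let (p , r) = Eₚ.minor-independent minor (emb (co₁ t′) Eₚ.- e E.* emb (co₁ t)) (emb (co₂ t′) Eₚ.- e E.* emb (co₂ t))
                      (difference i) (difference j)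
      in co-injective {e} t t′ (Eₚ.x∙y⁻¹≈ε⇒x≈y _ _ p) (Eₚ.x∙y⁻¹≈ε⇒x≈y _ _ r)
      where
      difference : ∀ l → (emb (co₁ t′) Eₚ.- e E.* emb (co₁ t)) E.* ψ u l E.+
                         (emb (co₂ t′) Eₚ.- e E.* emb (co₂ t)) E.* ψ v l ≡ E.0#
      difference l = begin
        (emb (co₁ t′) Eₚ.- e E.* emb (co₁ t)) E.* ψ u l E.+ (emb (co₂ t′) Eₚ.- e E.* emb (co₂ t)) E.* ψ v l
          ≡⟨ Eₚ.solve 7 (λ a b c d e x y → (a :- e :* c) :* x :+ (b :- e :* d) :* y := (a :* x :+ b :* y) :- e :* (c :* x :+ d :* y))
               refl (emb (co₁ t′)) (emb (co₂ t′)) (emb (co₁ t)) (emb (co₂ t)) e (ψ u l) (ψ v l) ⟩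
        (emb (co₁ t′) E.* ψ u l E.+ emb (co₂ t′) E.* ψ v l) Eₚ.- e E.* (emb (co₁ t) E.* ψ u l E.+ emb (co₂ t) E.* ψ v l)
          ≡⟨ sym (cong₂ (λ x y → x Eₚ.- e E.* y) (ψ-pt t′ l) (ψ-pt t l)) ⟩
        ψ (pt u v t′) l Eₚ.- e E.* ψ (pt u v t) l
          ≡⟨ cong (Eₚ._- (e E.* ψ (pt u v t) l)) (ψ-multiple {e} {pt u v t} {pt u v t′} m l) ⟩
        e E.* ψ (pt u v t) l Eₚ.- e E.* ψ (pt u v t) l
          ≡⟨ Eₚ.-‿inverseʳ _ ⟩
        E.0# ∎

    abstract
      φ-pt : ∀ t → ∃[ d ] (¬ d ≡ E.0# × φ (ι (pt u v t)) ≐W (d ·W ι (pt u v (s t))))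
      φ-pt t =
        let (d , d≢0 , e) = φι (pt u v t) (pt-≢0 t)
        in d E.* emb (κ t) , Eₚ.*-≢0 d≢0 (emb-≢0 (κ≢0 t)) ,
           λ i → trans (e i) (trans (cong (d E.*_) (ι-σ-pt t i)) (sym (Eₚ.*-assoc d (emb (κ t)) _)))

      -- The first image is only proportional to the point at s t, so the second application of `φ`
      -- passes through `wd`, whose factor is unknown; that the total factor is nonzero comes from
      -- `φ` preserving nonzero vectors.
      φφ-pt : ∀ t → ∃[ d ] (¬ d ≡ E.0# × φ (φ (ι (pt u v t))) ≐W (d ·W ι (pt u v (s (s t)))))
      φφ-pt t =
        let (d , _ , e) = φ-pt t
            (d′ , _ , e′) = φ-pt (s t)
            P = ι (pt u v t)
            nonzero = IsCollineation.nonzero isCollineation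
            (c , m) = IsCollineation.wd isCollineation (ι (pt u v (s t))) (φ P)
                        (ι-pt-≢0 (s t)) (nonzero P (ι-pt-≢0 t)) (d , e)
        in c E.* d′ ,
           (λ cd≡0 → nonzero (φ P) (nonzero P (ι-pt-≢0 t)) λ i → trans (m i) (trans (cong (c E.*_) (e′ i))
             (trans (sym (Eₚ.*-assoc c d′ _)) (trans (cong (E._* ι (pt u v (s (s t))) i) cd≡0) (Eₚ.zeroˡ _))))) ,
           λ i → trans (m i) (trans (cong (c E.*_) (e′ i)) (sym (Eₚ.*-assoc c d′ _)))

    module _ (t : Maybe F.Carrier) where
      private
        P = ι (pt u v t)
        φP≢0 : NonzeroW (φ P)
        φP≢0 = IsCollineation.nonzero isCollineation P (ι-pt-≢0 t)
        φφP≢0 : NonzeroW (φ (φ P))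
        φφP≢0 = IsCollineation.nonzero isCollineation (φ P) φP≢0

      st~φ : SamePtW (ι (pt u v (s t))) (φ P)
      st~φ = let (d , _ , e) = φ-pt t in d , e

      φ~st : SamePtW (φ P) (ι (pt u v (s t)))
      φ~st = SamePtW-sym {ι (pt u v (s t))} {φ P} φP≢0 st~φ

      φφ~sst : SamePtW (φ (φ P)) (ι (pt u v (s (s t))))
      φφ~sst = SamePtW-sym {ι (pt u v (s (s t)))} {φ (φ P)} φφP≢0 (let (d , _ , e) = φφ-pt t in d , e)

      moved⇒TypeII : ¬ s t ≡ t → TypeII P
      moved⇒TypeII moved =
        ((λ P~φP → t≢st t moved (E-injective t (s t) (SamePtW-trans {P} {φ P} {ι (pt u v (s t))} P~φP φ~st))) ,
         (λ P~φφP → t≢sst t moved (E-injective t (s (s t)) (SamePtW-trans {P} {φ (φ P)} {ι (pt u v (s (s t)))} P~φφP φφ~sst))) ,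
         (λ φP~φφP → st≢sst t moved (E-injective (s t) (s (s t))
           (SamePtW-trans {ι (pt u v (s t))} {φ P} {ι (pt u v (s (s t)))} st~φ
             (SamePtW-trans {φ P} {φ (φ P)} {ι (pt u v (s (s t)))} φP~φφP φφ~sst))))) ,
        collinear
        where
        collinear : CollW P (φ P) (φ (φ P))
        collinear =
          let (a , b , e) = pt-spans (t≢st t moved) (s (s t))
              (d , d≢0 , m) = φ-pt t
              (d′ , _ , m′) = φφ-pt t
              third : ∀ l → ι (pt u v (s (s t))) l ≡ emb a E.* P l E.+ emb b E.* ι (pt u v (s t)) l
              third l = trans (ι-cong {pt u v (s (s t))} {(a ·V pt u v t) +V (b ·V pt u v (s t))} e l) (ι-comb a (pt u v t) b (pt u v (s t)) l)
          -- The relation of `orbit-collinear`, with the factors d and d′ of `φ` in E in the roles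
          -- of k and l.
          in (emb a E.* d′) E.* d , emb b E.* d′ , E.- d ,
             (λ (_ , _ , -d≡0) → d≢0 (trans (sym (Eₚ.-‿involutive d)) (trans (cong E.-_ -d≡0) Eₚ.-0#≈0#))) ,
             λ l → begin
               ((emb a E.* d′) E.* d) E.* P l E.+ (emb b E.* d′) E.* φ P l E.+ (E.- d) E.* φ (φ P) l
                 ≡⟨ cong₂ (λ x y → ((emb a E.* d′) E.* d) E.* P l E.+ (emb b E.* d′) E.* x E.+ (E.- d) E.* y)
                      (m l) (trans (m′ l) (cong (d′ E.*_) (third l))) ⟩
               ((emb a E.* d′) E.* d) E.* P l E.+ (emb b E.* d′) E.* (d E.* ι (pt u v (s t)) l)
                 E.+ (E.- d) E.* (d′ E.* (emb a E.* P l E.+ emb b E.* ι (pt u v (s t)) l))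
                 ≡⟨ Eₚ.solve 6 (λ a b k l x y → a :* l :* k :* x :+ b :* l :* (k :* y) :+ (:- k) :* (l :* (a :* x :+ b :* y)) := :0)
                      refl (emb a) (emb b) d d′ (P l) (ι (pt u v (s t)) l) ⟩
               E.0# ∎

      module _ (Q : W) (Q≢0 : NonzeroW Q) (Q∋ : InS Q (pt u v t)) where

        -- Types are given for an arbitrary representative `Q` of the S-plane, while the permutation
        -- `s` is known on `P`; this links the two.
        φQ~φP : SamePtW (φ Q) (φ P)
        φQ~φP = IsCollineation.wd isCollineation Q P Q≢0 (ι-pt-≢0 t) Q∋

        TypeI⇒fixed : TypeI Q → s t ≡ t
        TypeI⇒fixed typeI = sym (E-injective t (s t)
          (SamePtW-trans {P} {Q} {ι (pt u v (s t))} (SamePtW-sym {Q} {P} (ι-pt-≢0 t) Q∋)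
            (SamePtW-trans {Q} {φ Q} {ι (pt u v (s t))} (fixesPtwise Q Q≢0 typeI)
              (SamePtW-trans {φ Q} {φ P} {ι (pt u v (s t))} φQ~φP φ~st))))

        TypeII⇒moved : TypeII Q → ¬ s t ≡ t
        TypeII⇒moved ((Q≁φQ , _) , _) st≡t = Q≁φQ
          (SamePtW-trans {Q} {P} {φ Q} Q∋
            (SamePtW-trans {P} {φ P} {φ Q} (subst (λ t′ → SamePtW (ι (pt u v t′)) (φ P)) st≡t st~φ)
              (SamePtW-sym {φ Q} {φ P} φP≢0 φQ~φP)))

    meetsSI : HasExactly W SamePtW
      (λ P → NonzeroW P × TypeI P × ∃[ t ] InS P (pt u v t)) (length fixedPoints)
    meetsSI = exactly-fixed (λ t → ι (pt u v t))
      (λ {t} e → ι-pt-≢0 t , s≡⇒TypeI t e , t , InS-refl (pt u v t))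
      (λ {t} {t′} → E-injective t t′)
      (λ P (P≢0 , typeI , t , P∋) → t , TypeI⇒fixed t P P≢0 P∋ typeI , P∋)

    meetsSII : HasExactly W SamePtW
      (λ P → NonzeroW P × TypeII P × ∃[ t ] InS P (pt u v t)) (length movedPoints)
    meetsSII = exactly-moved (λ t → ι (pt u v t))
      (λ {t} m → ι-pt-≢0 t , moved⇒TypeII t m , t , InS-refl (pt u v t))
      (λ {t} {t′} → E-injective t t′)
      (λ P (P≢0 , typeII , t , P∋) → t , TypeII⇒moved t P P≢0 P∋ typeII , P∋)

    -- Every moved orbit is collinear. Conversely type II already forces the point to move, since a
    -- fixed point has a fixed S-plane.
    IIPoints-exactly : HasExactly (Maybe F.Carrier) _≡_ (λ t → IIColPoint (pt u v t)) (length movedPoints)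
    IIPoints-exactly = exactly-moved (λ t → t)
      (λ {t} m → (pt-≢0 t , ι (pt u v t) , ι-pt-≢0 t , moved⇒TypeII t m , InS-refl (pt u v t)) , orbit-collinear t m)
      (λ e → e)
      (λ t ((_ , P , P≢0 , typeII , P∋) , _) → t , TypeII⇒moved t P P≢0 P∋ typeII , refl)

    point : E.Carrier → E.Carrier → W
    point a b l = a E.* ψ u l E.+ b E.* ψ v l

    frame-point : ∀ a b → frame (point a b) ≐W ((a ·W ι u) +W (b ·W ι v))
    frame-point a b l = trans (frame-comb a (ψ u) b (ψ v) l) (cong₂ (λ x y → a E.* x E.+ b E.* y) (frame-ψ u l) (frame-ψ v l))

    point-determined : ∀ {a b c d} → point a b i ≡ point c d i → point a b j ≡ point c d j → point a b ≐W point c d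
    point-determined {a} {b} {c} {d} eᵢ eⱼ l =
      let (p , r) = Eₚ.minor-independent minor (a Eₚ.- c) (b Eₚ.- d) (difference i eᵢ) (difference j eⱼ)
      in cong₂ (λ x y → x E.* ψ u l E.+ y E.* ψ v l) (Eₚ.x∙y⁻¹≈ε⇒x≈y a c p) (Eₚ.x∙y⁻¹≈ε⇒x≈y b d r)
      where
      difference : ∀ m → point a b m ≡ point c d m → (a Eₚ.- c) E.* ψ u m E.+ (b Eₚ.- d) E.* ψ v m ≡ E.0#
      difference m e = begin
        (a Eₚ.- c) E.* ψ u m E.+ (b Eₚ.- d) E.* ψ v m
          ≡⟨ Eₚ.solve 6 (λ a b c d x y → (a :- c) :* x :+ (b :- d) :* y := (a :* x :+ b :* y) :- (c :* x :+ d :* y)) refl a b c d (ψ u m) (ψ v m) ⟩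
        point a b m Eₚ.- point c d m      ≡⟨ cong (Eₚ._- point c d m) e ⟩
        point c d m Eₚ.- point c d m      ≡⟨ Eₚ.-‿inverseʳ _ ⟩
        E.0#                              ∎

    ι-independent : Indep2W (ι u) (ι v)
    ι-independent a b e = Eₚ.minor-independent minor a b (point≐0 i) (point≐0 j)
      where
      point≐0 : point a b ≐W 0W
      point≐0 = frame≐0 {point a b} λ l → trans (frame-point a b l) (e l)

    private
      g-span : ∀ {x : W} t → (∀ l → x l ≡ ψ (pt u v t) l) →
               ∃[ a ] ∃[ b ] ∀ l → g (x l) ≡ emb a E.* ψ u l E.+ emb b E.* ψ v l
      g-span {x} t e = κ t F.* co₁ (s t) , κ t F.* co₂ (s t) , λ l → begin
        g (x l)                                                       ≡⟨ cong g (e l) ⟩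
        g (ψ (pt u v t) l)                                            ≡⟨ sym (ψσ≡g (pt u v t) l) ⟩
        ψ (σ (pt u v t)) l
          ≡⟨ ψ-multiple {emb (κ t)} {pt u v (s t)} {σ (pt u v t)} (ι-σ-pt t) l ⟩
        emb (κ t) E.* ψ (pt u v (s t)) l
          ≡⟨ cong (emb (κ t) E.*_) (ψ-pt (s t) l) ⟩
        emb (κ t) E.* (emb (co₁ (s t)) E.* ψ u l E.+ emb (co₂ (s t)) E.* ψ v l)
          ≡⟨ Eₚ.solve 5 (λ k a b x y → k :* (a :* x :+ b :* y) := k :* a :* x :+ k :* b :* y) refl (emb (κ t)) (emb (co₁ (s t))) (emb (co₂ (s t))) (ψ u l) (ψ v l) ⟩
        emb (κ t) E.* emb (co₁ (s t)) E.* ψ u l E.+ emb (κ t) E.* emb (co₂ (s t)) E.* ψ v l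
          ≡⟨ sym (cong₂ (λ p r → p E.* ψ u l E.+ r E.* ψ v l) (emb-* (κ t) (co₁ (s t))) (emb-* (κ t) (co₂ (s t)))) ⟩
        emb (κ t F.* co₁ (s t)) E.* ψ u l E.+ emb (κ t F.* co₂ (s t)) E.* ψ v l ∎

    -- By `g-*`, g (a x) g 1 = g a g x, and the images of u and v are F-combinations of u and v
    -- because ℓ is fixed. The factor `g 1` is what `g-*` costs.
    g-point : ∀ a b → ∃[ c ] ∃[ d ] ∀ l → g (point a b l) E.* g E.1# ≡ point c d l
    g-point a b =
      let (p , r , eu) = g-span {ψ u} (just F.0#) (ψ-cong {u} {pt u v (just F.0#)} u≐pt0)
          (p′ , r′ , ev) = g-span {ψ v} nothing (λ _ → refl)
      in g a E.* emb p E.+ g b E.* emb p′ , g a E.* emb r E.+ g b E.* emb r′ , λ l → begin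
        g (point a b l) E.* g E.1#
          ≡⟨ cong (λ z → g z E.* g E.1#) (unit (a E.* ψ u l) (b E.* ψ v l)) ⟩
        g (emb F.1# E.* (a E.* ψ u l) E.+ emb F.1# E.* (b E.* ψ v l)) E.* g E.1#
          ≡⟨ cong (E._* g E.1#) (trans (g-comb F.1# (a E.* ψ u l) F.1# (b E.* ψ v l)) (sym (unit (g (a E.* ψ u l)) (g (b E.* ψ v l))))) ⟩
        (g (a E.* ψ u l) E.+ g (b E.* ψ v l)) E.* g E.1#
          ≡⟨ Eₚ.solve 3 (λ x y z → (x :+ y) :* z := x :* z :+ y :* z) refl (g (a E.* ψ u l)) (g (b E.* ψ v l)) (g E.1#) ⟩
        g (a E.* ψ u l) E.* g E.1# E.+ g (b E.* ψ v l) E.* g E.1#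
          ≡⟨ cong₂ E._+_ (trans (g-* a (ψ u l)) (cong (g a E.*_) (eu l))) (trans (g-* b (ψ v l)) (cong (g b E.*_) (ev l))) ⟩
        g a E.* (emb p E.* ψ u l E.+ emb r E.* ψ v l) E.+ g b E.* (emb p′ E.* ψ u l E.+ emb r′ E.* ψ v l)
          ≡⟨ Eₚ.solve 8 (λ a b p r p′ r′ x y → a :* (p :* x :+ r :* y) :+ b :* (p′ :* x :+ r′ :* y)
               := (a :* p :+ b :* p′) :* x :+ (a :* r :+ b :* r′) :* y)
               refl (g a) (g b) (emb p) (emb r) (emb p′) (emb r′) (ψ u l) (ψ v l) ⟩
        (g a E.* emb p E.+ g b E.* emb p′) E.* ψ u l E.+ (g a E.* emb r E.+ g b E.* emb r′) E.* ψ v l ∎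
      where
      unit : ∀ x y → x E.+ y ≡ emb F.1# E.* x E.+ emb F.1# E.* y
      unit x y = trans (sym (cong₂ E._+_ (Eₚ.*-identityˡ x) (Eₚ.*-identityˡ y))) (cong (λ z → z E.* x E.+ z E.* y) (sym emb-1))

    -- The line is invariant under g, and its points are determined by the coordinates i and j;
    -- so a point whose coordinates i and j lie in F is fixed by g, hence rational.
    point-rational : ∀ {a b e f} → point a b i ≡ emb e → point a b j ≡ emb f → ∀ l → ∃[ h ] point a b l ≡ emb h
    point-rational {a} {b} {e} {f} eᵢ eⱼ l = fix⇒∈F {point a b l} (Eₚ.*-cancelˡ g1≢0 (begin
      g E.1# E.* g (point a b l)                   ≡⟨ Eₚ.*-comm _ _ ⟩
      g (point a b l) E.* g E.1#                   ≡⟨ proj₂ (proj₂ image) l ⟩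
      -- The image and g1² times the point both lie on the E-line, and `fix-emb` makes them agree at
      -- i and j.
      point c d l                                  ≡⟨ point-determined (at i e eᵢ) (at j f eⱼ) l ⟩
      point (g1² E.* a) (g1² E.* b) l              ≡⟨ scale l ⟩
      g1² E.* point a b l
        ≡⟨ Eₚ.solve 2 (λ h p → h :* h :* p := h :* (p :* h)) refl (g E.1#) (point a b l) ⟩
      g E.1# E.* (point a b l E.* g E.1#)          ∎))
      where
      g1² = g E.1# E.* g E.1#
      image = g-point a b
      c = proj₁ image
      d = proj₁ (proj₂ image)
      scale : ∀ l → point (g1² E.* a) (g1² E.* b) l ≡ g1² E.* point a b l
      scale l = Eₚ.solve 5 (λ h a b x y → h :* a :* x :+ h :* b :* y := h :* (a :* x :+ b :* y)) refl g1² a b (ψ u l) (ψ v l)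
      at : ∀ l h → point a b l ≡ emb h → point c d l ≡ point (g1² E.* a) (g1² E.* b) l
      at l h m = begin
        point c d l                          ≡⟨ sym (proj₂ (proj₂ image) l) ⟩
        g (point a b l) E.* g E.1#           ≡⟨ cong (λ z → g z E.* g E.1#) m ⟩
        g (emb h) E.* g E.1#                 ≡⟨ cong (E._* g E.1#) (fix-emb h) ⟩
        (emb h E.* g E.1#) E.* g E.1#
          ≡⟨ Eₚ.solve 2 (λ h u → h :* u :* u := u :* u :* h) refl (emb h) (g E.1#) ⟩
        g1² E.* emb h                        ≡⟨ cong (g1² E.*_) (sym m) ⟩
        g1² E.* point a b l                  ≡⟨ sym (scale l) ⟩
        point (g1² E.* a) (g1² E.* b) l      ∎

    abstract
      -- The coordinates at i and j can be prescribed in F: the nonzero minor gives a point of the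
      -- E-line with these values, and `point-rational` makes its third coordinate rational too.
      -- Hence the rational points of the E-line are parametrised by PG(1,q).
      rationalPoint : ∀ e f → ∃ λ (z : Fin 3 → F.Carrier) → z i ≡ e × z j ≡ f ×
                      ∃[ a ] ∃[ b ] embVec z ≐W point a b
      rationalPoint e f =
        let (a , b , p , r) = Eₚ.minor-spans minor (emb e) (emb f)
            rational = point-rational {a} {b} {e} {f} (sym p) (sym r)
        in (λ l → proj₁ (rational l)) ,
           emb-injective _≟_ (trans (sym (proj₂ (rational i))) (sym p)) ,
           emb-injective _≟_ (trans (sym (proj₂ (rational j))) (sym r)) ,
           a , b , λ l → sym (proj₂ (rational l))

      rational : Maybe F.Carrier → Fin 3 → F.Carrier
      rational t = proj₁ (rationalPoint (co₁ t) (co₂ t))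

      rationalᵢ : ∀ t → rational t i ≡ co₁ t
      rationalᵢ t = proj₁ (proj₂ (rationalPoint (co₁ t) (co₂ t)))

      rationalⱼ : ∀ t → rational t j ≡ co₂ t
      rationalⱼ t = proj₁ (proj₂ (proj₂ (rationalPoint (co₁ t) (co₂ t))))

      rational-point : ∀ t → ∃[ a ] ∃[ b ] embVec (rational t) ≐W point a b
      rational-point t = proj₂ (proj₂ (proj₂ (rationalPoint (co₁ t) (co₂ t))))

    zero-point : point E.0# E.0# ≐W 0W
    zero-point l = Eₚ.solve 2 (λ x y → :0 :* x :+ :0 :* y := :0) refl (ψ u l) (ψ v l)

    scale-point : ∀ c a b → point (c E.* a) (c E.* b) ≐W (c ·W point a b)
    scale-point c a b l = Eₚ.solve 5 (λ h a b x y → h :* a :* x :+ h :* b :* y := h :* (a :* x :+ b :* y))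
      refl c a b (ψ u l) (ψ v l)

    rational-≢0 : ∀ t → ¬ (∀ l → rational t l ≡ F.0#)
    rational-≢0 t e = co-≢0 t (trans (sym (rationalᵢ t)) (e i) , trans (sym (rationalⱼ t)) (e j))

    rationalW : Maybe F.Carrier → W
    rationalW t = frame (embVec (rational t))

    rational-injective : ∀ t t′ → SamePtW (rationalW t) (rationalW t′) → t ≡ t′
    rational-injective t t′ (e , m) = co-injective {e} t t′
      (trans (cong emb (sym (rationalᵢ t′))) (trans (multiple i) (cong (λ x → e E.* emb x) (rationalᵢ t))))
      (trans (cong emb (sym (rationalⱼ t′))) (trans (multiple j) (cong (λ x → e E.* emb x) (rationalⱼ t))))
      where
      multiple : embVec (rational t′) ≐W (e ·W embVec (rational t))
      multiple = frame-injective {embVec (rational t′)} {e ·W embVec (rational t)} λ l →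
        trans (m l) (sym (frame-· e (embVec (rational t)) l))

    normalise : ∀ x y → ¬ (x ≡ F.0# × y ≡ F.0#) → ∃[ t ] ∃[ c ] (x ≡ c F.* co₁ t × y ≡ c F.* co₂ t)
    normalise x y xy≢0 = by-cases (x ≟ F.0#)
      where
      by-cases : Dec (x ≡ F.0#) → ∃[ t ] ∃[ c ] (x ≡ c F.* co₁ t × y ≡ c F.* co₂ t)
      by-cases (yes x≡0) = nothing , y , trans x≡0 (sym (Fₚ.zeroʳ y)) , sym (Fₚ.*-identityʳ y)
      by-cases (no x≢0)  = let (t , y≡xt) = Fₚ.solve-* x≢0 y in just t , x , sym (Fₚ.*-identityʳ x) , y≡xt

    abstract
      -- The pair (zᵢ, zⱼ) determines z on the E-line, so it is nonzero; normalising it gives the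
      -- parameter t and the factor c.
      rational-surjective : ∀ z {a b} → ¬ (∀ l → z l ≡ F.0#) → embVec z ≐W point a b →
                            ∃[ t ] ∃[ c ] embVec z ≐W (emb c ·W embVec (rational t))
      rational-surjective z {a} {b} z≢0 z-point = multiple (normalise (z i) (z j) zᵢⱼ≢0)
        where
        zᵢⱼ≢0 : ¬ (z i ≡ F.0# × z j ≡ F.0#)
        zᵢⱼ≢0 (zᵢ≡0 , zⱼ≡0) = embVec-≢0 z z≢0 λ l → trans (z-point l) (trans
          (point-determined {a} {b} {E.0#} {E.0#} (at i zᵢ≡0) (at j zⱼ≡0) l) (zero-point l))
          where
          at : ∀ m → z m ≡ F.0# → point a b m ≡ point E.0# E.0# m
          at m e = trans (sym (z-point m)) (trans (trans (cong emb e) emb-0) (sym (zero-point m)))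

        multiple : ∃[ t ] ∃[ c ] (z i ≡ c F.* co₁ t × z j ≡ c F.* co₂ t) →
                   ∃[ t ] ∃[ c ] embVec z ≐W (emb c ·W embVec (rational t))
        multiple (t , c , zᵢ , zⱼ) = t , c , with-point (rational-point t)
          where
          with-point : (∃[ a′ ] ∃[ b′ ] embVec (rational t) ≐W point a′ b′) →
                       embVec z ≐W (emb c ·W embVec (rational t))
          with-point (a′ , b′ , w-point) l = trans (z-point l) (trans
            (point-determined {a} {b} {emb c E.* a′} {emb c E.* b′}
              (at i (trans zᵢ (cong (c F.*_) (sym (rationalᵢ t)))))
              (at j (trans zⱼ (cong (c F.*_) (sym (rationalⱼ t))))) l)
            (scaled l))
            where
            scaled : ∀ l → point (emb c E.* a′) (emb c E.* b′) l ≡ emb c E.* emb (rational t l)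
            scaled l = trans (scale-point (emb c) a′ b′ l) (cong (emb c E.*_) (sym (w-point l)))
            at : ∀ m → z m ≡ c F.* rational t m → point a b m ≡ point (emb c E.* a′) (emb c E.* b′) m
            at m e = trans (sym (z-point m)) (trans (cong emb e) (trans (emb-* c (rational t m)) (sym (scaled m))))

      -- Dividing by `e` transfers membership in the E-line from `P` to the vector over F that
      -- represents it.
      line∩frame : ∀ {P z a b e} → NonzeroW P → P ≐W (e ·W frame (embVec z)) →
                   P ≐W ((a ·W ι u) +W (b ·W ι v)) → ∃[ c ] ∃[ d ] embVec z ≐W point c d
      line∩frame {P} {z} {a} {b} {e} P≢0 m n = with-inverse (E.inverse e e≢0)
        where
        e≢0 : ¬ e ≡ E.0#
        e≢0 e≡0 = P≢0 λ l → trans (m l) (trans (cong (E._* frame (embVec z) l) e≡0) (Eₚ.zeroˡ _))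
        with-inverse : ∃[ d ] e E.* d ≡ E.1# → ∃[ c ] ∃[ d ] embVec z ≐W point c d
        with-inverse (d , ed≡1) = d E.* a , d E.* b ,
          frame-injective {embVec z} {point (d E.* a) (d E.* b)} λ l → begin
            frame (embVec z) l                              ≡⟨ sym (Eₚ.*-identityˡ _) ⟩
            E.1# E.* frame (embVec z) l
              ≡⟨ cong (E._* frame (embVec z) l) (sym ed≡1) ⟩
            (e E.* d) E.* frame (embVec z) l
              ≡⟨ Eₚ.solve 3 (λ e d x → e :* d :* x := d :* (e :* x)) refl e d (frame (embVec z) l) ⟩
            d E.* (e E.* frame (embVec z) l)
              ≡⟨ cong (d E.*_) (trans (sym (m l)) (n l)) ⟩
            d E.* (a E.* ι u l E.+ b E.* ι v l)
              ≡⟨ Eₚ.solve 5 (λ h a b x y → h :* (a :* x :+ b :* y) := h :* a :* x :+ h :* b :* y) refl d a b (ι u l) (ι v l) ⟩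
            (d E.* a) E.* ι u l E.+ (d E.* b) E.* ι v l
              ≡⟨ sym (frame-point (d E.* a) (d E.* b) l) ⟩
            frame (point (d E.* a) (d E.* b)) l             ∎

    OnLineI : W → Set
    OnLineI P = NonzeroW P × TypeI P × OnLineW (ι u) (ι v) P

    rational-onLine : ∀ t → OnLineI (rationalW t)
    rational-onLine t =
      frame-≢0 (embVec-≢0 (rational t) (rational-≢0 t)) ,
      (rational t , rational-≢0 t , E.1# , λ l → sym (Eₚ.*-identityˡ _)) ,
      on-line (rational-point t)
      where
      on-line : (∃[ a ] ∃[ b ] embVec (rational t) ≐W point a b) → OnLineW (ι u) (ι v) (rationalW t)
      on-line (a , b , m) = a , b , λ l →
        trans (frame-cong {embVec (rational t)} {point a b} m l) (frame-point a b l)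

    onLine⇒rational : ∀ P → OnLineI P → ∃[ t ] (t ∈ points × SamePtW P (rationalW t))
    onLine⇒rational P (P≢0 , (z , z≢0 , e , m) , (a , b , n)) =
      step₁ (line∩frame {P} {z} {a} {b} {e} P≢0 m n)
      where
      step₂ : (∃[ t ] ∃[ c ] embVec z ≐W (emb c ·W embVec (rational t))) →
              ∃[ t ] (t ∈ points × SamePtW P (rationalW t))
      step₂ (t , c , r) = t , ∈points t , SamePtW-sym {rationalW t} {P} P≢0 (e E.* emb c , λ l → begin
        P l                                            ≡⟨ m l ⟩
        e E.* frame (embVec z) l
          ≡⟨ cong (e E.*_) (frame-cong {embVec z} {emb c ·W embVec (rational t)} r l) ⟩
        e E.* frame (emb c ·W embVec (rational t)) l
          ≡⟨ cong (e E.*_) (frame-· (emb c) (embVec (rational t)) l) ⟩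
        e E.* (emb c E.* rationalW t l)
          ≡⟨ sym (Eₚ.*-assoc e (emb c) (rationalW t l)) ⟩
        (e E.* emb c) E.* rationalW t l                ∎)
      step₁ : (∃[ c ] ∃[ d ] embVec z ≐W point c d) → ∃[ t ] (t ∈ points × SamePtW P (rationalW t))
      step₁ (c , d , z-point) = step₂ (rational-surjective z {c} {d} z≢0 z-point)

    lineTypeI : LineTypeI q (ι u) (ι v)
    lineTypeI = subst (HasExactly W SamePtW OnLineI) length-points
      (exactly-map rationalW points-unique (λ {t} _ → rational-onLine t)
        (λ {t} {t′} → rational-injective t t′) onLine⇒rational)

    inUniqueHISpace : InUniqueHISpace q u v
    inUniqueHISpace = ι u , ι v , ι-independent ,
      (λ t → emb (co₁ t) , emb (co₂ t) , ι-pt t) , lineTypeI , unique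
      where
      unique : ∀ n₁ n₂ → Indep2W n₁ n₂ → InHSpace u v n₁ n₂ → SameLineW (ι u) (ι v) n₁ n₂
      unique n₁ n₂ _ inH =
        let (a , b , mu) = inH (just F.0#)
            (c , d , mv) = inH nothing
            ιu : ∀ l → ι u l ≡ a E.* n₁ l E.+ b E.* n₂ l
            ιu l = trans (ι-cong {u} {pt u v (just F.0#)} u≐pt0 l) (mu l)
            minor′ : ¬ a E.* d ≡ b E.* c
            minor′ ad≡bc =
              -- d ι u - b ι v = (a d - b c) n₁ and a ι v - c ι u = (a d - b c) n₂. If the
              -- determinant vanished, independence of ι u and ι v would give b = 0 and a = 0, hence
              -- ι u = 0.
              let (_ , c≡0) = ι-independent d (E.- b) λ l → trans (cong₂ (λ x y → d E.* x E.+ (E.- b) E.* y) (ιu l) (mv l))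
                    (trans (Eₚ.solve 6 (λ a b c d x y → d :* (a :* x :+ b :* y) :+ (:- b) :* (c :* x :+ d :* y) := (a :* d :- b :* c) :* x) refl a b c d (n₁ l) (n₂ l))
                      (vanish ad≡bc (n₁ l)))
                  (_ , a≡0) = ι-independent (E.- c) a λ l → trans (cong₂ (λ x y → (E.- c) E.* x E.+ a E.* y) (ιu l) (mv l))
                    (trans (Eₚ.solve 6 (λ a b c d x y → (:- c) :* (a :* x :+ b :* y) :+ a :* (c :* x :+ d :* y) := (a :* d :- b :* c) :* y) refl a b c d (n₁ l) (n₂ l))
                      (vanish ad≡bc (n₂ l)))
                  b≡0 : b ≡ E.0#
                  b≡0 = trans (sym (Eₚ.-‿involutive b)) (trans (cong E.-_ c≡0) Eₚ.-0#≈0#)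
              in ι-≢0 u≢0 λ l → trans (ιu l) (trans (cong₂ (λ x y → x E.* n₁ l E.+ y E.* n₂ l) a≡0 b≡0)
                   (Eₚ.solve 2 (λ x y → :0 :* x :+ :0 :* y := :0) refl (n₁ l) (n₂ l)))
            -- The two solutions are the rows of the inverse of the matrix expressing ι u, ι v in
            -- n₁, n₂.
            (p , r , e₁ , e₂) = Eₚ.minor-spans minor′ E.1# E.0#
            (p′ , r′ , e₁′ , e₂′) = Eₚ.minor-spans minor′ E.0# E.1#
            combine : ∀ p r l → p E.* ι u l E.+ r E.* ι v l ≡ (p E.* a E.+ r E.* c) E.* n₁ l E.+ (p E.* b E.+ r E.* d) E.* n₂ l
            combine p r l = trans (cong₂ (λ x y → p E.* x E.+ r E.* y) (ιu l) (mv l))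
              (Eₚ.solve 8 (λ p r a b c d x y → p :* (a :* x :+ b :* y) :+ r :* (c :* x :+ d :* y) := (p :* a :+ r :* c) :* x :+ (p :* b :+ r :* d) :* y)
                refl p r a b c d (n₁ l) (n₂ l))
        in (p , r , λ l → begin
              n₁ l
                ≡⟨ Eₚ.solve 2 (λ x y → x := :1 :* x :+ :0 :* y) refl (n₁ l) (n₂ l) ⟩
              E.1# E.* n₁ l E.+ E.0# E.* n₂ l
                ≡⟨ cong₂ (λ x y → x E.* n₁ l E.+ y E.* n₂ l) e₁ e₂ ⟩
              (p E.* a E.+ r E.* c) E.* n₁ l E.+ (p E.* b E.+ r E.* d) E.* n₂ l
                ≡⟨ sym (combine p r l) ⟩
              p E.* ι u l E.+ r E.* ι v l              ∎) ,
           (p′ , r′ , λ l → begin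
              n₂ l
                ≡⟨ Eₚ.solve 2 (λ x y → y := :0 :* x :+ :1 :* y) refl (n₁ l) (n₂ l) ⟩
              E.0# E.* n₁ l E.+ E.1# E.* n₂ l
                ≡⟨ cong₂ (λ x y → x E.* n₁ l E.+ y E.* n₂ l) e₁′ e₂′ ⟩
              (p′ E.* a E.+ r′ E.* c) E.* n₁ l E.+ (p′ E.* b E.+ r′ E.* d) E.* n₂ l
                ≡⟨ sym (combine p′ r′ l) ⟩
              p′ E.* ι u l E.+ r′ E.* ι v l            ∎)
        where
        vanish : ∀ {x y} → x ≡ y → ∀ z → (x Eₚ.- y) E.* z ≡ E.0#
        vanish {x} refl z = trans (cong (E._* z) (Eₚ.-‿inverseʳ x)) (Eₚ.zeroˡ z)

  -- The three types of fixed line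

  Trichotomy : ℤ.ℤ → Set
  Trichotomy n =
    ((∀ t → Fixed (pt u v t)) × MeetsSI u v (ℤ.+ q ℤ.+ ℤ.+ 1) × InPtwiseFixedPlane u v)
    ⊎ (PointsWith u v Fixed (n ℤ.+ ℤ.+ 1) × PointsWith u v IColPoint (ℤ.+ q ℤ.- n) × InSIPlane u v)
    ⊎ (PointsWith u v Fixed (n ℤ.+ ℤ.+ 1) × PointsWith u v IIColPoint (ℤ.+ q ℤ.- n) ×
       MeetsSI u v (n ℤ.+ ℤ.+ 1) × MeetsSII u v (ℤ.+ q ℤ.- n) × InUniqueHISpace q u v)

  trichotomy : 2 ℕ.< q → ∀ n → (n ≡ ℤ.-[1+ 0 ] ⊎ n ≡ ℤ.+ 0 ⊎ n ≡ ℤ.+ 1) →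
               (ℤ.+ 3) ℤ.∣ (ℤ.+ q ℤ.- n) → Trichotomy n
  trichotomy 2<q n n∈ 3∣q-n =
    split fixedPoints refl (Allₚ.all-filter fixed? points) (Uniqueₚ.filter⁺ fixed? points-unique)
    where
    few : length fixedPoints ℕ.≤ 2 → Trichotomy n
    few ≤2 = [ (λ (_ , _ , minor , _) → inj₂ (inj₂ (independent minor))) ,
               (λ prop → let (c , m) = Eₚ.proportional⇒multiple (E-≟ _≟_) (ψ u) (ψ v) (ψ-≢0 u≢0) prop
                         in inj₂ (inj₁ (dependent c m))) ]′
             (Eₚ.completes⊎proportional (E-≟ _≟_) (ψ u) (ψ v))
      where
      moved = movedPoints-multiple-of-3 s s³≡id _≟ₚ_ points-unique ∈points
      counts = fixedPoint-count {q} {length fixedPoints} {proj₁ moved} n 2<q ≤2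
        (trans (cong (length fixedPoints ℕ.+_) (sym (proj₂ moved))) (trans (length-filter-¬ fixed? points) length-points))
        n∈ 3∣q-n
      #fixed : ℤ.+ length fixedPoints ≡ n ℤ.+ ℤ.+ 1
      #fixed = proj₁ counts
      #moved : ℤ.+ length movedPoints ≡ ℤ.+ q ℤ.- n
      #moved = trans (cong ℤ.+_ (proj₂ moved)) (proj₂ counts)

      dependent : ∀ c → (∀ l → ψ v l ≡ c E.* ψ u l) →
        PointsWith u v Fixed (n ℤ.+ ℤ.+ 1) × PointsWith u v IColPoint (ℤ.+ q ℤ.- n) × InSIPlane u v
      dependent c m = (_ , #fixed , fixed-exactly) , (_ , #moved , IPoints-exactly) , inSIPlane
        where open InOneSPlane c m

      independent : ∀ {i j} → ¬ ψ u i E.* ψ v j ≡ ψ u j E.* ψ v i →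
        PointsWith u v Fixed (n ℤ.+ ℤ.+ 1) × PointsWith u v IIColPoint (ℤ.+ q ℤ.- n) ×
        MeetsSI u v (n ℤ.+ ℤ.+ 1) × MeetsSII u v (ℤ.+ q ℤ.- n) × InUniqueHISpace q u v
      independent minor = (_ , #fixed , fixed-exactly) , (_ , #moved , IIPoints-exactly) ,
        (_ , #fixed , meetsSI) , (_ , #moved , meetsSII) , inUniqueHISpace
        where open EIndependent minor

    -- The list is generalised to `ts`, with an equation, so that it can be matched while `few`
    -- still speaks of `fixedPoints`.
    split : ∀ ts → fixedPoints ≡ ts → All (λ t → s t ≡ t) ts → Unique ts → Trichotomy n
    split [] e _ _ = few (subst (λ ts → length ts ℕ.≤ 2) (sym e) ℕ.z≤n)
    split (_ ∷ []) e _ _ = few (subst (λ ts → length ts ℕ.≤ 2) (sym e) (ℕ.s≤s ℕ.z≤n))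
    split (_ ∷ _ ∷ []) e _ _ = few (subst (λ ts → length ts ℕ.≤ 2) (sym e) (ℕ.s≤s (ℕ.s≤s ℕ.z≤n)))
    split (t₁ ∷ t₂ ∷ t₃ ∷ _) _ (f₁ ∷ f₂ ∷ f₃ ∷ _) ((t₁≢t₂ ∷ t₁≢t₃ ∷ _) ∷ (t₂≢t₃ ∷ _) ∷ _) =
      let (k , scalar) = three-fixed⇒scalar t₁≢t₂ t₁≢t₃ t₂≢t₃ f₁ f₂ f₃
          open PtwiseFixed k scalar
      in inj₁ (all-Fixed , meetsSI , inPtwiseFixedPlane)

open import Data.Nat using (ℕ; _<_)
open import Data.Integer using (ℤ; +_; -[1+_]; _+_; _-_)
open import Data.Integer.Divisibility using (_∣_)

theorem2 : (q : ℕ) → 2 < q → IsPrimePower q →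
    (n : ℤ) → (n ≡ -[1+ 0 ] ⊎ n ≡ + 0 ⊎ n ≡ + 1) → (+ 3) ∣ (+ q - n) →
    (F : Field) → HasSize F q → (K : CubicExt F) →
    let open Geometry F K in
    (φ : W → W) → IsCollineation φ → HasOrder3W φ →
    (S : Subplane) → FixesPtwise φ S →
    (σ : V → V) → IsProjectivity σ → HasOrder3V σ → Induces σ φ →
    let open Config φ S σ in
    (u v : V) → Indep2V u v → LineFixed u v →
    ((∀ t → Fixed (pt u v t)) × MeetsSI u v (+ q + + 1) × InPtwiseFixedPlane u v)
    ⊎ (PointsWith u v Fixed (n + + 1) × PointsWith u v IColPoint (+ q - n) ×
    InSIPlane u v)
    ⊎ (PointsWith u v Fixed (n + + 1) × PointsWith u v IIColPoint (+ q - n) ×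
    MeetsSI u v (n + + 1) × MeetsSII u v (+ q - n) × InUniqueHISpace q u v)
theorem2 q 2<q _ n n∈ 3∣q-n F size K φ isCollineation order3W S fixesPtwise
  σ isProjectivity order3V induces u v uv-indep lineFixed =
  FixedLine.trichotomy F K size φ isCollineation order3W S fixesPtwise
    σ isProjectivity order3V induces u v uv-indep lineFixed 2<q n n∈ 3∣q-n
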